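{- The following statements hold. (1) Every finite set $P$ of prime numbers with $|P|\le 4$ is of finite type. (2) For every integer $r\ge 5$, there exist only finitely many primitive sets $P$ with $|P|=r$. (3) For a positive integer $M$ put $P(M)=\{p \text{ prime} : p^2\mid M\}$, and for a positive integer $N$ put $$\mathcal{A}(N)=\{M\in\mathbb{N} : M\le N,\ P(M)\text{ is of finite type}\}.$$ Then $$0.99999991254\ \le\ \lim_{N\to\infty}\frac{|\mathcal{A}(N)|}{N}\ \le\ 0.9999999153 .$$
   Context: $\mathbb{N}$ denotes the set of positive integers. For a finite set $P$ of primes, $N(P)=\prod_{p\in P}p$. For $(x,y)\in\mathbb{N}^2$, the additive prime tree $\mathrm{APT}_P(x,y)$ is the smallest subset of $\mathbb{N}^2$ such that: (i) $(x,y)\in \mathrm{APT}_P(x,y)$; (ii) if $(X,Y)\in\mathrm{APT}_P(x,y)$, $\gcd(X,Y,N(P))=1$, and there exist $p,p'\in P$ with $p\mid X$ and $p'\mid Y$, then $(X,X+Y)\in\mathrm{APT}_P(x,y)$ and $(X+Y,Y)\in\mathrm{APT}_P(x,y)$. $P$ is of finite type if $\mathrm{APT}_P(x,y)$ is finite for every $(x,y)\in\mathbb{N}^2$; otherwise $P$ is of infinite type. A finite set $P$ of primes is a primitive set if it is of infinite type and every proper subset of $P$ is of finite type. -}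

module Defs where

open import Level using (Level; _⊔_)
open import Data.Nat using (ℕ; suc; _+_; _*_; _^_; _≤_; NonZero; s≤s)
open import Data.Nat.Divisibility using (_∣_; _∣?_; ∣⇒≤; ∣-trans; m∣m*n)
open import Data.Nat.GCD using (gcd)
open import Data.Nat.ListAction using (product)
open import Data.Nat.Primality using (Prime; prime?)
open import Data.Integer using (+_)
import Data.Rational as ℚ
open ℚ using (ℚ)
open import Data.Rational.Properties
  using (≤-trans; ≤-reflexive; +-inverseʳ; +-mono-≤; nonNegative⁻¹; normalize-nonNeg)
open import Data.List using (List; length; filter; upTo)
open import Data.List.Membership.Propositional using (_∈_)
open import Data.List.Membership.Propositional.Properties
  using (∈-filter⁺; ∈-filter⁻; ∈-upTo⁺)
open import Data.List.Relation.Binary.Subset.Propositional using (_⊆_)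
open import Data.List.Relation.Unary.All as All using (All)
open import Data.List.Relation.Unary.All.Properties using (all-filter)
open import Data.List.Relation.Unary.Any using (Any)
open import Data.List.Relation.Unary.Unique.Propositional using (Unique)
import Data.List.Relation.Unary.Unique.Propositional.Properties as Unique
open import Data.Product using (∃; _×_; _,_; proj₁; proj₂)
open import Function.Bundles using (_⇔_; mk⇔)
open import Relation.Binary.Core using (Rel)
open import Relation.Binary.PropositionalEquality using (_≡_; cong)
open import Relation.Nullary using (¬_; Dec)
open import Relation.Nullary.Decidable using (_×-dec_)
open import Relation.Unary using (Pred)

private
  variable
    a ℓ p : Level

-- A predicate is finite when some list exhausts it up to _≈_; the list may
-- also contain elements outside the predicate.
Finite : {A : Set a} → Rel A ℓ → Pred A p → Set (a ⊔ ℓ ⊔ p)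
Finite {A = A} _≈_ S = ∃ λ (xs : List A) → ∀ x → S x → Any (x ≈_) xs

HasCardinality : {A : Set a} → Pred A p → ℕ → Set (a ⊔ p)
HasCardinality {A = A} S n =
  ∃ λ (xs : List A) → Unique xs × (∀ x → x ∈ xs ⇔ S x) × length xs ≡ n

-- The order of the list carries no meaning: sets are compared with _≋_.
record PrimeSet : Set where
  field
    elements : List ℕ
    unique   : Unique elements
    primes   : All Prime elements

open PrimeSet public

card : PrimeSet → ℕ
card P = length (elements P)

infix 4 _≋_ _⊊_

_≋_ : PrimeSet → PrimeSet → Set
P ≋ Q = elements P ⊆ elements Q × elements Q ⊆ elements P

_⊊_ : PrimeSet → PrimeSet → Set
Q ⊊ P = elements Q ⊆ elements P × ¬ (elements P ⊆ elements Q)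

N : PrimeSet → ℕ
N P = product (elements P)

data APT (P : PrimeSet) (x y : ℕ) : Pred (ℕ × ℕ) Level.zero where
  root  : APT P x y (x , y)
  stepʳ : ∀ {X Y} → APT P x y (X , Y) → gcd (gcd X Y) (N P) ≡ 1 →
          (∃ λ p → p ∈ elements P × p ∣ X) →
          (∃ λ p′ → p′ ∈ elements P × p′ ∣ Y) →
          APT P x y (X , X + Y)
  stepˡ : ∀ {X Y} → APT P x y (X , Y) → gcd (gcd X Y) (N P) ≡ 1 →
          (∃ λ p → p ∈ elements P × p ∣ X) →
          (∃ λ p′ → p′ ∈ elements P × p′ ∣ Y) →
          APT P x y (X + Y , Y)

FiniteType : PrimeSet → Set
FiniteType P = ∀ x y .{{_ : NonZero x}} .{{_ : NonZero y}} → Finite _≡_ (APT P x y)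

InfiniteType : PrimeSet → Set
InfiniteType P = ¬ FiniteType P

Primitive : PrimeSet → Set
Primitive P = InfiniteType P × (∀ Q → Q ⊊ P → FiniteType Q)

squareDivisor? : ∀ M p → Dec (Prime p × p ^ 2 ∣ M)
squareDivisor? M p = prime? p ×-dec (p ^ 2 ∣? M)

-- P(M): searching below suc M loses nothing when M is positive
-- (see ∈-squarePrimes).
squarePrimes : ℕ → PrimeSet
squarePrimes M = record
  { elements = filter (squareDivisor? M) (upTo (suc M))
  ; unique   = Unique.filter⁺ (squareDivisor? M) (Unique.upTo⁺ (suc M))
  ; primes   = All.map proj₁ (all-filter (squareDivisor? M) (upTo (suc M)))
  }

∈-squarePrimes : ∀ M .{{_ : NonZero M}} p →
                 p ∈ elements (squarePrimes M) ⇔ (Prime p × p ^ 2 ∣ M)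
∈-squarePrimes M p = mk⇔
  (λ p∈ → proj₂ (∈-filter⁻ (squareDivisor? M) {xs = upTo (suc M)} p∈))
  (λ (pr , p²∣M) → ∈-filter⁺ (squareDivisor? M)
    (∈-upTo⁺ (s≤s (∣⇒≤ (∣-trans (m∣m*n (p * 1)) p²∣M)))) (pr , p²∣M))

𝒜 : ℕ → Pred ℕ Level.zero
𝒜 n M = 1 ≤ M × M ≤ n × FiniteType (squarePrimes M)

-- Real numbers as Bishop's regular sequences of rationals; the sequence is
-- indexed from 0, so its n-th term is within 1/(n+1) of the real number.
record ℝ : Set where
  field
    seq     : ℕ → ℚ
    regular : ∀ m n → ℚ.∣ seq m ℚ.- seq n ∣ ℚ.≤ (+ 1 ℚ./ suc m) ℚ.+ (+ 1 ℚ./ suc n)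

open ℝ public

infix 4 _≤ℝ_ _⟶_

_≤ℝ_ : ℝ → ℝ → Set
x ≤ℝ y = ∀ n → seq x n ℚ.≤ seq y n ℚ.+ (+ 2 ℚ./ suc n)

fromℚ : ℚ → ℝ
fromℚ q = record { seq = λ _ → q ; regular = const-regular }
  where
  1/_ : ℕ → ℚ
  1/ k = + 1 ℚ./ suc k
  0≤1/_ : ∀ k → ℚ.0ℚ ℚ.≤ 1/ k
  0≤1/ k = nonNegative⁻¹ (1/ k) {{normalize-nonNeg 1 (suc k)}}
  const-regular : ∀ m n → ℚ.∣ q ℚ.- q ∣ ℚ.≤ (+ 1 ℚ./ suc m) ℚ.+ (+ 1 ℚ./ suc n)
  const-regular m n = ≤-trans (≤-reflexive (cong ℚ.∣_∣ (+-inverseʳ q)))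
    (+-mono-≤ {ℚ.0ℚ} {1/ m} {ℚ.0ℚ} {1/ n} (0≤1/ m) (0≤1/ n))

-- s n → L over positive n; the two inequalities say |s n - L| ≤ ε.
_⟶_ : ((n : ℕ) .{{_ : NonZero n}} → ℚ) → ℝ → Set
s ⟶ L = ∀ ε → ℚ.0ℚ ℚ.< ε → ∃ λ n₀ → ∀ n .{{_ : NonZero n}} → n₀ ≤ n →
  fromℚ (s n ℚ.- ε) ≤ℝ L × L ≤ℝ fromℚ (s n ℚ.+ ε)

{-# OPTIONS --safe #-}
module Submission where

-- A path in the tree of P is followed through the residues of its entries, so P is
-- of infinite type exactly when some path, started at a pair with no common factor
-- in P, returns to its residues modulo N(P); this is decidable.
--
-- Along a path every entry is a linear form a x + b y in the starting pair, and
-- every new entry must be divisible by a prime of P. A prime dividing two entries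
-- divides the determinant of the two forms. Hence a finite search, branching over
-- the direction of the path and over which entries share a prime, shows that a set
-- of at most six primes is of finite type unless it contains one of 29 explicit
-- sets, all of them with at least five elements. To keep the search small it is
-- started only at positions (given by the residues modulo 2, 3 and 5) that no long
-- path can avoid.
--
-- For (2), a prime that is large compared with a path of bounded length divides at
-- most one of its entries. So if the primes up to b form a set of finite type and
-- all other primes of P exceed a bound depending on b and |P| only, P is of finite
-- type; this bounds the next prime of a primitive set in terms of the previous ones.
--
-- For (3), replacing P(M) by its part below y changes the status of at most N / y
-- of the M up to N and makes it periodic in M, which gives the limit. The sets
-- {2,3,5,7,19} and {2,3,5,13,17} are of infinite type and give the upper bound. For
-- the lower bound an M of infinite type contains one of the 29 sets or at least
-- seven primes; the density of the second event is at most the sum of 1 / N(S)^2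
-- over the sets S of seven primes containing none of the 29.

open import Defs
open import Agda.Builtin.Nat using (div-helper; mod-helper)
open import Data.Bool using (Bool; true; false; if_then_else_; _∧_; T)
open import Data.Bool.ListAction using (all)
open import Data.Empty using (⊥; ⊥-elim)
import Data.Fin as Fin
open import Data.Fin using (Fin; zero; suc; toℕ; fromℕ<; combine)
open import Data.Fin.Properties using (pigeonhole; combine-injective; toℕ-fromℕ<)
import Data.Integer as ℤ
import Data.Integer.Properties as ℤₚ
open import Data.List using (List; []; _∷_; _++_; length; map; filter; upTo; applyUpTo; concat; replicate; drop; zipWith)
open import Data.List.Membership.Propositional using (_∈_; find; lose)
open import Data.List.Membership.Propositional.Properties
  using (∈-++⁺ˡ; ∈-++⁺ʳ; ∈-++⁻; ∈-filter⁺; ∈-filter⁻; ∈-∃++; ∈-map⁺; ∈-map⁻; ∈-upTo⁺; ∈-length)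
open import Data.List.Properties using (map-++; ++-identityʳ; ++-assoc; ≡-dec; filter-accept; filter-reject)
open import Data.List.Relation.Binary.Permutation.Propositional
  using (_↭_; ↭-refl; ↭-sym; ↭-trans; ↭-reflexive; prep; swap; ↭⇒↭ₛ)
open import Data.List.Relation.Binary.Permutation.Propositional.Properties
  using (map⁺; All-resp-↭; shift; ++⁺ˡ; ↭-length; ∈-resp-↭)
import Data.List.Relation.Binary.Permutation.Setoid.Properties as Perm
open import Data.List.Relation.Binary.Subset.Propositional using (_⊆_)
open import Data.List.Relation.Unary.All as All using (All; []; _∷_)
open import Data.List.Relation.Unary.All.Properties using (¬All⇒Any¬)
open import Data.List.Relation.Unary.AllPairs using ([]; _∷_)
open import Data.List.Relation.Unary.Any as Any using (Any; here; there)
open import Data.List.Relation.Unary.Unique.Propositional using (Unique)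
import Data.List.Relation.Unary.Unique.Propositional.Properties as Unique
open import Data.Maybe using (Maybe; just; nothing)
open import Data.Nat
open import Data.Nat.Coprimality using (Coprime; coprime-divisor; coprime⇒gcd≡1)
open import Data.Nat.Divisibility
open import Data.Nat.DivMod
open import Data.Nat.GCD using (gcd; gcd-greatest; gcd[m,n]∣m; gcd[m,n]∣n)
open import Data.Nat.ListAction using (product; sum)
open import Data.Nat.Primality
open import Data.Nat.Properties
open import Data.Nat.Tactic.RingSolver using (solve-∀)
open import Data.List.Membership.DecPropositional _≟_ using (_∈?_)
open import Data.List.Relation.Unary.Unique.DecPropositional _≟_ using (unique?)
open import Data.Product using (∃; ∃₂; _×_; _,_; proj₁; proj₂)
import Data.Rational as ℚ
open import Data.Rational using (ℚ; mkℚ)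
import Data.Rational.Properties as ℚₚ
import Data.Rational.Unnormalised as ℚᵘ
open import Data.Rational.Unnormalised using (mkℚᵘ)
import Data.Rational.Unnormalised.Properties as ℚᵘₚ
open import Data.Sum as Sum using (_⊎_; inj₁; inj₂; [_,_]′)
open import Data.Unit using (⊤; tt)
open import Function using (_∘_; case_of_; id; it)
open import Function.Bundles using (Equivalence; mk⇔)
open import Relation.Binary.PropositionalEquality
open import Relation.Nullary using (¬_; Dec; yes; no; contradiction)
open import Relation.Nullary.Decidable using (_×-dec_; _⊎-dec_; ¬?; decidable-stable; from-yes; map′)

-- Both children of a pair inherit its gcd condition, so it is imposed once, at the start (`Good`),
-- and a path is afterwards only a chain of covered entries (`Live`). Modulo a prime p that does not
-- divide both x and y, only the projective point (x : y) matters. One linear form divisible by p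
-- fixes this point and thereby all forms divisible by p; so once every prime is tied to a form, the
-- rest of the search is plain evaluation at one integer point, glued together by the Chinese
-- remainder theorem.
--
-- The searches are run by the type checker. They are therefore Boolean functions with soundness
-- proved separately, and large constants are hidden behind `abstract` or parameters.
--
-- In (3) the margin is narrow: the numbers with one of the two five-element sets have density about
-- 8.556 / 10^8, and 8.746 / 10^8 is allowed in all. Less than 0.2 / 10^8 is left for the other 27
-- sets and for seven primes, so overlaps among the 29 are subtracted and the sets of seven primes
-- are sorted out by their small members.

-- Paths of given length and coprimality along them

-- The index counts steps, and the pair reached last need not be covered. To know that the next sum
-- is covered two steps are required, hence the `2 + d` in the soundness statements.
data Live (ps : List ℕ) : ℕ → ℕ → ℕ → Set where
  stop : ∀ {x y} → Live ps zero x y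
  step : ∀ {d x y} → Any (_∣ x) ps × Any (_∣ y) ps × (Live ps d x (x + y) ⊎ Live ps d (x + y) y) →
         Live ps (suc d) x y

Good : List ℕ → ℕ → ℕ → Set
Good ps x y = ∀ {p} → p ∈ ps → p ∣ x → p ∣ y → ⊥

live-swap : ∀ {ps} d {x y} → Live ps d x y → Live ps d y x
live-swap zero l = stop
live-swap {ps} (suc d) {x} {y} (step (cx , cy , inj₁ l)) =
  step (cy , cx , inj₂ (subst (λ z → Live ps d z x) (+-comm x y) (live-swap d l)))
live-swap {ps} (suc d) {x} {y} (step (cx , cy , inj₂ l)) =
  step (cy , cx , inj₁ (subst (Live ps d y) (+-comm x y) (live-swap d l)))

live-anti : ∀ {ps x y} d e → Live ps (d + e) x y → Live ps d x y
live-anti zero e l = stop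
live-anti (suc d) e (step (cx , cy , inj₁ l)) = step (cx , cy , inj₁ (live-anti d e l))
live-anti (suc d) e (step (cx , cy , inj₂ l)) = step (cx , cy , inj₂ (live-anti d e l))

good-swap : ∀ {ps x y} → Good ps x y → Good ps y x
good-swap g p∈ p∣y p∣x = g p∈ p∣x p∣y

good-stepʳ : ∀ {ps x y} → Good ps x y → Good ps x (x + y)
good-stepʳ g p∈ p∣x p∣x+y = g p∈ p∣x (∣m+n∣m⇒∣n p∣x+y p∣x)

good-stepˡ : ∀ {ps x y} → Good ps x y → Good ps (x + y) y
good-stepˡ {x = x} {y} g {p} p∈ p∣x+y p∣y =
  g p∈ (∣m+n∣m⇒∣n (subst (p ∣_) (+-comm x y) p∣x+y) p∣y) p∣y

unique-⊆⇒length≤ : ∀ {A : Set} {xs ys : List A} → Unique xs → xs ⊆ ys → length xs ≤ length ys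
unique-⊆⇒length≤ [] xs⊆ys = z≤n
unique-⊆⇒length≤ {ys = ys} (_∷_ {x = x} {xs} x≢ u) x∷xs⊆ys
  with ∈-∃++ (x∷xs⊆ys (here refl))
... | as , bs , refl = subst (suc (length xs) ≤_) (sym (↭-length (shift x as bs)))
      (s≤s (unique-⊆⇒length≤ u xs⊆as++bs))
  where
  xs⊆as++bs : xs ⊆ as ++ bs
  xs⊆as++bs {z} z∈ with ∈-resp-↭ (shift x as bs) (x∷xs⊆ys (there z∈))
  ... | here z≡x = contradiction (sym z≡x) (All.lookup x≢ z∈)
  ... | there z∈′ = z∈′

-- Linear forms in the starting pair and their determinants

data Form : Set where
  _·x+_·y : ℕ → ℕ → Form

at : ℕ → ℕ → Form → ℕ
at x y (a ·x+ b ·y) = a * x + b * y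

infixl 6 _⊞_
_⊞_ : Form → Form → Form
(a ·x+ b ·y) ⊞ (c ·x+ d ·y) = (a + c) ·x+ (b + d) ·y

at-⊞ : ∀ x y f g → at x y (f ⊞ g) ≡ at x y f + at x y g
at-⊞ x y (a ·x+ b ·y) (c ·x+ d ·y) = lemma a b c d x y
  where
  lemma : ∀ a b c d x y → (a + c) * x + (b + d) * y ≡ (a * x + b * y) + (c * x + d * y)
  lemma = solve-∀

-- The absolute value of the determinant: one of the two truncated differences is zero.
det : Form → Form → ℕ
det (a ·x+ b ·y) (c ·x+ d ·y) = (b * c ∸ a * d) + (a * d ∸ b * c)

module _ {p x y : ℕ} (pr : Prime p) (indivisible : p ∣ x → p ∣ y → ⊥) where

  ∣-both : ∀ {k} → p ∣ k * x → p ∣ k * y → p ∣ k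
  ∣-both {k} p∣kx p∣ky with euclidsLemma k x pr p∣kx | euclidsLemma k y pr p∣ky
  ... | inj₁ p∣k | _        = p∣k
  ... | inj₂ _   | inj₁ p∣k = p∣k
  ... | inj₂ p∣x | inj₂ p∣y = ⊥-elim (indivisible p∣x p∣y)

  -- Modulo p the hypotheses say v = -a and (x : y) = (u : v) as projective points, so a form that
  -- vanishes at one vanishes at the other.
  kills : ∀ {a u v} → p ∣ a * x + u * y → p ∣ v + a → ∀ c d → p ∣ c * x + d * y → p ∣ u * c + v * d
  kills {a} {u} {v} p∣ax+uy p∣v+a c d p∣g = ∣-both
    (∣m+n∣m⇒∣n {m = d * (a * x + u * y)}
      (subst (p ∣_) (eqˣ a u v c d x y) (∣m∣n⇒∣m+n (∣n⇒∣m*n u p∣g) (∣n⇒∣m*n (d * x) p∣v+a)))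
      (∣n⇒∣m*n d p∣ax+uy))
    (∣m+n∣m⇒∣n {m = a * (c * x + d * y)}
      (subst (p ∣_) (eqʸ a u v c d x y) (∣m∣n⇒∣m+n (∣n⇒∣m*n c p∣ax+uy) (∣n⇒∣m*n (d * y) p∣v+a)))
      (∣n⇒∣m*n a p∣g))
    where
    eqˣ : ∀ a u v c d x y → u * (c * x + d * y) + d * x * (v + a) ≡ d * (a * x + u * y) + (u * c + v * d) * x
    eqˣ = solve-∀
    eqʸ : ∀ a u v c d x y → c * (a * x + u * y) + d * y * (v + a) ≡ a * (c * x + d * y) + (u * c + v * d) * y
    eqʸ = solve-∀

  -- Eliminating y and x from the two forms leaves k x and k y, both divisible by p.
  ∣det′ : ∀ {a b c d k} → a * d + k ≡ b * c → p ∣ a * x + b * y → p ∣ c * x + d * y → p ∣ k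
  ∣det′ {a} {b} {c} {d} {k} eq p∣f p∣g = ∣-both
    (∣m+n∣m⇒∣n {m = d * (a * x + b * y)} (subst (p ∣_) eqˣ (∣n⇒∣m*n b p∣g)) (∣n⇒∣m*n d p∣f))
    (∣m+n∣m⇒∣n {m = a * (c * x + d * y)} (subst (p ∣_) eqʸ (∣n⇒∣m*n c p∣f)) (∣n⇒∣m*n a p∣g))
    where
    open ≡-Reasoning
    e₁ : ∀ b c d x y → b * (c * x + d * y) ≡ (b * c) * x + b * d * y
    e₁ = solve-∀
    e₂ : ∀ a b d k x y → (a * d + k) * x + b * d * y ≡ d * (a * x + b * y) + k * x
    e₂ = solve-∀
    eqˣ : b * (c * x + d * y) ≡ d * (a * x + b * y) + k * x
    eqˣ = trans (e₁ b c d x y) (trans (cong (λ z → z * x + b * d * y) (sym eq)) (e₂ a b d k x y))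
    e₃ : ∀ a b c x y → c * (a * x + b * y) ≡ a * c * x + (b * c) * y
    e₃ = solve-∀
    e₄ : ∀ a c d k x y → a * c * x + (a * d + k) * y ≡ a * (c * x + d * y) + k * y
    e₄ = solve-∀
    eqʸ : c * (a * x + b * y) ≡ a * (c * x + d * y) + k * y
    eqʸ = trans (e₃ a b c x y) (trans (cong (λ z → a * c * x + z * y) (sym eq)) (e₄ a c d k x y))

  ∣det : ∀ f g → p ∣ at x y f → p ∣ at x y g → p ∣ det f g
  ∣det (a ·x+ b ·y) (c ·x+ d ·y) p∣f p∣g with ≤-total (a * d) (b * c)
  ... | inj₁ ad≤bc = subst (p ∣_)
        (sym (trans (cong (b * c ∸ a * d +_) (m≤n⇒m∸n≡0 ad≤bc)) (+-identityʳ _)))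
        (∣det′ {a} {b} {c} {d} (m+[n∸m]≡n ad≤bc) p∣f p∣g)
  ... | inj₂ bc≤ad = subst (p ∣_)
        (sym (cong (_+ (a * d ∸ b * c)) (m≤n⇒m∸n≡0 bc≤ad)))
        (∣det′ {c} {d} {a} {b}
          (trans (cong (_+ (a * d ∸ b * c)) (*-comm c b))
            (trans (m+[n∸m]≡n bc≤ad) (*-comm a d))) p∣g p∣f)

-- The search

-- known ms u v n: the primes suc m (m in ms), with product n, are attached to
-- forms they divide; a prime of the list that divides c x + d y divides u c + v d.
data Known : Set where
  known : List ℕ → ℕ → ℕ → ℕ → Known

infixl 7 _mod-suc_
-- The built-in remainder called directly: by definition it is `w % suc m`, but it takes no instance
-- argument. For its sake divisors are stored as predecessors.
_mod-suc_ : ℕ → ℕ → ℕ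
w mod-suc m = mod-helper 0 m w m

isZero : ℕ → Bool
isZero zero    = true
isZero (suc _) = false

consNew : ℕ → List ℕ → List ℕ
consNew d [] = d ∷ []
consNew d (q ∷ qs) = if d ≡ᵇ q then q ∷ qs else d ∷ q ∷ qs

consFactor : ℕ → Maybe (List ℕ) → Maybe (List ℕ)
consFactor d (just qs) = just (consNew d qs)
consFactor d nothing   = nothing

-- Trial division from d + 1 on. The candidate is written d + 1 and not suc d
-- because the evaluator keeps sums, but not successors, as machine integers.
primeFactors   : ℕ → ℕ → ℕ → Maybe (List ℕ)
primeFactors-% : ℕ → ℕ → ℕ → ℕ → Maybe (List ℕ)
primeFactors-< : Bool → ℕ → ℕ → ℕ → Maybe (List ℕ)
primeFactors zero    d n = nothing
primeFactors (suc k) d n = primeFactors-% (n mod-suc d) k d n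
primeFactors-% zero    k d n = consFactor (d + 1) (primeFactors k d (div-helper 0 d n d))
primeFactors-% (suc _) k d n = primeFactors-< (n <ᵇ (d + 1) * (d + 1)) k d n
primeFactors-< true  k d n = just (if n ≡ᵇ 1 then [] else n ∷ [])
primeFactors-< false k d n = primeFactors k (d + 1) n

divided   : List ℕ → ℕ → Bool
divided-% : ℕ → List ℕ → ℕ → Bool
divided []       w = false
divided (m ∷ ms) w = divided-% (w mod-suc m) ms w
divided-% zero    ms w = true
divided-% (suc _) ms w = divided ms w

covered : Known → Form → Bool
covered (known ms u v n) f = divided ms (at u v f)

-- The Chinese remainder theorem up to scaling. Modulo the old primes the new point is q (u, v), and
-- modulo q = `suc m` it is n (b, -a), where the form vanishes; the factors q and n are units there
-- when q is a new prime.
attach : ℕ → Form → Known → Known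
attach zero    f k = k
attach (suc m) (a ·x+ b ·y) (known ms u v n) = known (ms ++ m ∷ [])
  (u * suc m + (b mod-suc m) * n) (v * suc m + (suc m ∸ a mod-suc m) * n) (n * suc m)

known? : ℕ → Known → Bool
known? zero    k = true
known? (suc m) (known ms u v n) = isZero (n mod-suc m)

multipleOf   : List ℕ → ℕ → Bool
multipleOf-% : ℕ → List ℕ → ℕ → Bool
multipleOf []           n = false
multipleOf (zero  ∷ es) n = multipleOf es n
multipleOf (suc m ∷ es) n = multipleOf-% (n mod-suc m) es n
multipleOf-% zero    es n = true
multipleOf-% (suc _) es n = multipleOf es n

multipleOfSome : List ℕ → Known → Bool
multipleOfSome es (known ms u v n) = multipleOf es n

Refuter : Set
Refuter = Known → List Form → ℕ → Bool

pick : (Form → List Form → Bool) → List Form → Bool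
pick k []       = true
pick k (f ∷ fs) = k f fs ∧ pick (λ g gs → k g (f ∷ gs)) fs

-- Applies when every prime is attached. Evaluated at the point (u, v), an entry shows whether it
-- can be covered, so both directions are followed until a sum is uncovered.
dead  : ℕ → List ℕ → ℕ → ℕ → Bool
dead? : Bool → ℕ → List ℕ → ℕ → ℕ → Bool
dead zero    ms v w = false
dead (suc d) ms v w = dead? (divided ms (v + w)) d ms v w
dead? false d ms v w = true
dead? true  d ms v w = dead d ms v (v + w) ∧ dead d ms (v + w) w

module Search (es : List ℕ) where

  -- Each number in `es` has, by assumption, a prime factor outside the set. A branch whose attached
  -- primes include all prime factors of such a number is closed.
  avoid : Refuter → Known → List Form → ℕ → Bool
  avoid r k fs s = if multipleOfSome es k then true else r k fs s

  identify : Refuter → Known → Form → List Form → ℕ → List ℕ → Bool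
  identify r k f fs s []       = true
  identify r k f fs s (q ∷ qs) =
    -- An attached prime cannot also be the unidentified prime of f, since the two are distinct
    -- primes of the set.
    (if known? q k then true else avoid r (attach q f k) fs s) ∧ identify r k f fs s qs

  identifyAny : Refuter → Known → Form → List Form → ℕ → Maybe (List ℕ) → Bool
  identifyAny r k f fs s nothing   = false
  identifyAny r k f fs s (just qs) = identify r k f fs s qs

  fresh : Refuter → Form → Refuter
  fresh r z k fs zero    = true
  fresh r z k fs (suc s) = r k (z ∷ fs) s

  -- The form z has to be divisible by one of the primes: by an attached one, by
  -- one not met so far, or by one that was only known to divide some f of fs, and
  -- then this prime divides det f z.
  cover : Refuter → Form → Refuter
  cover r z k fs s =
    if covered k z then r k fs s
    else (fresh r z k fs s
      ∧ pick (λ f gs → identifyAny r k f gs s (primeFactors 5000 1 (det f z))) fs)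

  -- Here `fs` lists forms whose primes have been met without being identified, and `s` bounds the
  -- number of primes not met yet. With both exhausted no branching remains and `dead` takes over.
  refute  : ℕ → Form → Form → Refuter
  refute′ : ℕ → Form → Form → Refuter
  refute d f g (known ms u v n) [] zero = dead d ms (at u v f) (at u v g)
  refute d f g k fs@[] s@(suc _) = refute′ d f g k fs s
  refute d f g k fs@(_ ∷ _) s = refute′ d f g k fs s
  refute′ zero    f g k fs s = false
  refute′ (suc d) f g = cover
    (λ k fs s → refute d f (f ⊞ g) k fs s ∧ refute d (f ⊞ g) g k fs s) (f ⊞ g)

  -- The search starts on the edge from (x, y) to (x + y, y), so the three entries x, y and x + y
  -- are covered first. Edges in the other direction are reduced to this one by symmetry.
  refuteˡ : ℕ → Known → ℕ → Bool
  refuteˡ d k s =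
    cover (cover (cover (refute d (1 ·x+ 1 ·y) (0 ·x+ 1 ·y)) (1 ·x+ 1 ·y)) (0 ·x+ 1 ·y)) (1 ·x+ 0 ·y) k [] s

-- Soundness of the search

∧-true : ∀ b {c} → (b ∧ c) ≡ true → b ≡ true × c ≡ true
∧-true true eq = refl , eq

if-true : ∀ b {c d : Bool} → (if b then c else d) ≡ true → (b ≡ true × c ≡ true) ⊎ (b ≡ false × d ≡ true)
if-true true  eq = inj₁ (refl , eq)
if-true false eq = inj₂ (refl , eq)

mod-suc≡0⇒∣ : ∀ w m → w mod-suc m ≡ 0 → suc m ∣ w
mod-suc≡0⇒∣ w m = m%n≡0⇒n∣m w (suc m)

∣⇒mod-suc≡0 : ∀ w m → suc m ∣ w → w mod-suc m ≡ 0
∣⇒mod-suc≡0 w m = n∣m⇒m%n≡0 w (suc m)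

¬divided⇒∤ : ∀ ms w → divided ms w ≡ false → ∀ {m} → m ∈ ms → suc m ∣ w → ⊥
¬divided⇒∤ (m ∷ ms) w eq m′∈ m′∣w with w mod-suc m in r
¬divided⇒∤ (m ∷ ms) w eq (here refl) m∣w | suc _ with () ← trans (sym r) (∣⇒mod-suc≡0 w m m∣w)
¬divided⇒∤ (m ∷ ms) w eq (there m′∈) m′∣w | suc _ = ¬divided⇒∤ ms w eq m′∈ m′∣w

multipleOf-true : ∀ es n → multipleOf es n ≡ true → Any (_∣ n) es
multipleOf-true (zero ∷ es) n eq = there (multipleOf-true es n eq)
multipleOf-true (suc m ∷ es) n eq with n mod-suc m in r
... | zero  = here (mod-suc≡0⇒∣ n m r)
... | suc _ = there (multipleOf-true es n eq)

∈-consNew⁻ : ∀ {p} d qs → p ∈ d ∷ qs → p ∈ consNew d qs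
∈-consNew⁻ d [] p∈ = p∈
∈-consNew⁻ d (q ∷ qs) p∈ with d ≡ᵇ q in eq
∈-consNew⁻ d (q ∷ qs) p∈           | false = p∈
∈-consNew⁻ d (q ∷ qs) (here refl)  | true  = here (≡ᵇ⇒≡ d q (subst T (sym eq) tt))
∈-consNew⁻ d (q ∷ qs) (there p∈)   | true  = p∈

-- Roughness is the invariant of trial division: primes up to d no longer divide n, so a found
-- divisor has no smaller prime behind it.
primeFactors-complete : ∀ k d n {qs} → suc d Rough n → 1 ≤ d → NonZero n → primeFactors k d n ≡ just qs →
  ∀ {p} → Prime p → p ∣ n → p ∈ qs
primeFactors-complete (suc k) d n rough 1≤d nz eq {p} pr p∣n with n mod-suc d in r
... | zero with primeFactors k d (div-helper 0 d n d) in eq′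
primeFactors-complete (suc k) d@(suc _) n rough 1≤d nz refl {p} pr p∣n | zero | just qs = ∈-consNew⁻ (d + 1) qs
  (case euclidsLemma (n / suc d) (suc d) pr (subst (p ∣_) (sym (m/n*n≡m d∣n)) p∣n) of λ where
    (inj₂ p∣d) → here (trans (≤-antisym (∣⇒≤ p∣d) (rough⇒≤ {{prime⇒nonTrivial pr}} (rough∧∣⇒rough rough p∣n))) (+-comm 1 d))
    (inj₁ p∣n/d) → there (primeFactors-complete k d (n / suc d)
      (rough∧∣⇒rough rough (m/n∣m d∣n)) 1≤d n/d≢0 eq′ pr p∣n/d))
  where
  d∣n : suc d ∣ n
  d∣n = mod-suc≡0⇒∣ n d r
  n/d≢0 : NonZero (n / suc d)
  n/d≢0 = ≢-nonZero λ n/d≡0 → ≢-nonZero⁻¹ n {{nz}} (trans (sym (m/n*n≡m d∣n)) (cong (_* suc d) n/d≡0))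
primeFactors-complete (suc k) d n rough 1≤d nz eq {p} pr p∣n | suc _ with n <ᵇ (d + 1) * (d + 1) in lt
... | false = primeFactors-complete k (d + 1) n
      (subst (λ e → suc e Rough n) (+-comm 1 d) (∤⇒rough-suc d∤n rough))
      (≤-trans 1≤d (m≤m+n d 1)) nz eq pr p∣n
  where
  d∤n : suc d ∤ n
  d∤n d∣n with () ← trans (sym r) (∣⇒mod-suc≡0 n d d∣n)
primeFactors-complete (suc k) d 1 rough 1≤d nz refl {p} pr p∣n | suc _ | true =
  contradiction (subst Prime (∣1⇒≡1 p∣n) pr) ¬prime[1]
primeFactors-complete (suc k) d n@(2+ _) rough 1≤d nz refl {p} pr p∣n | suc _ | true =
  here (case prime⇒irreducible (rough∧square>⇒prime rough n<d²) p∣n of λ where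
    (inj₁ p≡1) → contradiction (subst Prime p≡1 pr) ¬prime[1]
    (inj₂ p≡n) → p≡n)
  where
  n<d² : n < suc d * suc d
  n<d² = subst (λ e → n < e * e) (+-comm d 1) (<ᵇ⇒< n _ (subst T (sym lt) tt))

pick-sound : ∀ r (fs : List Form) → pick r fs ≡ true → (abs : List (Form × ℕ)) → fs ≡ map proj₁ abs →
  ∀ {f p} → (f , p) ∈ abs → ∃ λ rest → abs ↭ (f , p) ∷ rest × r f (map proj₁ rest) ≡ true
pick-sound r _ eq ((f , p) ∷ abs) refl (here refl) = abs , ↭-refl , proj₁ (∧-true (r f (map proj₁ abs)) eq)
pick-sound r _ eq ((f , p) ∷ abs) refl {g} {q} (there q∈)
  with pick-sound (λ h hs → r h (f ∷ hs)) (map proj₁ abs) (proj₂ (∧-true (r f (map proj₁ abs)) eq)) abs refl q∈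
... | rest , abs↭ , eq′ = (f , p) ∷ rest , ↭-trans (prep _ abs↭) (swap _ _ ↭-refl) , eq′

unique-resp-↭ : ∀ {A : Set} {xs ys : List A} → xs ↭ ys → Unique xs → Unique ys
unique-resp-↭ {A} xs↭ys = Perm.Unique-resp-↭ (setoid A) (↭⇒↭ₛ xs↭ys)

module Soundness (ps : List ℕ) (primes : All Prime ps) (x y : ℕ) (good : Good ps x y)
  (es : List ℕ) (es-free : All (λ e → ¬ (∀ {p} → Prime p → p ∣ e → p ∈ ps)) es) where

  open Search es

  value : Form → ℕ
  value = at x y

  record Attached (ms : List ℕ) (u v n : ℕ) : Set where
    field
      ∣n    : ∀ {m} → m ∈ ms → suc m ∣ n
      ∣n⁻¹  : ∀ {p} → Prime p → p ∣ n → p ∈ map suc ms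
      kill  : ∀ {m} → m ∈ ms → ∀ f → suc m ∣ value f → suc m ∣ at u v f

  names : List ℕ → List (Form × ℕ) → List ℕ
  names ms abs = map suc ms ++ map proj₂ abs

  -- The meaning of a search state. Each entry of `abs` pairs a form with an actual prime dividing
  -- it whose value the search does not know. By `unique` and `bound`, once `s` is zero every prime
  -- of the set has a name.
  record Valid (k : Known) (fs : List Form) (s : ℕ) : Set where
    constructor valid
    field
      {ms}     : List ℕ
      {u v n}  : ℕ
      k≡       : k ≡ known ms u v n
      attached : Attached ms u v n
      abs      : List (Form × ℕ)
      fs≡      : fs ≡ map proj₁ abs
      unique   : Unique (names ms abs)
      names⊆ps : All (_∈ ps) (names ms abs)
      divs     : All (λ (f , p) → p ∣ value f) abs
      bound    : length ps ≤ length (names ms abs) + s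

  Sound : Refuter → Set
  Sound r = ∀ k fs s → r k fs s ≡ true → Valid k fs s → ⊥

  value-⊞ : ∀ f g → value (f ⊞ g) ≡ value f + value g
  value-⊞ = at-⊞ x y

  prime∈ : ∀ {p} → p ∈ ps → Prime p
  prime∈ = All.lookup primes

  attach-attached : ∀ {ms u v n m a b} → suc m ∈ ps → suc m ∣ value (a ·x+ b ·y) → Attached ms u v n →
    Attached (ms ++ m ∷ []) (u * suc m + (b mod-suc m) * n) (v * suc m + (suc m ∸ a mod-suc m) * n) (n * suc m)
  attach-attached {ms} {u} {v} {n} {m} {a} {b} m∈ps m∣f att = record
    { ∣n   = λ m′∈ → case ∈-++⁻ ms m′∈ of λ where
        (inj₁ m′∈) → ∣m⇒∣m*n (suc m) (∣n m′∈)
        (inj₂ (here refl)) → n∣m*n n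
    ; ∣n⁻¹ = λ {p} pr p∣ → subst (p ∈_) (sym (map-++ suc ms (m ∷ []))) (case euclidsLemma n (suc m) pr p∣ of λ where
        (inj₁ p∣n) → ∈-++⁺ˡ (∣n⁻¹ pr p∣n)
        (inj₂ p∣q) → ∈-++⁺ʳ (map suc ms) (here (case prime⇒irreducible (prime∈ m∈ps) p∣q of λ where
           (inj₁ p≡1) → contradiction (subst Prime p≡1 pr) ¬prime[1]
           (inj₂ p≡q) → p≡q)))
    ; kill = λ {m′} m′∈ f m′∣ → subst (suc m′ ∣_) (sym (split f)) (case ∈-++⁻ ms m′∈ of λ where
        (inj₁ m′∈) → ∣m∣n⇒∣m+n (∣n⇒∣m*n (suc m) (kill m′∈ f m′∣)) (∣m⇒∣m*n _ (∣n m′∈))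
        (inj₂ (here refl)) → ∣m∣n⇒∣m+n (m∣m*n {suc m} _) (∣n⇒∣m*n n (new f m′∣)))
    }
    where
    open Attached att
    b′ = b mod-suc m
    a′ = suc m ∸ a mod-suc m
    split : ∀ f → at (u * suc m + b′ * n) (v * suc m + a′ * n) f ≡ suc m * at u v f + n * at b′ a′ f
    split (c ·x+ d ·y) = trans (lemma (suc m) u v n b′ a′ c d) refl
      where
      lemma : ∀ q u v n b a c d → c * (u * q + b * n) + d * (v * q + a * n) ≡ q * (c * u + d * v) + n * (c * b + d * a)
      lemma = solve-∀
    m∣ax+b′y : suc m ∣ a * x + b′ * y
    m∣ax+b′y = ∣m+n∣m⇒∣n {m = b / suc m * suc m * y}
      (subst (suc m ∣_) (trans (cong (λ z → a * x + z * y) (m≡m%n+[m/n]*n b (suc m)))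
        (shuffle a x b′ (b / suc m * suc m) y)) m∣f)
      (∣m⇒∣m*n y (n∣m*n (b / suc m)))
      where
      shuffle : ∀ a x b c y → a * x + (b + c) * y ≡ c * y + (a * x + b * y)
      shuffle = solve-∀
    m∣a′+a : suc m ∣ a′ + a
    m∣a′+a = subst (suc m ∣_)
      (trans (cong (_+ a / suc m * suc m) (sym (m∸n+n≡m (<⇒≤ (m%n<n a (suc m))))))
        (trans (+-assoc a′ (a mod-suc m) _) (cong (a′ +_) (sym (m≡m%n+[m/n]*n a (suc m))))))
      (∣m∣n⇒∣m+n (∣-refl {suc m}) (n∣m*n (a / suc m)))
    new : ∀ f → suc m ∣ value f → suc m ∣ at b′ a′ f
    new (c ·x+ d ·y) m∣ = subst (suc m ∣_) (cong₂ _+_ (*-comm b′ c) (*-comm a′ d))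
      (kills (prime∈ m∈ps) (good m∈ps) {a} {b′} {a′} m∣ax+b′y m∣a′+a c d m∣)

  empty-valid : Valid (known [] 0 0 1) [] (length ps)
  empty-valid = valid refl
    (record { ∣n = λ () ; ∣n⁻¹ = λ pr p∣1 → contradiction (subst Prime (∣1⇒≡1 p∣1) pr) ¬prime[1] ; kill = λ () })
    [] refl [] [] [] ≤-refl

  names-attach : ∀ ms m abs → suc m ∷ names ms abs ↭ names (ms ++ m ∷ []) abs
  names-attach ms m abs = ↭-trans (↭-sym (shift (suc m) (map suc ms) (map proj₂ abs)))
    (↭-reflexive (trans (sym (++-assoc (map suc ms) (suc m ∷ []) (map proj₂ abs)))
      (cong (_++ map proj₂ abs) (sym (map-++ suc ms (m ∷ []))))))

  attach-valid : ∀ {ms u v n m s qs} f abs → Attached ms u v n → suc m ∣ value f →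
    Unique qs → All (_∈ ps) qs → length ps ≤ length qs + s → qs ↭ suc m ∷ names ms abs →
    All (λ (f , p) → p ∣ value f) abs → Valid (attach (suc m) f (known ms u v n)) (map proj₁ abs) s
  attach-valid {ms} {m = m} {s} f@(a ·x+ b ·y) abs att m∣f uq qs⊆ bd perm dv = valid refl
    (attach-attached {a = a} {b} (All.lookup qs⊆ (∈-resp-↭ (↭-sym perm) (here refl))) m∣f att) abs refl
    (unique-resp-↭ perm′ uq) (All-resp-↭ perm′ qs⊆) dv
    (≤-trans bd (≤-reflexive (cong (_+ s) (↭-length perm′))))
    where
    perm′ = ↭-trans perm (names-attach ms m abs)

  avoid-sound : ∀ {r} → Sound r → Sound (avoid r)
  avoid-sound {r} snd k fs s eq val@(valid {n = n} refl att abs refl uq ns⊆ dv bd)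
    with if-true (multipleOf es n) eq
  ... | inj₂ (_ , eq′) = snd k fs s eq′ val
  ... | inj₁ (eq′ , _) with find (multipleOf-true es n eq′)
  ... | e , e∈ , e∣n = All.lookup es-free e∈ λ pr p∣e →
        All.lookup ns⊆ (∈-++⁺ˡ (Attached.∣n⁻¹ att pr (∣-trans p∣e e∣n)))

  known?-false : ∀ {ms u v n p} → Attached ms u v n → Prime p → ¬ p ∈ map suc ms → known? p (known ms u v n) ≡ true → ⊥
  known?-false {p = zero} att pr p∉ eq = ¬prime[0] pr
  known?-false {n = n} {p = suc m} att pr p∉ eq with n mod-suc m in r
  ... | zero = p∉ (Attached.∣n⁻¹ att pr (mod-suc≡0⇒∣ n m r))

  identify-sound : ∀ r k f fs s qs → identify r k f fs s qs ≡ true → ∀ {p} → p ∈ qs →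
    known? p k ≡ true ⊎ avoid r (attach p f k) fs s ≡ true
  identify-sound r k f fs s (q ∷ qs) eq (there p∈) =
    identify-sound r k f fs s qs (proj₂ (∧-true (if known? q k then true else avoid r (attach q f k) fs s) eq)) p∈
  identify-sound r k f fs s (q ∷ qs) eq (here refl)
    with if-true (known? q k) (proj₁ (∧-true (if known? q k then true else avoid r (attach q f k) fs s) eq))
  ... | inj₁ (eq′ , _) = inj₁ eq′
  ... | inj₂ (_ , eq′) = inj₂ eq′

  -- A zero determinant says nothing about a shared prime. Factoring then runs out of fuel, and the
  -- branch counts as not refuted.
  primeFactors-0 : ∀ k d → primeFactors k d 0 ≡ nothing
  primeFactors-0 zero    d = refl
  primeFactors-0 (suc k) d = cong (consFactor (d + 1)) (primeFactors-0 k d)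

  identifyAny-sound : ∀ r k f fs s n → identifyAny r k f fs s (primeFactors 5000 1 n) ≡ true →
    ∀ {p} → Prime p → p ∣ n → known? p k ≡ true ⊎ avoid r (attach p f k) fs s ≡ true
  identifyAny-sound r k f fs s n eq pr p∣n with primeFactors 5000 1 n in eq′
  identifyAny-sound r k f fs s zero      eq pr p∣n | just qs with () ← trans (sym eq′) (primeFactors-0 5000 1)
  identifyAny-sound r k f fs s n@(suc _) eq pr p∣n | just qs =
    identify-sound r k f fs s qs eq (primeFactors-complete 5000 1 n 2-rough ≤-refl _ eq′ pr p∣n)

  unique-disjoint : ∀ {p : ℕ} xs {ys} → Unique (xs ++ ys) → p ∈ xs → p ∈ ys → ⊥
  unique-disjoint (x ∷ xs) (x≢ ∷ uq) (here refl) p∈ys = All.lookup x≢ (∈-++⁺ʳ xs p∈ys) refl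
  unique-disjoint (x ∷ xs) (x≢ ∷ uq) (there p∈xs) p∈ys = unique-disjoint xs uq p∈xs p∈ys

  -- The argument follows an actual prime p of z. If p has no name, `fresh` applies; if it is
  -- attached, it divides z at (u, v), against the failed test; if it is named but unidentified, it
  -- divides a determinant and `identify` reaches it.
  cover-sound : ∀ {r} z → Any (_∣ value z) ps → Sound r → Sound (cover r z)
  cover-sound {r} z cov snd k fs s eq val@(valid {ms} {u} {v} {n} refl att abs refl uq ns⊆ dv bd)
    with if-true (covered k z) eq
  ... | inj₁ (_ , eq′) = snd k fs s eq′ val
  ... | inj₂ (uncov , eq′) with ∧-true (fresh r z k fs s) eq′ | find cov
  ... | eqᶠ , eqᵖ | p , p∈ps , p∣z with p ∈? names ms abs
  ... | no p∉ = new s eqᶠ bd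
    where
    p≢ : All (p ≢_) (names ms abs)
    p≢ = All.tabulate λ q∈ p≡q → p∉ (subst (_∈ names ms abs) (sym p≡q) q∈)
    new : ∀ s → fresh r z k fs s ≡ true → length ps ≤ length (names ms abs) + s → ⊥
    new zero    eqᶠ bd = <-irrefl refl (≤-trans
      (unique-⊆⇒length≤ (p≢ ∷ uq) (All.lookup {P = _∈ ps} (p∈ps ∷ ns⊆)))
      (≤-trans bd (≤-reflexive (+-identityʳ _))))
    new (suc s) eqᶠ bd = snd k (z ∷ fs) s eqᶠ (valid refl att ((z , p) ∷ abs) refl
      (unique-resp-↭ perm (p≢ ∷ uq)) (All-resp-↭ perm (p∈ps ∷ ns⊆)) (p∣z ∷ dv)
      (≤-trans bd (≤-reflexive (trans (+-suc _ s) (cong (_+ s) (↭-length perm))))))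
      where
      perm : p ∷ names ms abs ↭ names ms ((z , p) ∷ abs)
      perm = ↭-sym (shift p (map suc ms) (map proj₂ abs))
  ... | yes p∈ with ∈-++⁻ (map suc ms) p∈
  ...   | inj₁ p∈ms with ∈-map⁻ suc p∈ms
  ...     | m , m∈ , refl = ¬divided⇒∤ ms (at u v z) uncov m∈ (Attached.kill att m∈ z p∣z)
  cover-sound {r} z cov snd k fs s eq val@(valid {ms} {u} {v} {n} refl att abs refl uq ns⊆ dv bd)
    | inj₂ (uncov , eq′) | eqᶠ , eqᵖ | p , p∈ps , p∣z | yes p∈ | inj₂ p∈abs with ∈-map⁻ proj₂ p∈abs
  ... | (f , p) , fp∈ , refl with pick-sound _ fs eqᵖ abs refl fp∈
  ... | rest , perm , eqⁱ
    with identifyAny-sound r k f (map proj₁ rest) s (det f z) eqⁱ (prime∈ p∈ps)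
           (∣det (prime∈ p∈ps) (good p∈ps) f z (All.lookup dv fp∈) p∣z)
  ... | inj₁ k? = known?-false att (prime∈ p∈ps) (λ p∈ms → unique-disjoint (map suc ms) uq p∈ms p∈abs) k?
  ... | inj₂ eqᵃ with p | prime∈ p∈ps
  ... | zero  | pr = ¬prime[0] pr
  ... | suc m | pr = avoid-sound snd _ _ s eqᵃ
        (attach-valid f rest att (All.lookup dv fp∈) uq ns⊆ bd
          (↭-trans (++⁺ˡ (map suc ms) (map⁺ proj₂ perm)) (shift (suc m) (map suc ms) (map proj₂ rest)))
          (All.tail (All-resp-↭ perm dv)))

  dead-sound : ∀ d ms u v n f g → Attached ms u v n → ps ⊆ map suc ms →
    dead d ms (at u v f) (at u v g) ≡ true → Live ps (2 + d) (value f) (value g) → ⊥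
  dead-sound (suc d) ms u v n f g att ps⊆ eq (step (_ , _ , l)) with divided ms (at u v f + at u v g) in dv
  ... | true with ∧-true (dead d ms (at u v f) (at u v f + at u v g)) eq | l
  ...   | eqʳ , _ | inj₁ l′ = dead-sound d ms u v n f (f ⊞ g) att ps⊆
          (subst (λ w → dead d ms (at u v f) w ≡ true) (sym (at-⊞ u v f g)) eqʳ)
          (subst (Live ps (2 + d) (value f)) (sym (value-⊞ f g)) l′)
  ...   | _ , eqˡ | inj₂ l′ = dead-sound d ms u v n (f ⊞ g) g att ps⊆
          (subst (λ w → dead d ms w (at u v g) ≡ true) (sym (at-⊞ u v f g)) eqˡ)
          (subst (λ w → Live ps (2 + d) w (value g)) (sym (value-⊞ f g)) l′)
  dead-sound (suc d) ms u v n f g att ps⊆ eq (step (_ , _ , l)) | false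
    with find (sum-covered l)
    where
    sum-covered : Live ps (2 + d) (value f) (value f + value g) ⊎ Live ps (2 + d) (value f + value g) (value g) →
      Any (_∣ (value f + value g)) ps
    sum-covered (inj₁ (step (_ , c , _))) = c
    sum-covered (inj₂ (step (c , _ , _))) = c
  ... | p , p∈ , p∣ with ∈-map⁻ suc (ps⊆ p∈)
  ... | m , m∈ , refl = ¬divided⇒∤ ms (at u v f + at u v g) dv m∈
        (subst (suc m ∣_) (at-⊞ u v f g)
          (Attached.kill att m∈ (f ⊞ g) (subst (suc m ∣_) (sym (value-⊞ f g)) p∣)))

  refute-sound  : ∀ d f g → Live ps (2 + d) (value f) (value g) → Sound (refute d f g)
  refute′-sound : ∀ d f g → Live ps (2 + d) (value f) (value g) → Sound (refute′ d f g)
  refute-sound d f g l k [] zero eq (valid {ms} {u} {v} {n} refl att [] refl uq ns⊆ dv bd) =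
    dead-sound d ms u v n f g att ps⊆ eq l
    where
    ps⊆ : ps ⊆ map suc ms
    ps⊆ {p} p∈ with p ∈? names ms []
    ... | yes p∈′ = subst (p ∈_) (++-identityʳ (map suc ms)) p∈′
    ... | no  p∉  = contradiction (≤-trans
            (unique-⊆⇒length≤ (All.tabulate (λ q∈ p≡q → p∉ (subst (_∈ names ms []) (sym p≡q) q∈)) ∷ uq)
              (All.lookup {P = _∈ ps} (p∈ ∷ ns⊆)))
            (≤-trans bd (≤-reflexive (+-identityʳ _)))) (<-irrefl refl)
  refute-sound d f g l k@(known _ _ _ _) [] (suc s) eq val = refute′-sound d f g l k [] (suc s) eq val
  refute-sound d f g l k@(known _ _ _ _) (h ∷ fs) s eq val = refute′-sound d f g l k (h ∷ fs) s eq val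
  refute′-sound (suc d) f g (step (_ , _ , l)) = cover-sound (f ⊞ g)
    (subst (λ w → Any (_∣ w) ps) (sym (value-⊞ f g)) (sum-covered l)) (both l)
    where
    sum-covered : Live ps (2 + d) (value f) (value f + value g) ⊎ Live ps (2 + d) (value f + value g) (value g) →
      Any (_∣ (value f + value g)) ps
    sum-covered (inj₁ (step (_ , c , _))) = c
    sum-covered (inj₂ (step (c , _ , _))) = c
    both : Live ps (2 + d) (value f) (value f + value g) ⊎ Live ps (2 + d) (value f + value g) (value g) →
      Sound (λ k fs s → refute d f (f ⊞ g) k fs s ∧ refute d (f ⊞ g) g k fs s)
    both (inj₁ l) k fs s eq val = refute-sound d f (f ⊞ g)
      (subst (Live ps (2 + d) (value f)) (sym (value-⊞ f g)) l) k fs s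
      (proj₁ (∧-true (refute d f (f ⊞ g) k fs s) eq)) val
    both (inj₂ l) k fs s eq val = refute-sound d (f ⊞ g) g
      (subst (λ w → Live ps (2 + d) w (value g)) (sym (value-⊞ f g)) l) k fs s
      (proj₂ (∧-true (refute d f (f ⊞ g) k fs s) eq)) val

  value-x : value (1 ·x+ 0 ·y) ≡ x
  value-x = trans (+-identityʳ _) (*-identityˡ x)

  value-y : value (0 ·x+ 1 ·y) ≡ y
  value-y = *-identityˡ y

  value-x+y : value (1 ·x+ 1 ·y) ≡ x + y
  value-x+y = cong₂ _+_ (*-identityˡ x) (*-identityˡ y)

  refuteˡ-sound : ∀ d k s → refuteˡ d k s ≡ true → Valid k [] s →
    Any (_∣ x) ps → Live ps (2 + d) (x + y) y → ⊥
  refuteˡ-sound d k s eq val cx l@(step (cz , cy , _)) =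
    cover-sound (1 ·x+ 0 ·y) (subst (λ w → Any (_∣ w) ps) (sym value-x) cx)
      (cover-sound (0 ·x+ 1 ·y) (subst (λ w → Any (_∣ w) ps) (sym value-y) cy)
        (cover-sound (1 ·x+ 1 ·y) (subst (λ w → Any (_∣ w) ps) (sym value-x+y) cz)
          (refute-sound d (1 ·x+ 1 ·y) (0 ·x+ 1 ·y)
            (subst₂ (Live ps (2 + d)) (sym value-x+y) (sym value-y) l))))
      k [] s eq val

-- Residue patterns that long paths cannot avoid

attachAll : List (ℕ × Form) → Known
attachAll []            = known [] 0 0 1
attachAll ((q , f) ∷ h) = attach q f (attachAll h)

all-true : ∀ {A : Set} (t : A → Bool) xs → all t xs ≡ true → ∀ {x} → x ∈ xs → t x ≡ true
all-true t (x ∷ xs) eq (here refl) = proj₁ (∧-true (t x) eq)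
all-true t (x ∷ xs) eq (there x∈)  = all-true t xs (proj₂ (∧-true (t x) eq)) x∈

-- The paths through the residues modulo suc n: every long path passes through a
-- vertex satisfying one of the divisibility patterns of hs and continues there in
-- the first coordinate, up to exchanging the coordinates.
module Patterns (n : ℕ) (hs : List (List (ℕ × Form))) where

  fits : ℕ → ℕ → List (ℕ × Form) → Bool
  fits r t [] = true
  fits r t ((zero  , f) ∷ h) = false
  fits r t ((suc m , f) ∷ h) = if isZero (at r t f mod-suc m) then fits r t h else false

  fitsAny : ℕ → ℕ → List (List (ℕ × Form)) → Bool
  fitsAny r t []       = false
  fitsAny r t (h ∷ hs) = if fits r t h then true else fitsAny r t hs

  -- A pattern has to be met together with a left step. A right step from (r, t) is a left step from
  -- (t, r), which is why the second line tests the exchanged pair.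
  inevitable : ℕ → ℕ → ℕ → Bool
  inevitable zero    r t = false
  inevitable (suc k) r t =
    (if fitsAny r t hs then true else inevitable k ((r + t) mod-suc n) t) ∧
    (if fitsAny t r hs then true else inevitable k r ((r + t) mod-suc n))

  common : List ℕ → ℕ → ℕ → Bool
  common []           r t = false
  common (zero  ∷ bs) r t = common bs r t
  common (suc m ∷ bs) r t =
    if isZero (r mod-suc m) then (if isZero (t mod-suc m) then true else common bs r t)
    else common bs r t

  inevitableFromAll : List ℕ → ℕ → Bool
  inevitableFromAll bs k = all (λ r → all (λ t →
    if common bs r t then true else inevitable k r t) (upTo (suc n))) (upTo (suc n))

-- The primes `bs` are assumed in the set, and each number in `es` is assumed to have a prime factor
-- outside it. Of at most six primes, `6 ∸ length bs` are then still unknown.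
record Certificate (bs : List ℕ) (n : ℕ) (hs : List (List (ℕ × Form))) (es : List ℕ) : Set where
  field
    window   : ℕ
    depth    : ℕ
    distinct : Unique bs
    periods  : All (_∣ suc n) bs
    patterns : All (λ h → map proj₁ h ≡ bs) hs
    passed   : Patterns.inevitableFromAll n hs bs window ≡ true
    refuted  : all (λ h → Search.refuteˡ es depth (attachAll h) (6 ∸ length bs)) hs ≡ true

module _ {bs n hs es} (cert : Certificate bs n hs es)
  (ps : List ℕ) (primes : All Prime ps) (bs⊆ps : bs ⊆ ps) (small : length ps ≤ 6)
  (es-free : All (λ e → ¬ (∀ {p} → Prime p → p ∣ e → p ∈ ps)) es) where

  open Certificate cert
  open Patterns n hs

  fits-sound : ∀ r t h → fits r t h ≡ true → All (λ (q , f) → q ∣ at r t f) h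
  fits-sound r t [] eq = []
  fits-sound r t ((suc m , f) ∷ h) eq with at r t f mod-suc m in e
  ... | zero = mod-suc≡0⇒∣ _ m e ∷ fits-sound r t h eq

  fitsAny-sound : ∀ r t hs → fitsAny r t hs ≡ true → ∃ λ h → h ∈ hs × All (λ (q , f) → q ∣ at r t f) h
  fitsAny-sound r t (h ∷ hs) eq with if-true (fits r t h) eq
  ... | inj₁ (eq′ , _) = h , here refl , fits-sound r t h eq′
  ... | inj₂ (_ , eq′) with fitsAny-sound r t hs eq′
  ...   | h′ , h′∈ , dv = h′ , there h′∈ , dv

  common-sound : ∀ bs r t → common bs r t ≡ true → ∃ λ q → q ∈ bs × q ∣ r × q ∣ t
  common-sound (zero ∷ bs) r t eq with common-sound bs r t eq
  ... | q , q∈ , dv = q , there q∈ , dv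
  common-sound (suc m ∷ bs) r t eq with r mod-suc m in e
  common-sound (suc m ∷ bs) r t eq | zero with t mod-suc m in e′
  ... | zero = suc m , here refl , mod-suc≡0⇒∣ r m e , mod-suc≡0⇒∣ t m e′
  ... | suc _ with common-sound bs r t eq
  ...   | q , q∈ , dv = q , there q∈ , dv
  common-sound (suc m ∷ bs) r t eq | suc _ with common-sound bs r t eq
  ...   | q , q∈ , dv = q , there q∈ , dv

  ∣-unmod : ∀ {q} f x y → q ∣ suc n → q ∣ at (x mod-suc n) (y mod-suc n) f → q ∣ at x y f
  ∣-unmod {q} (a ·x+ b ·y) x y q∣n q∣ = subst (q ∣_)
    (trans (shuffle a b (x % suc n) (y % suc n) (x / suc n) (y / suc n) (suc n))
      (cong₂ (λ v w → a * v + b * w) (sym (m≡m%n+[m/n]*n x (suc n))) (sym (m≡m%n+[m/n]*n y (suc n)))))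
    (∣m∣n⇒∣m+n q∣ (∣n⇒∣m*n (a * (x / suc n) + b * (y / suc n)) q∣n))
    where
    shuffle : ∀ a b r t c d n → (a * r + b * t) + (a * c + b * d) * n ≡ a * (r + c * n) + b * (t + d * n)
    shuffle = solve-∀

  attachAll-valid : ∀ {x y} (good : Good ps x y) h → map proj₁ h ≡ bs → All (λ (q , f) → q ∣ at x y f) h →
    Soundness.Valid ps primes x y good es es-free (attachAll h) [] (6 ∸ length bs)
  attachAll-valid {x} {y} good h refl dv with attached h bs⊆ps dv
    where
    open Soundness ps primes x y good es es-free
    attached : ∀ h → map proj₁ h ⊆ ps → All (λ (q , f) → q ∣ at x y f) h →
      ∃₂ λ ms u → ∃₂ λ v n → attachAll h ≡ known ms u v n × Attached ms u v n × map suc ms ↭ map proj₁ h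
    attached [] ⊆ps [] = [] , 0 , 0 , 1 , refl , Valid.attached empty-valid , ↭-refl
    attached ((zero , f) ∷ h) ⊆ps dv = contradiction (All.lookup primes (⊆ps (here refl))) ¬prime[0]
    attached ((suc m , f@(a ·x+ b ·y)) ∷ h) ⊆ps (d ∷ dv) with attached h (⊆ps ∘ there) dv
    ... | ms , u , v , n , eq , att , perm rewrite eq = _ , _ , _ , _ , refl ,
          attach-attached {a = a} {b} (⊆ps (here refl)) d att ,
          ↭-trans (↭-reflexive (map-++ suc ms (m ∷ [])))
            (↭-trans (shift (suc m) (map suc ms) []) (prep (suc m) (↭-trans (↭-reflexive (++-identityʳ _)) perm)))
  ... | ms , u , v , n , eq , att , perm = Soundness.valid eq att [] refl
        (unique-resp-↭ perm′ distinct) (All-resp-↭ perm′ (All.tabulate bs⊆ps)) []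
        (≤-trans small (≤-trans (m≤n+m∸n 6 (length bs)) (≤-reflexive (cong (_+ (6 ∸ length bs)) (↭-length perm′)))))
    where
    perm′ : map proj₁ h ↭ map suc ms ++ []
    perm′ = ↭-trans (↭-sym perm) (↭-reflexive (sym (++-identityʳ _)))

  edge-sound : ∀ {x y} → Good ps x y → fitsAny (x mod-suc n) (y mod-suc n) hs ≡ true →
    Any (_∣ x) ps → Live ps (2 + depth) (x + y) y → ⊥
  edge-sound {x} {y} good eq cx l with fitsAny-sound _ _ hs eq
  ... | h , h∈ , dv = Soundness.refuteˡ-sound ps primes x y good es es-free depth (attachAll h) (6 ∸ length bs)
        (all-true (λ h → Search.refuteˡ es depth (attachAll h) (6 ∸ length bs)) hs refuted h∈)
        (attachAll-valid good h (All.lookup patterns h∈)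
          (All.tabulate λ { {q , f} qf∈ → ∣-unmod f x y
            (All.lookup periods (subst (q ∈_) (All.lookup patterns h∈) (∈-map⁺ proj₁ qf∈)))
            (All.lookup dv qf∈) }))
        cx l

  inevitable-sound : ∀ k x y → Good ps x y → inevitable k (x mod-suc n) (y mod-suc n) ≡ true →
    Live ps (k + (2 + depth)) x y → ⊥
  inevitable-sound (suc k) x y good eq (step (cx , cy , l)) with ∧-true (if fitsAny (x mod-suc n) (y mod-suc n) hs then true
    else inevitable k ((x mod-suc n + y mod-suc n) mod-suc n) (y mod-suc n)) eq | l
  ... | eqˡ , _ | inj₂ l′ with if-true (fitsAny (x mod-suc n) (y mod-suc n) hs) eqˡ
  ...   | inj₁ (eq′ , _) = edge-sound good eq′ cx (live-anti (2 + depth) k (subst (λ d → Live ps d (x + y) y) (+-comm k (2 + depth)) l′))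
  ...   | inj₂ (_ , eq′) = inevitable-sound k (x + y) y (good-stepˡ good)
          (subst (λ r → inevitable k r (y mod-suc n) ≡ true) (sym (%-distribˡ-+ x y (suc n))) eq′) l′
  inevitable-sound (suc k) x y good eq (step (cx , cy , l)) | _ , eqʳ | inj₁ l′
    with if-true (fitsAny (y mod-suc n) (x mod-suc n) hs) eqʳ
  ...   | inj₁ (eq′ , _) = edge-sound (good-swap good) eq′ cy
          (subst (λ w → Live ps (2 + depth) w x) (+-comm x y)
            (live-swap (2 + depth) (live-anti (2 + depth) k (subst (λ d → Live ps d x (x + y)) (+-comm k (2 + depth)) l′))))
  ...   | inj₂ (_ , eq′) = inevitable-sound k x (x + y) (good-stepʳ good)
          (subst (λ r → inevitable k (x mod-suc n) r ≡ true) (sym (%-distribˡ-+ x y (suc n))) eq′) l′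

  certificate-sound : ∀ x y → Good ps x y → Live ps (window + (2 + depth)) x y → ⊥
  certificate-sound x y good l
    with if-true (common bs (x mod-suc n) (y mod-suc n))
      (all-true _ (upTo (suc n)) (all-true _ (upTo (suc n)) passed (∈-upTo⁺ (m%n<n x (suc n)))) (∈-upTo⁺ (m%n<n y (suc n))))
  ... | inj₂ (_ , eq) = inevitable-sound window x y good eq l
  ... | inj₁ (eq , _) with common-sound bs (x mod-suc n) (y mod-suc n) eq
  ...   | q , q∈ , q∣x , q∣y = good (bs⊆ps q∈) (∣n∣m%n⇒∣m (All.lookup periods q∈) q∣x)
          (∣n∣m%n⇒∣m (All.lookup periods q∈) q∣y)

-- The exceptional sets and the certificates

-- the sets of at most six primes on which the search does not end
exceptional : List (List ℕ)
exceptional =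
  (2 ∷ 3 ∷ 5 ∷ 7 ∷ 19 ∷ []) ∷
  (2 ∷ 3 ∷ 5 ∷ 13 ∷ 17 ∷ []) ∷
  (2 ∷ 3 ∷ 5 ∷ 7 ∷ 11 ∷ 13 ∷ []) ∷
  (2 ∷ 3 ∷ 5 ∷ 7 ∷ 11 ∷ 23 ∷ []) ∷
  (2 ∷ 3 ∷ 5 ∷ 7 ∷ 13 ∷ 29 ∷ []) ∷
  (2 ∷ 3 ∷ 5 ∷ 11 ∷ 13 ∷ 23 ∷ []) ∷
  (2 ∷ 3 ∷ 7 ∷ 11 ∷ 13 ∷ 23 ∷ []) ∷
  (2 ∷ 3 ∷ 5 ∷ 11 ∷ 19 ∷ 31 ∷ []) ∷
  (2 ∷ 3 ∷ 5 ∷ 7 ∷ 29 ∷ 41 ∷ []) ∷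
  (2 ∷ 3 ∷ 5 ∷ 7 ∷ 37 ∷ 59 ∷ []) ∷
  (2 ∷ 3 ∷ 5 ∷ 11 ∷ 59 ∷ 61 ∷ []) ∷
  (2 ∷ 3 ∷ 5 ∷ 11 ∷ 31 ∷ 107 ∷ []) ∷
  (2 ∷ 3 ∷ 5 ∷ 7 ∷ 11 ∷ 223 ∷ []) ∷
  (2 ∷ 3 ∷ 5 ∷ 7 ∷ 41 ∷ 103 ∷ []) ∷
  (2 ∷ 3 ∷ 5 ∷ 23 ∷ 31 ∷ 61 ∷ []) ∷
  (2 ∷ 3 ∷ 5 ∷ 11 ∷ 13 ∷ 97 ∷ []) ∷
  (2 ∷ 3 ∷ 5 ∷ 7 ∷ 11 ∷ 1499 ∷ []) ∷
  (2 ∷ 3 ∷ 5 ∷ 7 ∷ 149 ∷ 229 ∷ []) ∷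
  (2 ∷ 3 ∷ 5 ∷ 11 ∷ 29 ∷ 53 ∷ []) ∷
  (2 ∷ 3 ∷ 5 ∷ 17 ∷ 67 ∷ 79 ∷ []) ∷
  (2 ∷ 3 ∷ 7 ∷ 17 ∷ 31 ∷ 41 ∷ []) ∷
  (2 ∷ 3 ∷ 5 ∷ 17 ∷ 19 ∷ 89 ∷ []) ∷
  (2 ∷ 3 ∷ 29 ∷ 41 ∷ 43 ∷ 53 ∷ []) ∷
  (2 ∷ 3 ∷ 5 ∷ 29 ∷ 41 ∷ 103 ∷ []) ∷
  (2 ∷ 3 ∷ 5 ∷ 67 ∷ 71 ∷ 103 ∷ []) ∷
  (2 ∷ 3 ∷ 5 ∷ 7 ∷ 97 ∷ 113 ∷ []) ∷
  (2 ∷ 3 ∷ 5 ∷ 101 ∷ 257 ∷ 337 ∷ []) ∷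
  (2 ∷ 5 ∷ 7 ∷ 31 ∷ 37 ∷ 59 ∷ []) ∷
  (2 ∷ 5 ∷ 7 ∷ 11 ∷ 13 ∷ 43 ∷ []) ∷ []

exceptional-primes : All (All Prime) exceptional
exceptional-primes = from-yes (All.all? (All.all? prime?) exceptional)

products : List ℕ
products = map product exceptional

-- Each table meets every cycle of the graph of residues; among the tables doing so
-- these lead to short searches.
patterns-2-3 patterns-2-5 patterns-2-3-5 : List (List (ℕ × Form))
patterns-2-3 =
  ((2 , 0 ·x+ 1 ·y) ∷ (3 , 0 ·x+ 1 ·y) ∷ []) ∷
  ((2 , 0 ·x+ 1 ·y) ∷ (3 , 2 ·x+ 1 ·y) ∷ []) ∷
  ((2 , 1 ·x+ 1 ·y) ∷ (3 , 0 ·x+ 1 ·y) ∷ []) ∷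
  ((2 , 1 ·x+ 1 ·y) ∷ (3 , 1 ·x+ 1 ·y) ∷ []) ∷ []
patterns-2-5 =
  ((2 , 0 ·x+ 1 ·y) ∷ (5 , 0 ·x+ 1 ·y) ∷ []) ∷
  ((2 , 0 ·x+ 1 ·y) ∷ (5 , 4 ·x+ 1 ·y) ∷ []) ∷
  ((2 , 1 ·x+ 1 ·y) ∷ (5 , 0 ·x+ 1 ·y) ∷ []) ∷
  ((2 , 1 ·x+ 1 ·y) ∷ (5 , 3 ·x+ 1 ·y) ∷ []) ∷
  ((2 , 1 ·x+ 1 ·y) ∷ (5 , 2 ·x+ 1 ·y) ∷ []) ∷ []
patterns-2-3-5 =
  ((2 , 0 ·x+ 1 ·y) ∷ (3 , 0 ·x+ 1 ·y) ∷ (5 , 0 ·x+ 1 ·y) ∷ []) ∷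
  ((2 , 0 ·x+ 1 ·y) ∷ (3 , 0 ·x+ 1 ·y) ∷ (5 , 4 ·x+ 1 ·y) ∷ []) ∷
  ((2 , 0 ·x+ 1 ·y) ∷ (3 , 2 ·x+ 1 ·y) ∷ (5 , 0 ·x+ 1 ·y) ∷ []) ∷
  ((2 , 0 ·x+ 1 ·y) ∷ (3 , 2 ·x+ 1 ·y) ∷ (5 , 4 ·x+ 1 ·y) ∷ []) ∷
  ((2 , 0 ·x+ 1 ·y) ∷ (3 , 2 ·x+ 1 ·y) ∷ (5 , 2 ·x+ 1 ·y) ∷ []) ∷
  ((2 , 0 ·x+ 1 ·y) ∷ (3 , 2 ·x+ 1 ·y) ∷ (5 , 1 ·x+ 1 ·y) ∷ []) ∷
  ((2 , 0 ·x+ 1 ·y) ∷ (3 , 1 ·x+ 1 ·y) ∷ (5 , 4 ·x+ 1 ·y) ∷ []) ∷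
  ((2 , 1 ·x+ 1 ·y) ∷ (3 , 0 ·x+ 1 ·y) ∷ (5 , 0 ·x+ 1 ·y) ∷ []) ∷
  ((2 , 1 ·x+ 1 ·y) ∷ (3 , 0 ·x+ 1 ·y) ∷ (5 , 3 ·x+ 1 ·y) ∷ []) ∷
  ((2 , 1 ·x+ 1 ·y) ∷ (3 , 0 ·x+ 1 ·y) ∷ (5 , 2 ·x+ 1 ·y) ∷ []) ∷
  ((2 , 1 ·x+ 1 ·y) ∷ (3 , 2 ·x+ 1 ·y) ∷ (5 , 3 ·x+ 1 ·y) ∷ []) ∷
  ((2 , 1 ·x+ 1 ·y) ∷ (3 , 2 ·x+ 1 ·y) ∷ (5 , 2 ·x+ 1 ·y) ∷ []) ∷
  ((2 , 1 ·x+ 1 ·y) ∷ (3 , 1 ·x+ 1 ·y) ∷ (5 , 0 ·x+ 1 ·y) ∷ []) ∷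
  ((2 , 1 ·x+ 1 ·y) ∷ (3 , 1 ·x+ 1 ·y) ∷ (5 , 2 ·x+ 1 ·y) ∷ []) ∷
  ((2 , 1 ·x+ 1 ·y) ∷ (3 , 1 ·x+ 1 ·y) ∷ (5 , 1 ·x+ 1 ·y) ∷ []) ∷ []

-- For the sets that contain neither 2 and 3 nor 2 and 5, whence the numbers 6 and 10. No residue is
-- prescribed: the modulus is 1 and the empty pattern always fits.
certificate : Certificate [] 0 ([] ∷ []) (6 ∷ 10 ∷ products)
certificate = record { window = 1 ; depth = 100 ; distinct = [] ; periods = [] ; patterns = refl ∷ [] ; passed = refl ; refuted = refl }

certificate-2-3 : Certificate (2 ∷ 3 ∷ []) 5 patterns-2-3 (5 ∷ products)
certificate-2-3 = record
  { window   = 30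
  ; depth    = 100
  ; distinct = from-yes (unique? (2 ∷ 3 ∷ []))
  ; periods  = from-yes (All.all? (_∣? 6) (2 ∷ 3 ∷ []))
  ; patterns = from-yes (All.all? (λ h → ≡-dec _≟_ (map proj₁ h) (2 ∷ 3 ∷ [])) patterns-2-3)
  ; passed   = refl
  ; refuted  = refl
  }

certificate-2-5 : Certificate (2 ∷ 5 ∷ []) 9 patterns-2-5 (3 ∷ products)
certificate-2-5 = record
  { window   = 30
  ; depth    = 100
  ; distinct = from-yes (unique? (2 ∷ 5 ∷ []))
  ; periods  = from-yes (All.all? (_∣? 10) (2 ∷ 5 ∷ []))
  ; patterns = from-yes (All.all? (λ h → ≡-dec _≟_ (map proj₁ h) (2 ∷ 5 ∷ [])) patterns-2-5)
  ; passed   = refl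
  ; refuted  = refl
  }

certificate-2-3-5 : Certificate (2 ∷ 3 ∷ 5 ∷ []) 29 patterns-2-3-5 products
certificate-2-3-5 = record
  { window   = 30
  ; depth    = 100
  ; distinct = from-yes (unique? (2 ∷ 3 ∷ 5 ∷ []))
  ; periods  = from-yes (All.all? (_∣? 30) (2 ∷ 3 ∷ 5 ∷ []))
  ; patterns = from-yes (All.all? (λ h → ≡-dec _≟_ (map proj₁ h) (2 ∷ 3 ∷ 5 ∷ [])) patterns-2-3-5)
  ; passed   = refl
  ; refuted  = refl
  }

-- Finite type as boundedness of paths

Bounded : List ℕ → Set
Bounded ps = ∀ x y .{{_ : NonZero x}} .{{_ : NonZero y}} → Good ps x y → ∃ λ d → ¬ Live ps d x y

prime∣product⇒∈ : ∀ {p} {qs} → Prime p → All Prime qs → p ∣ product qs → p ∈ qs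
prime∣product⇒∈ pr [] p∣1 = contradiction (subst Prime (∣1⇒≡1 p∣1) pr) ¬prime[1]
prime∣product⇒∈ {p} {q ∷ qs} pr (prq ∷ prs) p∣ with euclidsLemma q (product qs) pr p∣
... | inj₂ p∣qs = there (prime∣product⇒∈ pr prs p∣qs)
... | inj₁ p∣q with prime⇒irreducible prq p∣q
...   | inj₁ p≡1 = contradiction (subst Prime p≡1 pr) ¬prime[1]
...   | inj₂ p≡q = here p≡q

∈⇒∣product : ∀ {p ps} → p ∈ ps → p ∣ product ps
∈⇒∣product {ps = _ ∷ ps} (here refl) = m∣m*n (product ps)
∈⇒∣product {ps = q ∷ ps} (there p∈)  = ∣n⇒∣m*n q (∈⇒∣product p∈)

good-product : ∀ {ps x y} → All Prime ps → gcd (gcd x y) (product ps) ≡ 1 → Good ps x y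
good-product {ps} {x} {y} primes eq {p} p∈ p∣x p∣y = ¬prime[1]
  (subst Prime (∣1⇒≡1 (subst (p ∣_) eq (gcd-greatest (gcd-greatest p∣x p∣y) (∈⇒∣product p∈)))) (All.lookup primes p∈))

coprime-product : ∀ {g} ps → All Prime ps → (∀ {p} → p ∈ ps → p ∤ g) → Coprime g (product ps)
coprime-product []       []            ∤g (d∣g , d∣1) = ∣1⇒≡1 d∣1
coprime-product {g} (p ∷ ps) (pr ∷ primes) ∤g {d} (d∣g , d∣pps) =
  coprime-product ps primes (∤g ∘ there) (d∣g , coprime-divisor coprime-d-p d∣pps)
  where
  coprime-d-p : Coprime d p
  coprime-d-p {e} (e∣d , e∣p) with prime⇒irreducible pr e∣p
  ... | inj₁ e≡1  = e≡1
  ... | inj₂ refl = contradiction (∣-trans e∣d d∣g) (∤g (here refl))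

product-good : ∀ {ps x y} → All Prime ps → Good ps x y → gcd (gcd x y) (product ps) ≡ 1
product-good {ps} {x} {y} primes good = coprime⇒gcd≡1 (coprime-product ps primes
  λ p∈ p∣gcd → good p∈ (∣-trans p∣gcd (gcd[m,n]∣m x y)) (∣-trans p∣gcd (gcd[m,n]∣n x y)))

live-⊆ : ∀ {ps qs d x y} → ps ⊆ qs → Live ps d x y → Live qs d x y
live-⊆ ps⊆ stop = stop
live-⊆ {ps} {qs} ps⊆ (step (cx , cy , l)) = step (any-⊆ cx , any-⊆ cy , [ inj₁ ∘ live-⊆ ps⊆ , inj₂ ∘ live-⊆ ps⊆ ]′ l)
  where
  any-⊆ : ∀ {x} → Any (_∣ x) ps → Any (_∣ x) qs
  any-⊆ c with find c
  ... | p , p∈ , p∣ = lose (ps⊆ p∈) p∣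

bounded-≋ : ∀ {ps qs} → ps ⊆ qs → qs ⊆ ps → Bounded ps → Bounded qs
bounded-≋ ps⊆ qs⊆ bd x y good with bd x y (good ∘ ps⊆)
... | d , ¬l = d , ¬l ∘ live-⊆ qs⊆

module _ (P : PrimeSet) where

  private
    ps = elements P

  toAny : ∀ {x} → (∃ λ p → p ∈ ps × p ∣ x) → Any (_∣ x) ps
  toAny (p , p∈ , p∣x) = lose p∈ p∣x

  data Descends (x y : ℕ) (z : ℕ × ℕ) : Set where
    same  : z ≡ (x , y) → Descends x y z
    below : gcd (gcd x y) (N P) ≡ 1 → Any (_∣ x) ps → Any (_∣ y) ps →
            APT P x (x + y) z ⊎ APT P (x + y) y z → Descends x y z

  -- A tree element is built by adding steps at its end, a live path by adding them at its
  -- beginning; here the first step is brought to the front.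
  descends : ∀ {x y z} → APT P x y z → Descends x y z
  descends root = same refl
  descends (stepʳ a g cX cY) with descends a
  ... | same refl = below g (toAny cX) (toAny cY) (inj₁ root)
  ... | below g′ cx cy (inj₁ a′) = below g′ cx cy (inj₁ (stepʳ a′ g cX cY))
  ... | below g′ cx cy (inj₂ a′) = below g′ cx cy (inj₂ (stepʳ a′ g cX cY))
  descends (stepˡ a g cX cY) with descends a
  ... | same refl = below g (toAny cX) (toAny cY) (inj₂ root)
  ... | below g′ cx cy (inj₁ a′) = below g′ cx cy (inj₁ (stepˡ a′ g cX cY))
  ... | below g′ cx cy (inj₂ a′) = below g′ cx cy (inj₂ (stepˡ a′ g cX cY))

  nodes : ℕ → ℕ → ℕ → List (ℕ × ℕ)
  nodes zero    x y = (x , y) ∷ []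
  nodes (suc d) x y = (x , y) ∷ nodes d x (x + y) ++ nodes d (x + y) y

  ∈-nodes : ∀ d x y → ¬ Live ps d x y → ∀ z → APT P x y z → z ∈ nodes d x y
  ∈-nodes zero    x y ¬l z a = contradiction stop ¬l
  ∈-nodes (suc d) x y ¬l z a with descends a
  ... | same refl = here refl
  ... | below _ cx cy (inj₁ a′) =
        there (∈-++⁺ˡ (∈-nodes d x (x + y) (λ l → ¬l (step (cx , cy , inj₁ l))) z a′))
  ... | below _ cx cy (inj₂ a′) =
        there (∈-++⁺ʳ (nodes d x (x + y)) (∈-nodes d (x + y) y (λ l → ¬l (step (cx , cy , inj₂ l))) z a′))

  bounded⇒finiteType : Bounded ps → FiniteType P
  bounded⇒finiteType bd x y with gcd (gcd x y) (N P) ≟ 1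
  ... | yes g = let (d , ¬l) = bd x y (good-product (primes P) g) in nodes d x y , ∈-nodes d x y ¬l
  ... | no ¬g = (x , y) ∷ [] , λ z a → case descends a of λ where
        (same eq)       → here eq
        (below g _ _ _) → contradiction g ¬g

  -- Both coordinates are positive, so every step raises X + Y by at least one. Long paths thus
  -- contain nodes larger than anything in a finite list.
  live-node : ∀ d {x y X Y} → 1 ≤ X → 1 ≤ Y → APT P x y (X , Y) → Good ps X Y → Live ps d X Y →
    ∃₂ λ X′ Y′ → APT P x y (X′ , Y′) × d ≤ X′ + Y′
  live-node d {x} {y} 1≤X 1≤Y a good l =
    let (X′ , Y′ , a′ , le) = grow d 1≤X 1≤Y a good l z≤n in X′ , Y′ , a′ , ≤-trans (m≤m+n d 0) le
    where
    grow : ∀ e {X Y s} → 1 ≤ X → 1 ≤ Y → APT P x y (X , Y) → Good ps X Y → Live ps e X Y → s ≤ X + Y →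
      ∃₂ λ X′ Y′ → APT P x y (X′ , Y′) × e + s ≤ X′ + Y′
    grow zero 1≤X 1≤Y a good stop s≤ = _ , _ , a , s≤
    grow (suc e) {X} {Y} {s} 1≤X 1≤Y a good (step (cX , cY , inj₁ l)) s≤
      with grow e {s = suc s} 1≤X (≤-trans 1≤X (m≤m+n X Y)) (stepʳ a (product-good (primes P) good) (find cX) (find cY))
             (good-stepʳ good) l (+-mono-≤ 1≤X s≤)
    ... | X′ , Y′ , a′ , le = X′ , Y′ , a′ , ≤-trans (≤-reflexive (sym (+-suc e s))) le
    grow (suc e) {X} {Y} {s} 1≤X 1≤Y a good (step (cX , cY , inj₂ l)) s≤
      with grow e {s = suc s} (≤-trans 1≤X (m≤m+n X Y)) 1≤Y (stepˡ a (product-good (primes P) good) (find cX) (find cY))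
             (good-stepˡ good) l (≤-trans (+-mono-≤ 1≤Y s≤) (≤-reflexive (+-comm Y (X + Y))))
    ... | X′ , Y′ , a′ , le = X′ , Y′ , a′ , ≤-trans (≤-reflexive (sym (+-suc e s))) le

  finiteType⇒bounded : FiniteType P → Bounded ps
  finiteType⇒bounded fin x y good with fin x y
  ... | zs , z∈ = suc total , λ l →
        let (X , Y , a , big) = live-node (suc total) (>-nonZero⁻¹ x) (>-nonZero⁻¹ y) root good l
        in <-irrefl refl (≤-trans big (size (z∈ (X , Y) a)))
    where
    total = sum (map (λ (X , Y) → X + Y) zs)
    size : ∀ {z} {zs : List (ℕ × ℕ)} → z ∈ zs → proj₁ z + proj₂ z ≤ sum (map (λ (X , Y) → X + Y) zs)
    size (here refl) = m≤m+n _ _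
    size {zs = (X , Y) ∷ zs} (there z∈) = ≤-trans (size z∈) (m≤n+m _ (X + Y))

-- Periodicity modulo the product of the primes, and decidability

live? : ∀ ps d x y → Dec (Live ps d x y)
live? ps zero    x y = yes stop
live? ps (suc d) x y with Any.any? (_∣? x) ps ×-dec Any.any? (_∣? y) ps ×-dec (live? ps d x (x + y) ⊎-dec live? ps d (x + y) y)
... | yes l = yes (step l)
... | no ¬l = no λ { (step l) → ¬l l }

good? : ∀ ps x y → Dec (Good ps x y)
good? ps x y with Any.any? (λ p → p ∣? x ×-dec p ∣? y) ps
... | yes c = no λ good → let (p , p∈ , p∣x , p∣y) = find c in good p∈ p∣x p∣y
... | no ¬c = yes λ p∈ p∣x p∣y → ¬c (lose p∈ (p∣x , p∣y))

data Path (ps : List ℕ) : ℕ → ℕ → ℕ → ℕ → ℕ → Set where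
  halt : ∀ {x y} → Path ps zero x y x y
  step : ∀ {k x y X Y} → Any (_∣ x) ps × Any (_∣ y) ps × (Path ps k x (x + y) X Y ⊎ Path ps k (x + y) y X Y) →
         Path ps (suc k) x y X Y

path-live : ∀ {ps k e x y X Y} → Path ps k x y X Y → Live ps e X Y → Live ps (k + e) x y
path-live halt l = l
path-live (step (cx , cy , inj₁ π)) l = step (cx , cy , inj₁ (path-live π l))
path-live (step (cx , cy , inj₂ π)) l = step (cx , cy , inj₂ (path-live π l))

module Periodic (ps : List ℕ) (n : ℕ) .{{_ : NonZero n}} (periods : All (_∣ n) ps) where

  infix 4 _≈_
  _≈_ : ℕ → ℕ → Set
  x ≈ y = x % n ≡ y % n

  ≈-+ : ∀ {x x′ y y′} → x ≈ x′ → y ≈ y′ → x + y ≈ x′ + y′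
  ≈-+ {x} {x′} {y} {y′} x≈ y≈ =
    trans (%-distribˡ-+ x y n) (trans (cong₂ (λ r t → (r + t) % n) x≈ y≈) (sym (%-distribˡ-+ x′ y′ n)))

  ∣-≈ : ∀ {p x x′} → p ∈ ps → x ≈ x′ → p ∣ x → p ∣ x′
  ∣-≈ {p} p∈ x≈ p∣x = ∣n∣m%n⇒∣m p∣n (subst (p ∣_) x≈ (%-presˡ-∣ p∣x p∣n))
    where
    p∣n = All.lookup periods p∈

  any-≈ : ∀ {x x′} → x ≈ x′ → Any (_∣ x) ps → Any (_∣ x′) ps
  any-≈ x≈ c with find c
  ... | p , p∈ , p∣x = lose p∈ (∣-≈ p∈ x≈ p∣x)

  good-≈ : ∀ {x x′ y y′} → x ≈ x′ → y ≈ y′ → Good ps x y → Good ps x′ y′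
  good-≈ x≈ y≈ good p∈ p∣x p∣y = good p∈ (∣-≈ p∈ (sym x≈) p∣x) (∣-≈ p∈ (sym y≈) p∣y)

  live-≈ : ∀ d {x x′ y y′} → x ≈ x′ → y ≈ y′ → Live ps d x y → Live ps d x′ y′
  live-≈ zero    x≈ y≈ stop = stop
  live-≈ (suc d) {x} {x′} {y} {y′} x≈ y≈ (step (cx , cy , l)) = step (any-≈ x≈ cx , any-≈ y≈ cy ,
    [ inj₁ ∘ live-≈ d x≈ (≈-+ {x} x≈ y≈) , inj₂ ∘ live-≈ d (≈-+ {x} x≈ y≈) y≈ ]′ l)

  -- One turn of the cycle puts at least one step in front of the path that exists by induction at
  -- its end, where the residues are those of the start.
  loop : ∀ {k x y X Y} → Path ps (suc k) x y X Y → x ≈ X → y ≈ Y → ∀ e → Live ps e x y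
  loop π x≈ y≈ zero    = stop
  loop {k} {x} {y} π x≈ y≈ (suc e) = live-anti (suc e) k
    (subst (λ d → Live ps d x y) (cong suc (+-comm k e)) (path-live π (live-≈ e x≈ y≈ (loop π x≈ y≈ e))))

  states : ∀ {d x y} → Live ps d x y → Fin (suc d) → ℕ × ℕ
  states {x = x} {y} l zero = x , y
  states (step (_ , _ , inj₁ l)) (suc i) = states l i
  states (step (_ , _ , inj₂ l)) (suc i) = states l i

  prefix : ∀ {d x y} (l : Live ps d x y) i → ∃ λ k → Path ps k x y (proj₁ (states l i)) (proj₂ (states l i))
  prefix l zero = 0 , halt
  prefix (step (cx , cy , inj₁ l)) (suc i) = let (k , π) = prefix l i in suc k , step (cx , cy , inj₁ π)
  prefix (step (cx , cy , inj₂ l)) (suc i) = let (k , π) = prefix l i in suc k , step (cx , cy , inj₂ π)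

  segment : ∀ {d x y} (l : Live ps d x y) {i j} → i Fin.< j → ∃ λ k →
    Path ps (suc k) (proj₁ (states l i)) (proj₂ (states l i)) (proj₁ (states l j)) (proj₂ (states l j))
  segment (step (cx , cy , inj₁ l)) {zero}  {suc j} i<j = let (k , π) = prefix l j in k , step (cx , cy , inj₁ π)
  segment (step (cx , cy , inj₂ l)) {zero}  {suc j} i<j = let (k , π) = prefix l j in k , step (cx , cy , inj₂ π)
  segment (step (cx , cy , inj₁ l)) {suc i} {suc j} i<j = segment l (s<s⁻¹ i<j)
  segment (step (cx , cy , inj₂ l)) {suc i} {suc j} i<j = segment l (s<s⁻¹ i<j)

  residues : ℕ × ℕ → Fin (n * n)
  residues (x , y) = combine (fromℕ< (m%n<n x n)) (fromℕ< (m%n<n y n))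

  residues-≈ : ∀ {x y X Y} → residues (x , y) ≡ residues (X , Y) → x ≈ X × y ≈ Y
  residues-≈ {x} {y} {X} {Y} eq =
    let (eqˣ , eqʸ) = combine-injective (fromℕ< (m%n<n x n)) (fromℕ< (m%n<n y n)) (fromℕ< (m%n<n X n)) (fromℕ< (m%n<n Y n)) eq
    in trans (sym (toℕ-fromℕ< (m%n<n x n))) (trans (cong toℕ eqˣ) (toℕ-fromℕ< (m%n<n X n))) ,
       trans (sym (toℕ-fromℕ< (m%n<n y n))) (trans (cong toℕ eqʸ) (toℕ-fromℕ< (m%n<n Y n)))

  -- A path of n * n steps visits n * n + 1 pairs, two of which agree in their residues.
  live-forever : ∀ {x y} → Live ps (n * n) x y → ∀ e → Live ps e x y
  live-forever {x} {y} l e with pigeonhole (n<1+n (n * n)) (residues ∘ states l)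
  ... | i , j , i<j , eq with segment l i<j | residues-≈ {proj₁ (states l i)} {proj₂ (states l i)} eq | prefix l i
  ...   | k , π | x≈ , y≈ | k₀ , π₀ = live-anti e k₀
          (subst (λ d → Live ps d x y) (+-comm k₀ e) (path-live π₀ (loop π x≈ y≈ e)))

  -- The summand n makes the representative positive, as `Bounded` requires.
  representative : ∀ x → (n + x % n) ≈ x
  representative x = trans (cong (_% n) (+-comm n (x % n))) (trans ([m+n]%n≡m%n (x % n) n) (m%n%n≡m%n x n))

  Persists : ℕ × ℕ → Set
  Persists (r , t) = Good ps (n + r) (n + t) × Live ps (n * n) (n + r) (n + t)

  persistent? : Dec (Any (λ r → Any (λ t → Persists (r , t)) (upTo n)) (upTo n))
  persistent? = Any.any? (λ r → Any.any? (λ t → good? ps (n + r) (n + t) ×-dec live? ps (n * n) (n + r) (n + t)) (upTo n)) (upTo n)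

  dies : ¬ Any (λ r → Any (λ t → Persists (r , t)) (upTo n)) (upTo n) →
    ∀ x y → Good ps x y → ¬ Live ps (n * n) x y
  dies ¬p x y good l = ¬p (lose (∈-upTo⁺ (m%n<n x n)) (lose (∈-upTo⁺ (m%n<n y n))
    (good-≈ (sym (representative x)) (sym (representative y)) good ,
     live-≈ (n * n) (sym (representative x)) (sym (representative y)) l)))

  bounded? : Dec (Bounded ps)
  bounded? with persistent?
  ... | no ¬p = yes λ x y good → n * n , dies ¬p x y good
  ... | yes p with find p
  ...   | r , _ , p′ with find p′
  ...     | t , _ , good , l = no λ bd →
            let (d , ¬l) = bd (n + r) (n + t) {{nonZero-+ r}} {{nonZero-+ t}} good in ¬l (live-forever l d)
    where
    nonZero-+ : ∀ m → NonZero (n + m)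
    nonZero-+ m = >-nonZero (≤-trans (>-nonZero⁻¹ n) (m≤m+n n m))

finiteType? : ∀ P → Dec (FiniteType P)
finiteType? P = map′ (bounded⇒finiteType P) (finiteType⇒bounded P)
  (Periodic.bounded? (elements P) (N P) {{productOfPrimes≢0 (primes P)}} (All.tabulate ∈⇒∣product))

finiteType-≋ : ∀ {P Q} → P ≋ Q → FiniteType P → FiniteType Q
finiteType-≋ {P} {Q} (P⊆Q , Q⊆P) fin = bounded⇒finiteType Q (bounded-≋ P⊆Q Q⊆P (finiteType⇒bounded P fin))

-- Cycles for two sets of infinite type

data Move : Set where
  right left : Move

follow : List ℕ → ℕ → List Move → ℕ → ℕ → Maybe (ℕ × ℕ)
follow ms n []      x y = just (x , y)
follow ms n (m ∷ w) x y with divided ms x ∧ divided ms y | m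
... | false | _ = nothing
... | true  | right = follow ms n w x ((x + y) mod-suc n)
... | true  | left  = follow ms n w ((x + y) mod-suc n) y

divided-true : ∀ ms w → divided ms w ≡ true → Any (_∣ w) (map suc ms)
divided-true (m ∷ ms) w eq with w mod-suc m in e
... | zero  = here (mod-suc≡0⇒∣ w m e)
... | suc _ = there (divided-true ms w eq)

module _ (ms : List ℕ) (n : ℕ) (periods : All (_∣ suc n) (map suc ms)) where

  open Periodic (map suc ms) (suc n) periods

  follow-path : ∀ w x y {a b} → follow ms n w (x % suc n) (y % suc n) ≡ just (a , b) →
    ∃₂ λ X Y → Path (map suc ms) (length w) x y X Y × X % suc n ≡ a × Y % suc n ≡ b
  follow-path [] x y refl = x , y , halt , refl , refl
  follow-path (m ∷ w) x y eq with divided ms (x % suc n) ∧ divided ms (y % suc n) in cov | m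
  ... | true | right with follow-path w x (x + y) (trans (cong (follow ms n w (x % suc n)) (%-distribˡ-+ x y (suc n))) eq)
  ...   | X , Y , π , eqs = X , Y , step (covers x (proj₁ (∧-true _ cov)) , covers y (proj₂ (∧-true (divided ms (x % suc n)) cov)) , inj₁ π) , eqs
    where
    covers : ∀ z → divided ms (z % suc n) ≡ true → Any (_∣ z) (map suc ms)
    covers z eq = any-≈ (m%n%n≡m%n z (suc n)) (divided-true ms _ eq)
  follow-path (m ∷ w) x y eq | true | left with follow-path w (x + y) y (trans (cong (λ z → follow ms n w z (y % suc n)) (%-distribˡ-+ x y (suc n))) eq)
  ...   | X , Y , π , eqs = X , Y , step (covers x (proj₁ (∧-true _ cov)) , covers y (proj₂ (∧-true (divided ms (x % suc n)) cov)) , inj₂ π) , eqs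
    where
    covers : ∀ z → divided ms (z % suc n) ≡ true → Any (_∣ z) (map suc ms)
    covers z eq = any-≈ (m%n%n≡m%n z (suc n)) (divided-true ms _ eq)

  cycle-unbounded : ∀ m w x y {ps} .{{_ : NonZero x}} .{{_ : NonZero y}} → All Prime ps → map suc ms ⊆ ps → gcd x y ≡ 1 →
    follow ms n (m ∷ w) (x % suc n) (y % suc n) ≡ just (x % suc n , y % suc n) → ¬ Bounded ps
  cycle-unbounded m w x y primes ms⊆ coprime eq bd with follow-path (m ∷ w) x y eq
  ... | X , Y , π , X≈ , Y≈ with bd x y (λ {p} p∈ p∣x p∣y →
          ¬prime[1] (subst Prime (∣1⇒≡1 (subst (p ∣_) coprime (gcd-greatest p∣x p∣y))) (All.lookup primes p∈)))
  ...   | d , ¬l = ¬l (live-⊆ ms⊆ (loop π (sym X≈) (sym Y≈) d))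

repeat : ℕ → List Move → List Move
repeat k w = concat (replicate k w)

-- The cycle consists of twelve passes through one word of seven moves. The first move is split off
-- because `cycle-unbounded` expects a nonempty word.
unbounded-2-3-5-7-19 : ∀ {ps} → All Prime ps → 2 ∷ 3 ∷ 5 ∷ 7 ∷ 19 ∷ [] ⊆ ps → ¬ Bounded ps
unbounded-2-3-5-7-19 prs ⊆ps = cycle-unbounded (1 ∷ 2 ∷ 4 ∷ 6 ∷ 18 ∷ []) 3989
  (from-yes (All.all? (_∣? 3990) (2 ∷ 3 ∷ 5 ∷ 7 ∷ 19 ∷ [])))
  left (right ∷ right ∷ left ∷ right ∷ left ∷ left ∷
    repeat 11 (left ∷ right ∷ right ∷ left ∷ right ∷ left ∷ left ∷ [])) 666 685 prs ⊆ps refl refl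

-- Six passes through a word of eighteen moves, again with the first move split off.
unbounded-2-3-5-13-17 : ∀ {ps} → All Prime ps → 2 ∷ 3 ∷ 5 ∷ 13 ∷ 17 ∷ [] ⊆ ps → ¬ Bounded ps
unbounded-2-3-5-13-17 prs ⊆ps = cycle-unbounded (1 ∷ 2 ∷ 4 ∷ 12 ∷ 16 ∷ []) 6629
  (from-yes (All.all? (_∣? 6630) (2 ∷ 3 ∷ 5 ∷ 13 ∷ 17 ∷ [])))
  right (drop 1 (repeat 6 (right ∷ left ∷ left ∷ right ∷ left ∷ right ∷ left ∷ right ∷ right ∷
    left ∷ right ∷ right ∷ left ∷ right ∷ left ∷ right ∷ left ∷ left ∷ [])))
  391 783 prs ⊆ps refl refl

-- Sets of at most six primes, and statement (1)

classification : ∀ {ps} → All Prime ps → length ps ≤ 6 → All (λ e → ¬ e ⊆ ps) exceptional → Bounded ps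
classification {ps} primes small free = cases (2 ∈? ps) (3 ∈? ps) (5 ∈? ps)
  where
  free-product : ∀ {e} → All Prime e → ¬ e ⊆ ps → ¬ (∀ {p} → Prime p → p ∣ product e → p ∈ ps)
  free-product prs e⊈ h = e⊈ λ q∈ → h (All.lookup prs q∈) (∈⇒∣product q∈)
  free-products : All (λ e → ¬ (∀ {p} → Prime p → p ∣ e → p ∈ ps)) products
  free-products = products-free exceptional-primes free
    where
    products-free : ∀ {ess} → All (All Prime) ess → All (λ e → ¬ e ⊆ ps) ess →
      All (λ e → ¬ (∀ {p} → Prime p → p ∣ e → p ∈ ps)) (map product ess)
    products-free [] [] = []
    products-free (prs ∷ prss) (e⊈ ∷ es⊈) = free-product prs e⊈ ∷ products-free prss es⊈
  prime[3] : Prime 3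
  prime[3] = from-yes (prime? 3)
  prime[5] : Prime 5
  prime[5] = from-yes (prime? 5)
  all∈ : ∀ {xs} → All (_∈ ps) xs → xs ⊆ ps
  all∈ = All.lookup
  certified : ∀ {bs n hs es} → Certificate bs n hs es → bs ⊆ ps →
    All (λ e → ¬ (∀ {p} → Prime p → p ∣ e → p ∈ ps)) es → Bounded ps
  certified cert bs⊆ fr x y good = _ , certificate-sound cert ps primes bs⊆ small fr x y good
  cases : Dec (2 ∈ ps) → Dec (3 ∈ ps) → Dec (5 ∈ ps) → Bounded ps
  cases (yes 2∈) (yes 3∈) (yes 5∈) = certified certificate-2-3-5 (all∈ (2∈ ∷ 3∈ ∷ 5∈ ∷ [])) free-products
  cases (yes 2∈) (yes 3∈) (no 5∉)  = certified certificate-2-3 (all∈ (2∈ ∷ 3∈ ∷ []))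
    ((λ h → 5∉ (h prime[5] ∣-refl)) ∷ free-products)
  cases (yes 2∈) (no 3∉) (yes 5∈)  = certified certificate-2-5 (all∈ (2∈ ∷ 5∈ ∷ []))
    ((λ h → 3∉ (h prime[3] ∣-refl)) ∷ free-products)
  cases (yes 2∈) (no 3∉) (no 5∉)   = certified certificate (λ ())
    ((λ h → 3∉ (h prime[3] (divides 2 refl))) ∷ (λ h → 5∉ (h prime[5] (divides 2 refl))) ∷ free-products)
  cases (no 2∉) _ _ = certified certificate (λ ())
    ((λ h → 2∉ (h prime[2] (divides 3 refl))) ∷ (λ h → 2∉ (h prime[2] (divides 5 refl))) ∷ free-products)

exceptional-large : All (λ e → 5 ≤ length e) exceptional
exceptional-large = from-yes (All.all? (λ e → 5 ≤? length e) exceptional)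

exceptional-unique : All Unique exceptional
exceptional-unique = from-yes (All.all? unique? exceptional)

card≤4⇒finiteType : ∀ P → card P ≤ 4 → FiniteType P
card≤4⇒finiteType P small = bounded⇒finiteType P (classification (primes P) (≤-trans small (m≤m+n 4 2))
  (All.tabulate λ e∈ e⊆ → <-irrefl refl (≤-trans (All.lookup exceptional-large e∈)
    (≤-trans (unique-⊆⇒length≤ (All.lookup exceptional-unique e∈) e⊆) small))))

-- Large primes, and statement (2)

Covered : List ℕ → ℕ → Set
Covered ps x = Any (_∣ x) ps

-- Only the sums are required to be covered: a coordinate kept from the start may owe its prime to a
-- large one and need not be divisible by any prime of this list.
data NewCovered (ps : List ℕ) : ℕ → ℕ → ℕ → Set where
  stop : ∀ {x y} → NewCovered ps zero x y
  step : ∀ {d x y} → Covered ps (x + y) → NewCovered ps d x (x + y) ⊎ NewCovered ps d (x + y) y →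
         NewCovered ps (suc d) x y

newCovered-swap : ∀ {ps} d {x y} → NewCovered ps d x y → NewCovered ps d y x
newCovered-swap zero stop = stop
newCovered-swap {ps} (suc d) {x} {y} (step c ν) = step (subst (Covered ps) (+-comm x y) c) (case ν of λ where
  (inj₁ ν) → inj₂ (subst (λ z → NewCovered ps d z x) (+-comm x y) (newCovered-swap d ν))
  (inj₂ ν) → inj₁ (subst (NewCovered ps d y) (+-comm x y) (newCovered-swap d ν)))

newCovered-live : ∀ {ps d x y} → Covered ps x → Covered ps y → NewCovered ps d x y → Live ps d x y
newCovered-live cx cy stop = stop
newCovered-live cx cy (step c (inj₁ ν)) = step (cx , cy , inj₁ (newCovered-live cx c ν))
newCovered-live cx cy (step c (inj₂ ν)) = step (cx , cy , inj₂ (newCovered-live c cy ν))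

newCovered-anti : ∀ {ps} d e {x y} → NewCovered ps (d + e) x y → NewCovered ps d x y
newCovered-anti zero    e ν = stop
newCovered-anti (suc d) e (step c (inj₁ ν)) = step c (inj₁ (newCovered-anti d e ν))
newCovered-anti (suc d) e (step c (inj₂ ν)) = step c (inj₂ (newCovered-anti d e ν))

module _ {ps : List ℕ} (primes : All Prime ps) where

  -- y + i x is divisible by no prime of the list when i is the product of those
  -- primes of the list that do not divide y.
  private
    ∤y : ℕ → List ℕ
    ∤y y = filter (λ p → ¬? (p ∣? y)) ps

  product-filter≤ : ∀ {P : ℕ → Set} (P? : ∀ x → Dec (P x)) {qs} → All Prime qs → product (filter P? qs) ≤ product qs
  product-filter≤ P? [] = ≤-refl
  product-filter≤ P? {q ∷ qs} (pr ∷ prs) with P? q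
  ... | yes _ = *-monoʳ-≤ q (product-filter≤ P? prs)
  ... | no  _ = ≤-trans (product-filter≤ P? prs) (m≤n*m (product qs) q {{prime⇒nonZero pr}})

  uncovered-in-run : ∀ {x y} → Good ps x y → ∃ λ i → i ≤ product ps × ¬ Covered ps (y + i * x)
  uncovered-in-run {x} {y} good = i , product-filter≤ (λ p → ¬? (p ∣? y)) primes , uncovered
    where
    i = product (∤y y)
    uncovered : ¬ Covered ps (y + i * x)
    uncovered c with find c
    ... | p , p∈ , p∣ with p ∣? y
    ...   | no p∤y = p∤y (∣m+n∣m⇒∣n (subst (p ∣_) (+-comm y (i * x)) p∣)
              (∣m⇒∣m*n x (∈⇒∣product (∈-filter⁺ (λ p → ¬? (p ∣? y)) p∈ p∤y))))
    ...   | yes p∣y with euclidsLemma i x (All.lookup primes p∈) (∣m+n∣m⇒∣n p∣ p∣y)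
    ...     | inj₂ p∣x = good p∈ p∣x p∣y
    ...     | inj₁ p∣i = proj₂ (∈-filter⁻ (λ p → ¬? (p ∣? y)) {xs = ps}
                (prime∣product⇒∈ (All.lookup primes p∈) (All.tabulate λ q∈ →
                  All.lookup primes (proj₁ (∈-filter⁻ (λ p → ¬? (p ∣? y)) {xs = ps} q∈))) p∣i)) p∣y

  module _ {m : ℕ} (dies : ∀ {x y} → Good ps x y → ¬ Live ps m x y) where

    -- After a turn both coordinates would be covered, so the path would be live for m steps, which
    -- `dies` forbids. Hence the path stays straight.
    run-covered : ∀ k {x y} → Good ps x y → Covered ps y → NewCovered ps (k + m) x y →
      ∀ i → i ≤ k → Covered ps (y + i * x)
    run-covered k {x} {y} good c ν zero i≤k = subst (Covered ps) (sym (+-identityʳ y)) c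
    run-covered (suc k) {x} {y} good c (step c′ (inj₁ ν)) (suc i) (s≤s i≤k) =
      subst (Covered ps) (shuffle x y (i * x)) (run-covered k (good-stepʳ good) c′ ν i i≤k)
      where
      shuffle : ∀ x y z → x + y + z ≡ y + (x + z)
      shuffle = solve-∀
    run-covered (suc k) {x} {y} good c (step c′ (inj₂ ν)) (suc i) i≤k = ⊥-elim (dies (good-stepˡ good)
      (live-anti m k (newCovered-live c′ c (subst (λ d → NewCovered ps d (x + y) y) (+-comm k m) ν))))

    -- The first step produces a covered coordinate, and the straight run that must follow meets an
    -- uncovered entry within `product ps` steps.
    newCovered-bounded : ∀ k → product ps ≤ k → ∀ {x y} → Good ps x y → ¬ NewCovered ps (suc (k + m)) x y
    newCovered-bounded k n≤k {x} {y} good (step c (inj₁ ν)) with uncovered-in-run (good-stepʳ good)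
    ... | i , i≤n , ¬c = ¬c (run-covered k (good-stepʳ good) c ν i (≤-trans i≤n n≤k))
    newCovered-bounded k n≤k {x} {y} good (step c (inj₂ ν)) with uncovered-in-run (good-swap (good-stepˡ good))
    ... | i , i≤n , ¬c = ¬c (run-covered k (good-swap (good-stepˡ good)) c
            (newCovered-swap (k + m) ν) i (≤-trans i≤n n≤k))

-- A large prime dividing one coordinate divides no entry that is new within the
-- next d steps, these being a x + b y with a and b positive and a + b ≤ 2 ^ d.
Avoids : ℕ → ℕ → ℕ → ℕ → Set
Avoids p d x y = ∀ a b → 1 ≤ a → 1 ≤ b → a + b ≤ 2 ^ d → p ∤ a * x + b * y

avoids-stepʳ : ∀ {p d x y} → Avoids p (suc d) x y → Avoids p d x (x + y)
avoids-stepʳ {p} {d} {x} {y} av a b 1≤a 1≤b a+b≤ p∣ = av (a + b) b (≤-trans 1≤a (m≤m+n a b)) 1≤b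
  (≤-trans (≤-trans (m≤m+n (a + b + b) a) (≤-reflexive (double a b))) (*-monoʳ-≤ 2 a+b≤))
  (subst (p ∣_) (shuffle a b x y) p∣)
  where
  double : ∀ a b → a + b + b + a ≡ 2 * (a + b)
  double = solve-∀
  shuffle : ∀ a b x y → a * x + b * (x + y) ≡ (a + b) * x + b * y
  shuffle = solve-∀

avoids-swap : ∀ {p d x y} → Avoids p d x y → Avoids p d y x
avoids-swap {p} {d} {x} {y} av a b 1≤a 1≤b a+b≤ p∣ = av b a 1≤b 1≤a
  (subst (_≤ 2 ^ d) (+-comm a b) a+b≤) (subst (p ∣_) (+-comm (a * y) (b * x)) p∣)

avoids-stepˡ : ∀ {p d x y} → Avoids p (suc d) x y → Avoids p d (x + y) y
avoids-stepˡ {p} {d} {x} {y} av = avoids-swap {p} {d} (subst (Avoids p d y) (+-comm y x) (avoids-stepʳ {p} {d} (avoids-swap {p} {suc d} av)))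

divisor-avoids : ∀ {p d x y} → Prime p → 2 ^ d < p → p ∣ x → p ∤ y → Avoids p d x y
divisor-avoids {p} {d} {x} {y} pr d<p p∣x p∤y a b 1≤a 1≤b a+b≤ p∣
  with euclidsLemma b y pr (∣m+n∣m⇒∣n p∣ (∣n⇒∣m*n a p∣x))
... | inj₂ p∣y = p∤y p∣y
... | inj₁ p∣b = <-irrefl refl (≤-trans d<p
      (≤-trans (∣⇒≤ {{>-nonZero 1≤b}} p∣b) (≤-trans (m≤n+m b a) a+b≤)))

module LargePrimes {ps qs : List ℕ} (primes : All Prime ps) (qs⊆ps : qs ⊆ ps)
  (b : ℕ) (short : ∀ {x y} → Good ps x y → ¬ NewCovered qs b x y) where

  reach : ℕ → ℕ
  reach zero    = b + 1
  reach (suc u) = b + reach u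

  reach≥1 : ∀ u → 1 ≤ reach u
  reach≥1 zero    = m≤n+m 1 b
  reach≥1 (suc u) = ≤-trans (reach≥1 u) (m≤n+m (reach u) b)

  Split : ℕ → List ℕ → List ℕ → Set
  Split d used unused = ∀ {p} → p ∈ ps → p ∈ qs ⊎ p ∈ used ⊎ (p ∈ unused × 2 ^ d < p)

  scan : ∀ e d used unused → Split d used unused → ∀ rest → 1 ≤ rest → e + rest ≤ d →
    (∀ {p x y} → p ∈ unused → Good ps x y → (∀ {q} → q ∈ p ∷ used → Avoids q rest x y) → ¬ Live ps rest x y) →
    ∀ {x y} → Good ps x y → (∀ {p} → p ∈ used → Avoids p (e + rest) x y) →
    Live ps (e + rest) x y → NewCovered qs e x y
  scan zero d used unused split rest 1≤rest e≤d ¬live good av l = stop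
  scan (suc e) d used unused split rest 1≤rest e≤d ¬live {x} {y} good av (step (_ , _ , l)) =
    step covered-sum (case l of λ where
      (inj₁ l) → inj₁ (scan e d used unused split rest 1≤rest (≤-trans (n≤1+n _) e≤d) ¬live
        (good-stepʳ good) (λ p∈ → avoids-stepʳ {d = e + rest} (av p∈)) l)
      (inj₂ l) → inj₂ (scan e d used unused split rest 1≤rest (≤-trans (n≤1+n _) e≤d) ¬live
        (good-stepˡ good) (λ p∈ → avoids-stepˡ {d = e + rest} (av p∈)) l))
    where
    head-covered : ∀ {d x y} → 1 ≤ d → Live ps d x y → Covered ps x × Covered ps y
    head-covered (s≤s _) (step (cx , cy , _)) = cx , cy
    1≤e+rest : 1 ≤ e + rest
    1≤e+rest = ≤-trans 1≤rest (m≤n+m rest e)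
    sum-covered : Covered ps (x + y)
    sum-covered = [ proj₂ ∘ head-covered 1≤e+rest , proj₁ ∘ head-covered 1≤e+rest ]′ l
    late : ∀ {x y} → Live ps (e + rest) x y → Live ps rest x y
    late {x} {y} l = live-anti rest e (subst (λ k → Live ps k x y) (+-comm e rest) l)
    early : ∀ {p x y} → Avoids p (e + rest) x y → Avoids p rest x y
    early av a b 1≤a 1≤b a+b≤ = av a b 1≤a 1≤b (≤-trans a+b≤ (^-monoʳ-≤ 2 (m≤n+m rest e)))
    use : ∀ {p} → p ∈ ps → p ∈ unused → 2 ^ d < p → p ∣ x + y → ⊥
    use {p} p∈ p∈unused large p∣ = case l of λ where
        (inj₁ l) → ¬live p∈unused (good-stepʳ good) (λ where
            (here refl) → avoids-swap {p} {rest} (divisor-avoids {d = rest} pr large′ p∣ λ p∣x → good p∈ p∣x (∣m+n∣m⇒∣n p∣ p∣x))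
            {q} (there q∈) → early {q} (avoids-stepʳ {d = e + rest} (av q∈)))
          (late l)
        (inj₂ l) → ¬live p∈unused (good-stepˡ good) (λ where
            (here refl) → divisor-avoids {d = rest} pr large′ p∣ λ p∣y → good p∈ (∣m+n∣m⇒∣n (subst (p ∣_) (+-comm x y) p∣) p∣y) p∣y
            {q} (there q∈) → early {q} (avoids-stepˡ {d = e + rest} (av q∈)))
          (late l)
      where
      pr = All.lookup primes p∈
      large′ : 2 ^ rest < p
      large′ = ≤-trans (s≤s (^-monoʳ-≤ 2 (≤-trans (m≤n+m rest (suc e)) e≤d))) large
    covered-sum : Covered qs (x + y)
    covered-sum with find sum-covered
    ... | p , p∈ , p∣ with split p∈
    ...   | inj₁ p∈qs = lose p∈qs p∣
    ...   | inj₂ (inj₂ (p∈unused , large)) = ⊥-elim (use p∈ p∈unused large p∣)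
    ...   | inj₂ (inj₁ p∈used) = contradiction (subst (p ∣_) (cong₂ _+_ (sym (*-identityˡ x)) (sym (*-identityˡ y))) p∣)
              (av p∈used 1 1 ≤-refl ≤-refl (*-monoʳ-≤ 2 (m^n>0 2 (e + rest))))

  large-bounded : ∀ u d used unused → length unused ≤ u → Split d used unused → reach u ≤ d →
    ∀ {x y} → Good ps x y → (∀ {p} → p ∈ used → Avoids p (reach u) x y) → ¬ Live ps (reach u) x y
  large-bounded zero d used unused len split r≤d good av l = short good
    (scan b d used unused split 1 ≤-refl r≤d
      (λ p∈ → contradiction (≤-trans (∈-length p∈) len) (<-irrefl refl)) good av l)
  large-bounded (suc u) d used unused len split r≤d good av l = short good
    (scan b d used unused split (reach u) (reach≥1 u) r≤d descend good av l)
    where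
    descend : ∀ {p x y} → p ∈ unused → Good ps x y → (∀ {q} → q ∈ p ∷ used → Avoids q (reach u) x y) → ¬ Live ps (reach u) x y
    descend {p} p∈ good′ av′ with ∈-∃++ p∈
    ... | as , bs , refl = large-bounded u d (p ∷ used) (as ++ bs)
      (s≤s⁻¹ (≤-trans (≤-reflexive (sym (↭-length (shift p as bs)))) len)) split′
      (≤-trans (m≤n+m (reach u) b) r≤d) good′ av′
      where
      split′ : Split d (p ∷ used) (as ++ bs)
      split′ q∈ with split q∈
      ... | inj₁ q∈qs = inj₁ q∈qs
      ... | inj₂ (inj₁ q∈used) = inj₂ (inj₁ (there q∈used))
      ... | inj₂ (inj₂ (q∈unused , large)) with ∈-resp-↭ (shift p as bs) q∈unused
      ...   | here q≡p = inj₂ (inj₁ (here q≡p))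
      ...   | there q∈ = inj₂ (inj₂ (q∈ , large))

small : ℕ → PrimeSet → PrimeSet
small b P = record
  { elements = filter (_≤? b) (elements P)
  ; unique   = Unique.filter⁺ (_≤? b) (unique P)
  ; primes   = All.tabulate λ p∈ → All.lookup (primes P) (proj₁ (∈-filter⁻ (_≤? b) {xs = elements P} p∈))
  }

product≤^ : ∀ {b r} qs → All (_≤ b) qs → length qs ≤ r → product qs ≤ suc b ^ r
product≤^ {b} {r} [] [] len = m^n>0 (suc b) r
product≤^ {b} {suc r} (q ∷ qs) (q≤b ∷ qs≤b) (s≤s len) = *-mono-≤ (m≤n⇒m≤1+n q≤b) (product≤^ qs qs≤b len)

module _ (r : ℕ) where

  -- For at most r primes up to b, `suc b ^ r` bounds their product, hence the straight runs, and
  -- its square bounds the number of pairs of residues. These are k and m of `newCovered-bounded`.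
  runs : ℕ → ℕ
  runs b = suc (suc b ^ r + suc b ^ r * suc b ^ r)

  reaches : ℕ → ℕ → ℕ
  reaches b zero    = runs b + 1
  reaches b (suc u) = runs b + reaches b u

  next : ℕ → ℕ
  next b = b ⊔ 2 ^ reaches b r

  next-prime : ∀ P → Primitive P → card P ≡ r → ∀ b → Any (b <_) (elements P) →
    Any (λ p → b < p × p ≤ next b) (elements P)
  next-prime P (inf , minimal) card≡r b larger with Any.any? (λ p → b <? p ×-dec p ≤? next b) (elements P)
  ... | yes found = found
  ... | no ¬found = contradiction (bounded⇒finiteType P λ x y good → reaches b r , λ l →
        large-bounded r (reaches b r) [] ps (≤-reflexive card≡r) split (≤-reflexive (reach≡ r)) good (λ ())
          (subst (λ d → Live ps d x y) (sym (reach≡ r)) l)) inf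
    where
    ps = elements P
    Q = small b P
    qs = elements Q
    qs⊆ps : qs ⊆ ps
    qs⊆ps = proj₁ ∘ ∈-filter⁻ (_≤? b) {xs = ps}
    Q⊊P : Q ⊊ P
    Q⊊P = qs⊆ps , λ ps⊆qs → let (p , p∈ , b<p) = find larger in
      <⇒≱ b<p (proj₂ (∈-filter⁻ (_≤? b) {xs = ps} (ps⊆qs p∈)))
    qs≤b : All (_≤ b) qs
    qs≤b = All.tabulate (proj₂ ∘ ∈-filter⁻ (_≤? b) {xs = ps})
    n≤ : N Q ≤ suc b ^ r
    n≤ = product≤^ qs qs≤b (≤-trans (unique-⊆⇒length≤ (unique Q) qs⊆ps) (≤-reflexive card≡r))
    open Periodic qs (N Q) {{productOfPrimes≢0 (primes Q)}} (All.tabulate ∈⇒∣product) using (live-forever; live-≈; good-≈; representative)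
    instance
      N≢0 : NonZero (N Q)
      N≢0 = productOfPrimes≢0 (primes Q)
    dies′ : ∀ {x y} → Good qs x y → ¬ Live qs (N Q * N Q) x y
    -- `Bounded` speaks of positive pairs only, while here zero coordinates are allowed; passing to
    -- positive representatives bridges the difference.
    dies′ {x} {y} good l with finiteType⇒bounded Q (minimal Q Q⊊P) (N Q + x % N Q) (N Q + y % N Q)
        {{>-nonZero (≤-trans (>-nonZero⁻¹ (N Q)) (m≤m+n _ _))}} {{>-nonZero (≤-trans (>-nonZero⁻¹ (N Q)) (m≤m+n _ _))}}
        (good-≈ (sym (representative x)) (sym (representative y)) good)
    ... | d , ¬l = ¬l (live-≈ d (sym (representative x)) (sym (representative y)) (live-forever l d))
    dies : ∀ {x y} → Good qs x y → ¬ Live qs (suc b ^ r * suc b ^ r) x y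
    dies {x} {y} good l = dies′ good (live-anti (N Q * N Q) _
      (subst (λ d → Live qs d x y) (sym (m+[n∸m]≡n (*-mono-≤ n≤ n≤))) l))
    short : ∀ {x y} → Good ps x y → ¬ NewCovered qs (runs b) x y
    short good = newCovered-bounded (primes Q) dies (suc b ^ r) n≤ (good ∘ qs⊆ps)
    open LargePrimes (primes P) qs⊆ps (runs b) short
    reach≡ : ∀ u → reach u ≡ reaches b u
    reach≡ zero    = refl
    reach≡ (suc u) = cong (runs b +_) (reach≡ u)
    split : ∀ {p} → p ∈ ps → p ∈ qs ⊎ p ∈ [] ⊎ (p ∈ ps × 2 ^ reaches b r < p)
    split {p} p∈ with p ≤? b
    ... | yes p≤b = inj₁ (∈-filter⁺ (_≤? b) p∈ p≤b)
    ... | no  p≰b = inj₂ (inj₂ (p∈ , ≤-trans (s≤s (m≤n⊔m b _)) (≰⇒> λ p≤ → ¬found (lose p∈ (≰⇒> p≰b , p≤)))))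

  bound : ℕ → ℕ
  bound zero    = 0
  bound (suc k) = next (bound k)

  -- Each passage from one bound to the next captures a further prime, unless none is left above; r
  -- captures exhaust P.
  bound-enough : ∀ P → Primitive P → card P ≡ r → ∀ k → All (_≤ bound k) (elements P) ⊎ k ≤ card (small (bound k) P)
  bound-enough P prim card≡r zero = inj₂ z≤n
  bound-enough P prim card≡r (suc k) with bound-enough P prim card≡r k
  ... | inj₁ all≤ = inj₁ (All.map (λ p≤ → ≤-trans p≤ (m≤m⊔n _ _)) all≤)
  ... | inj₂ k≤ with Any.any? (bound k <?_) (elements P)
  ...   | no none = inj₁ (All.tabulate λ p∈ → ≤-trans (≮⇒≥ λ b<p → none (lose p∈ b<p)) (m≤m⊔n _ _))
  ...   | yes some with find (next-prime P prim card≡r (bound k) some)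
  ...     | p , p∈ , b<p , p≤ = inj₂ (≤-trans (s≤s k≤)
            (unique-⊆⇒length≤ (All.tabulate p≢ ∷ unique (small (bound k) P)) incl))
    where
    p≢ : ∀ {q} → q ∈ elements (small (bound k) P) → p ≢ q
    p≢ q∈ refl = <⇒≱ b<p (proj₂ (∈-filter⁻ (_≤? bound k) {xs = elements P} q∈))
    incl : p ∷ elements (small (bound k) P) ⊆ elements (small (bound (suc k)) P)
    incl (here refl) = ∈-filter⁺ (_≤? bound (suc k)) p∈ p≤
    incl (there q∈) = let (q∈′ , q≤) = ∈-filter⁻ (_≤? bound k) {xs = elements P} q∈ in
      ∈-filter⁺ (_≤? bound (suc k)) q∈′ (≤-trans q≤ (m≤m⊔n _ _))

  primitive≤bound : ∀ P → Primitive P → card P ≡ r → All (_≤ bound r) (elements P)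
  primitive≤bound P prim card≡r with bound-enough P prim card≡r r
  ... | inj₁ all≤ = all≤
  ... | inj₂ r≤ = All.tabulate λ {p} p∈ → ≮⇒≥ λ b<p → <-irrefl refl (≤-trans (s≤s r≤)
        (≤-trans (unique-⊆⇒length≤ (All.tabulate (p≢ b<p) ∷ unique (small (bound r) P)) (incl p∈)) (≤-reflexive card≡r)))
    where
    p≢ : ∀ {p q} → bound r < p → q ∈ elements (small (bound r) P) → p ≢ q
    p≢ b<p q∈ refl = <⇒≱ b<p (proj₂ (∈-filter⁻ (_≤? bound r) {xs = elements P} q∈))
    incl : ∀ {p} → p ∈ elements P → p ∷ elements (small (bound r) P) ⊆ elements P
    incl p∈ (here refl) = p∈
    incl p∈ (there q∈) = proj₁ (∈-filter⁻ (_≤? bound r) {xs = elements P} q∈)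

sublists : List ℕ → List (List ℕ)
sublists []       = [] ∷ []
sublists (x ∷ xs) = sublists xs ++ map (x ∷_) (sublists xs)

filter∈sublists : ∀ {P : ℕ → Set} (P? : ∀ x → Dec (P x)) xs → filter P? xs ∈ sublists xs
filter∈sublists P? [] = here refl
filter∈sublists P? (x ∷ xs) with P? x
... | yes _ = ∈-++⁺ʳ (sublists xs) (∈-map⁺ (x ∷_) (filter∈sublists P? xs))
... | no  _ = ∈-++⁺ˡ (filter∈sublists P? xs)

primeSets : List (List ℕ) → List PrimeSet
primeSets [] = []
primeSets (xs ∷ xss) with unique? xs ×-dec All.all? prime? xs
... | yes (uq , prs) = record { elements = xs ; unique = uq ; primes = prs } ∷ primeSets xss
... | no _ = primeSets xss

∈-primeSets : ∀ {xs} xss → xs ∈ xss → Unique xs → All Prime xs → Any (λ P → elements P ≡ xs) (primeSets xss)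
∈-primeSets (xs ∷ xss) xs∈ uq prs with unique? xs ×-dec All.all? prime? xs | xs∈
... | yes _ | here refl = here refl
... | yes _ | there xs∈′ = there (∈-primeSets xss xs∈′ uq prs)
... | no ¬p | here refl = contradiction (uq , prs) ¬p
... | no ¬p | there xs∈′ = ∈-primeSets xss xs∈′ uq prs

primitive-finite : ∀ r → Finite _≋_ (λ P → Primitive P × card P ≡ r)
primitive-finite r = primeSets (sublists (upTo (suc (bound r r)))) , λ P (prim , card≡r) →
  -- Only the underlying set matters, so P is replaced by its increasing list, which is a sublist of
  -- an initial segment.
  let xs = filter (_∈? elements P) (upTo (suc (bound r r)))
      to : elements P ⊆ xs
      to p∈ = ∈-filter⁺ (_∈? elements P) (∈-upTo⁺ (s≤s (All.lookup (primitive≤bound r P prim card≡r) p∈))) p∈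
      from : xs ⊆ elements P
      from p∈ = proj₂ (∈-filter⁻ (_∈? elements P) {xs = upTo (suc (bound r r))} p∈)
  in Any.map (λ { refl → (λ {_} → to) , (λ {_} → from) })
       (∈-primeSets (sublists (upTo (suc (bound r r)))) (filter∈sublists (_∈? elements P) (upTo (suc (bound r r))))
         (Unique.filter⁺ (_∈? elements P) (Unique.upTo⁺ (suc (bound r r))))
         (All.tabulate (All.lookup (primes P) ∘ from)))

-- Counting the numbers divisible by given squares

bit : {A : Set} → Dec A → ℕ
bit (yes _) = 1
bit (no  _) = 0

count : {P : ℕ → Set} → (∀ M → Dec (P M)) → ℕ → ℕ
count P? zero    = 0
count P? (suc n) = bit (P? (suc n)) + count P? n

module _ {P : ℕ → Set} (P? : ∀ M → Dec (P M)) where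

  satisfying : ℕ → List ℕ
  satisfying zero = []
  satisfying (suc n) with P? (suc n)
  ... | yes _ = suc n ∷ satisfying n
  ... | no  _ = satisfying n

  length-satisfying : ∀ n → length (satisfying n) ≡ count P? n
  length-satisfying zero = refl
  length-satisfying (suc n) with P? (suc n)
  ... | yes _ = cong suc (length-satisfying n)
  ... | no  _ = length-satisfying n

  ∈-satisfying⁻ : ∀ n {M} → M ∈ satisfying n → 1 ≤ M × M ≤ n × P M
  ∈-satisfying⁻ (suc n) M∈ with P? (suc n)
  ∈-satisfying⁻ (suc n) (here refl) | yes p = s≤s z≤n , ≤-refl , p
  ∈-satisfying⁻ (suc n) (there M∈)  | yes _ = let (1≤M , M≤n , p) = ∈-satisfying⁻ n M∈ in 1≤M , m≤n⇒m≤1+n M≤n , p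
  ∈-satisfying⁻ (suc n) M∈          | no  _ = let (1≤M , M≤n , p) = ∈-satisfying⁻ n M∈ in 1≤M , m≤n⇒m≤1+n M≤n , p

  ∈-satisfying⁺ : ∀ n {M} → 1 ≤ M → M ≤ n → P M → M ∈ satisfying n
  ∈-satisfying⁺ zero    1≤M M≤n p = contradiction (≤-trans 1≤M M≤n) λ ()
  ∈-satisfying⁺ (suc n) {M} 1≤M M≤n p with P? (suc n) | M ≟ suc n
  ... | yes _ | yes refl = here refl
  ... | no ¬p | yes refl = contradiction p ¬p
  ... | yes _ | no M≢    = there (∈-satisfying⁺ n 1≤M (s≤s⁻¹ (≤∧≢⇒< M≤n M≢)) p)
  ... | no _  | no M≢    = ∈-satisfying⁺ n 1≤M (s≤s⁻¹ (≤∧≢⇒< M≤n M≢)) p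

  satisfying-unique : ∀ n → Unique (satisfying n)
  satisfying-unique zero = []
  satisfying-unique (suc n) with P? (suc n)
  ... | yes _ = All.tabulate (λ M∈ eq → <⇒≢ (s≤s (proj₁ (proj₂ (∈-satisfying⁻ n M∈)))) (sym eq)) ∷ satisfying-unique n
  ... | no  _ = satisfying-unique n

  count≤ : ∀ n → count P? n ≤ n
  count≤ zero = z≤n
  count≤ (suc n) with P? (suc n)
  ... | yes _ = s≤s (count≤ n)
  ... | no  _ = m≤n⇒m≤1+n (count≤ n)

module _ {P Q R : ℕ → Set} (P? : ∀ M → Dec (P M)) (Q? : ∀ M → Dec (Q M)) (R? : ∀ M → Dec (R M)) where

  count-⊎ : ∀ n → (∀ M → 1 ≤ M → M ≤ n → P M → Q M ⊎ R M) → count P? n ≤ count Q? n + count R? n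
  count-⊎ zero h = z≤n
  count-⊎ (suc n) h with count-⊎ n (λ M 1≤M M≤n → h M 1≤M (m≤n⇒m≤1+n M≤n)) | P? (suc n) | Q? (suc n) | R? (suc n)
  ... | ih | no _  | q     | r     = ≤-trans ih (+-mono-≤ (m≤n+m _ (bit q)) (m≤n+m _ (bit r)))
  ... | ih | yes _ | yes _ | r     = s≤s (≤-trans ih (+-monoʳ-≤ (count Q? n) (m≤n+m _ (bit r))))
  ... | ih | yes _ | no _  | yes _ = ≤-trans (s≤s ih) (≤-reflexive (sym (+-suc (count Q? n) (count R? n))))
  ... | ih | yes p | no ¬q | no ¬r = ⊥-elim ([ ¬q , ¬r ]′ (h (suc n) (s≤s z≤n) ≤-refl p))

  count-disjoint : ∀ n → (∀ M → 1 ≤ M → M ≤ n → Q M → P M) → (∀ M → 1 ≤ M → M ≤ n → R M → P M) →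
    (∀ M → Q M → R M → ⊥) → count Q? n + count R? n ≤ count P? n
  count-disjoint zero q r d = z≤n
  count-disjoint (suc n) hq hr d
    with count-disjoint n (λ M 1≤M M≤n → hq M 1≤M (m≤n⇒m≤1+n M≤n)) (λ M 1≤M M≤n → hr M 1≤M (m≤n⇒m≤1+n M≤n)) d
       | P? (suc n) | Q? (suc n) | R? (suc n)
  ... | ih | p     | no _  | no _  = ≤-trans ih (m≤n+m _ (bit p))
  ... | ih | p     | yes q | yes r = ⊥-elim (d (suc n) q r)
  ... | ih | yes _ | yes _ | no _  = s≤s ih
  ... | ih | yes _ | no _  | yes _ = ≤-trans (≤-reflexive (+-suc (count Q? n) (count R? n))) (s≤s ih)
  ... | ih | no ¬p | yes q | no _  = ⊥-elim (¬p (hq (suc n) (s≤s z≤n) ≤-refl q))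
  ... | ih | no ¬p | no _  | yes r = ⊥-elim (¬p (hr (suc n) (s≤s z≤n) ≤-refl r))

count-none : ∀ {P : ℕ → Set} (P? : ∀ M → Dec (P M)) n → (∀ M → 1 ≤ M → M ≤ n → ¬ P M) → count P? n ≡ 0
count-none P? zero none = refl
count-none P? (suc n) none with P? (suc n)
... | yes p = contradiction p (none (suc n) (s≤s z≤n) ≤-refl)
... | no  _ = count-none P? n λ M 1≤M M≤n → none M 1≤M (m≤n⇒m≤1+n M≤n)

count-mono : ∀ {P Q : ℕ → Set} (P? : ∀ M → Dec (P M)) (Q? : ∀ M → Dec (Q M)) n →
  (∀ M → 1 ≤ M → M ≤ n → P M → Q M) → count P? n ≤ count Q? n
count-mono P? Q? n h = ≤-trans (count-⊎ P? Q? (λ _ → no id) n (λ M 1≤M M≤n p → inj₁ (h M 1≤M M≤n p)))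
  (≤-reflexive (trans (cong (count Q? n +_) (count-none (λ _ → no id) n (λ _ _ _ ()))) (+-identityʳ _)))

count-multiples : ∀ k .{{_ : NonZero k}} n → ∃ λ r → r < k × n ≡ r + count (k ∣?_) n * k
count-multiples k zero = 0 , >-nonZero⁻¹ k , refl
count-multiples k (suc n) with count-multiples k n | k ∣? suc n
... | r , r<k , n≡ | yes k∣ = 0 , >-nonZero⁻¹ k ,
      trans (cong suc n≡) (cong (_+ count (k ∣?_) n * k) (≤-antisym r<k (∣⇒≤ k∣1+r)))
  where
  k∣1+r : k ∣ suc r
  k∣1+r = ∣m+n∣m⇒∣n (subst (k ∣_) (trans (cong suc n≡) (+-comm (suc r) _)) k∣) (n∣m*n (count (k ∣?_) n))
... | r , r<k , n≡ | no k∤ = suc r , ≤∧≢⇒< r<k (λ { refl → k∤ (subst (suc r ∣_) (sym (cong suc n≡))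
        (∣m∣n⇒∣m+n ∣-refl (n∣m*n (count (suc r ∣?_) n)))) }) , cong suc n≡

count-multiples≤ : ∀ k n → count (k ∣?_) n * k ≤ n
count-multiples≤ zero n = ≤-trans (≤-reflexive (*-zeroʳ (count (0 ∣?_) n))) z≤n
count-multiples≤ k@(suc _) n = let (r , _ , n≡) = count-multiples k n in
  ≤-trans (m≤n+m _ r) (≤-reflexive (sym n≡))

count-multiples-exact : ∀ k .{{_ : NonZero k}} n → k ∣ n → count (k ∣?_) n * k ≡ n
count-multiples-exact k n k∣n with count-multiples k n
... | zero  , _   , n≡ = sym n≡
... | suc r , r<k , n≡ = contradiction (∣⇒≤ (∣m+n∣m⇒∣n (subst (k ∣_) (trans n≡ (+-comm (suc r) _)) k∣n)
      (n∣m*n (count (k ∣?_) n)))) (<⇒≱ r<k)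

SquareDivisor : ℕ → ℕ → Set
SquareDivisor M p = Prime p × p ^ 2 ∣ M

Squares : List ℕ → ℕ → Set
Squares A M = All (SquareDivisor M) A

squares? : ∀ A M → Dec (Squares A M)
squares? A M = All.all? (squareDivisor? M) A

squares : List ℕ → ℕ
squares A = product A * product A

prime-square∣* : ∀ {p} → Prime p → ∀ k q → p ∤ k → p * p ∣ k * q → p * p ∣ q
prime-square∣* {p} pr k q p∤k pp∣kq with euclidsLemma k q pr (∣-trans (m∣m*n p) pp∣kq)
... | inj₁ p∣k = contradiction p∣k p∤k
... | inj₂ (divides q′ refl) with euclidsLemma k q′ pr
        (*-cancelʳ-∣ p {{prime⇒nonZero pr}} (subst (p * p ∣_) (sym (*-assoc k q′ p)) pp∣kq))
...   | inj₁ p∣k  = contradiction p∣k p∤k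
...   | inj₂ p∣q′ = *-monoˡ-∣ p p∣q′

squares-∣ : ∀ {A M} → Unique A → Squares A M → squares A ∣ M
squares-∣ [] [] = 1∣ _
squares-∣ {p ∷ A} {M} (p≢ ∷ uq) ((pr , pp∣M) ∷ sq) with squares-∣ uq sq
... | divides q refl = subst (_∣ q * squares A) (shuffle p (product A))
      (*-monoˡ-∣ (squares A) (prime-square∣* pr (squares A) q p∤
        (subst₂ _∣_ (cong (p *_) (*-identityʳ p)) (*-comm q (squares A)) pp∣M)))
  where
  shuffle : ∀ p a → p * p * (a * a) ≡ p * a * (p * a)
  shuffle = solve-∀
  p∉ : ¬ p ∈ A
  p∉ p∈ = All.lookup p≢ p∈ refl
  primesA : All Prime A
  primesA = All.map proj₁ sq
  p∤ : p ∤ squares A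
  p∤ p∣ = p∉ ([ id , id ]′ (Sum.map (prime∣product⇒∈ pr primesA) (prime∣product⇒∈ pr primesA)
    (euclidsLemma (product A) (product A) pr p∣)))

squares-∣⁻ : ∀ {A M} → All Prime A → squares A ∣ M → Squares A M
squares-∣⁻ {A} {M} prs sq∣ = All.tabulate λ {p} p∈ → All.lookup prs p∈ ,
  ∣-trans (subst (_∣ squares A) (cong (p *_) (sym (*-identityʳ p))) (*-pres-∣ (∈⇒∣product p∈) (∈⇒∣product p∈))) sq∣

count-squares≤ : ∀ {A} → Unique A → ∀ n → count (squares? A) n * squares A ≤ n
count-squares≤ {A} uq n = ≤-trans
  (*-monoˡ-≤ (squares A) (count-mono (squares? A) (squares A ∣?_) n (λ M _ _ → squares-∣ uq)))
  (count-multiples≤ (squares A) n)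

squares≢0 : ∀ {A} → All Prime A → NonZero (squares A)
squares≢0 {A} prs = m*n≢0 (product A) (product A) {{productOfPrimes≢0 prs}} {{productOfPrimes≢0 prs}}

count-squares : ∀ {A} → Unique A → All Prime A → ∀ n → squares A ∣ n → count (squares? A) n * squares A ≡ n
count-squares {A} uq prs n ∣n = trans
  (cong (_* squares A) (≤-antisym
    (count-mono (squares? A) (squares A ∣?_) n (λ M _ _ → squares-∣ uq))
    (count-mono (squares A ∣?_) (squares? A) n (λ M _ _ → squares-∣⁻ prs))))
  (count-multiples-exact (squares A) {{squares≢0 prs}} n ∣n)

Except : List ℕ → ℕ → ℕ → Set
Except A x M = Squares A M × ¬ SquareDivisor M x

except? : ∀ A x M → Dec (Except A x M)
except? A x M = squares? A M ×-dec ¬? (squareDivisor? M x)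

-- This is the density (1 - 1 / x^2) / `squares A`, brought over the denominator `squares (x ∷ A)`.
count-except : ∀ {A x} → Unique (x ∷ A) → All Prime (x ∷ A) → ∀ n → squares (x ∷ A) ∣ n →
  count (except? A x) n * squares (x ∷ A) ≡ n * (x * x ∸ 1)
count-except {A} {x} uq@(_ ∷ uqA) prs@(_ ∷ prsA) n ∣n = begin
  e * s′                   ≡⟨ cong (_* s′) (sym (m+n∸n≡m e c′)) ⟩
  (e + c′ ∸ c′) * s′       ≡⟨ cong (λ z → (z ∸ c′) * s′) total ⟩
  (c ∸ c′) * s′            ≡⟨ *-distribʳ-∸ s′ c c′ ⟩
  c * s′ ∸ c′ * s′         ≡⟨ cong₂ _∸_ (trans (shuffle c x (product A)) (cong (_* (x * x))
                                (count-squares uqA prsA n (∣-trans (divides (x * x) (shuffle′ x (product A))) ∣n)))) (count-squares uq prs n ∣n) ⟩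
  n * (x * x) ∸ n          ≡⟨ cong (n * (x * x) ∸_) (sym (*-identityʳ n)) ⟩
  n * (x * x) ∸ n * 1      ≡⟨ sym (*-distribˡ-∸ n (x * x) 1) ⟩
  n * (x * x ∸ 1)          ∎
  where
  open ≡-Reasoning
  e  = count (except? A x) n
  c  = count (squares? A) n
  c′ = count (squares? (x ∷ A)) n
  s′ = squares (x ∷ A)
  shuffle : ∀ c x a → c * (x * a * (x * a)) ≡ c * (a * a) * (x * x)
  shuffle = solve-∀
  shuffle′ : ∀ x a → x * a * (x * a) ≡ x * x * (a * a)
  shuffle′ = solve-∀
  total : e + c′ ≡ c
  total = ≤-antisym
    (count-disjoint (squares? A) (except? A x) (squares? (x ∷ A)) n
      (λ M _ _ → proj₁) (λ M _ _ → All.tail) (λ { M (_ , ¬x) (x ∷ _) → ¬x x }))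
    (count-⊎ (squares? A) (except? A x) (squares? (x ∷ A)) n λ M _ _ sq → case squareDivisor? M x of λ where
      (yes x²) → inj₂ (x² ∷ sq)
      (no ¬x²) → inj₁ (sq , ¬x²))

-- Numbers divisible by the squares of many primes

range : ℕ → ℕ → List ℕ
range a zero    = []
range a (suc k) = a ∷ range (a + 1) k

∈-range : ∀ {p} a k → a ≤ p → p < a + k → p ∈ range a k
∈-range a zero a≤p p<a = contradiction (≤-trans p<a (≤-trans (≤-reflexive (+-identityʳ a)) a≤p)) (<-irrefl refl)
∈-range {p} a (suc k) a≤p p<a+k with p ≟ a
... | yes refl = here refl
... | no  p≢a  = there (∈-range (a + 1) k (subst (_≤ p) (+-comm 1 a) (≤∧≢⇒< a≤p (p≢a ∘ sym)))
      (≤-trans p<a+k (≤-reflexive (sym (+-assoc a 1 k)))))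

module Tails {F : ℕ → Set} (F? : ∀ M → Dec (F M)) where

  tally : ℕ → List ℕ → ℕ
  tally M ps = length (filter (squareDivisor? M) ps)

  Event : List ℕ → ℕ → List ℕ → ℕ → Set
  Event A k ps M = Squares A M × k ≤ tally M ps × F M

  event? : ∀ A k ps M → Dec (Event A k ps M)
  event? A k ps M = squares? A M ×-dec k ≤? tally M ps ×-dec F? M

  event-split : ∀ {A k p ps M} → Event A (suc k) (p ∷ ps) M → Event A (suc k) ps M ⊎ Event (p ∷ A) k ps M
  event-split {k = k} {p} {M = M} (sq , k≤ , f) = case squareDivisor? M p of λ where
    (yes p²) → inj₂ (p² ∷ sq , s≤s⁻¹ (subst (suc k ≤_) (cong length (filter-accept (squareDivisor? M) p²)) k≤) , f)
    (no ¬p²) → inj₁ (sq , subst (suc k ≤_) (cong length (filter-reject (squareDivisor? M) ¬p²)) k≤ , f)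

  event-none : ∀ A k n → count (event? A (suc k) []) n ≡ 0
  event-none A k n = count-none (event? A (suc k) []) n λ { M _ _ (_ , () , _) }

  -- The bound rests on (y + 2) y ≤ (y + 1) ^ 2, that is, on summing 1 / p ^ 2 over
  -- p > y as a telescoping sum.
  tail-bound : ∀ n k m y A → Unique A → All (_< suc y) A →
    count (event? A k (range (suc y) m)) n * squares A * y ^ k ≤ n
  tail-bound n zero m y A uq A< = begin
    count (event? A 0 (range (suc y) m)) n * squares A * 1 ≡⟨ *-identityʳ _ ⟩
    count (event? A 0 (range (suc y) m)) n * squares A
      ≤⟨ *-monoˡ-≤ (squares A) (count-mono (event? A 0 (range (suc y) m)) (squares? A) n (λ M _ _ → proj₁)) ⟩
    count (squares? A) n * squares A                       ≤⟨ count-squares≤ uq n ⟩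
    n                                                      ∎
    where open ≤-Reasoning
  tail-bound n (suc k) zero y A uq A< rewrite event-none A k n = z≤n
  tail-bound n (suc k) (suc m) y A uq A< = *-cancelʳ-≤ _ _ (t * t) (begin
    c * s * (y * R) * (t * t)
      ≤⟨ *-monoˡ-≤ (t * t) (*-monoˡ-≤ (y * R) (*-monoˡ-≤ s (count-⊎ (event? A (suc k) (p ∷ ps)) (event? A (suc k) ps) (event? (p ∷ A) k ps) n
           (λ M _ _ → event-split)))) ⟩
    (c₁ + c₂) * s * (y * R) * (t * t)
      ≡⟨ expand c₁ c₂ s y R t ⟩
    (c₁ * s * (t * R)) * (y * t) + (c₂ * (t * t * s) * R) * y
      ≤⟨ +-mono-≤ (*-monoˡ-≤ (y * t) (*-monoʳ-≤ (c₁ * s) (*-monoʳ-≤ t R≤Q))) (*-monoˡ-≤ y (*-monoʳ-≤ (c₂ * (t * t * s)) R≤Q)) ⟩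
    (c₁ * s * (t * Q)) * (y * t) + (c₂ * (t * t * s) * Q) * y
      ≤⟨ +-mono-≤ (*-monoˡ-≤ (y * t) ih₁) (*-monoˡ-≤ y ih₂) ⟩
    n * (y * t) + n * y
      ≤⟨ m≤m+n _ n ⟩
    n * (y * t) + n * y + n
      ≡⟨ collect n y ⟩
    n * (t * t) ∎)
    where
    open ≤-Reasoning
    p = suc y
    t = y + 1
    ps = range (suc y + 1) m
    s = squares A
    R = y ^ k
    Q = t ^ k
    c = count (event? A (suc k) (p ∷ ps)) n
    c₁ = count (event? A (suc k) ps) n
    c₂ = count (event? (p ∷ A) k ps) n
    R≤Q : R ≤ Q
    R≤Q = ^-monoˡ-≤ k (m≤m+n y 1)
    A<′ : All (_< suc (y + 1)) A
    A<′ = All.map (λ a< → ≤-trans a< (s≤s (m≤m+n y 1))) A<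
    ih₁ : c₁ * s * (t * Q) ≤ n
    ih₁ = tail-bound n (suc k) m (y + 1) A uq A<′
    square-p : squares (p ∷ A) ≡ t * t * s
    square-p = trans (shuffle p (product A)) (cong (λ z → z * z * s) (+-comm 1 y))
      where
      shuffle : ∀ p a → p * a * (p * a) ≡ p * p * (a * a)
      shuffle = solve-∀
    ih₂ : c₂ * (t * t * s) * Q ≤ n
    ih₂ = subst (λ z → c₂ * z * Q ≤ n) square-p (tail-bound n k m (y + 1) (p ∷ A)
      (All.map (λ a< eq → <-irrefl (sym eq) a<) A< ∷ uq) (s≤s (≤-reflexive (+-comm 1 y)) ∷ A<′))
    instance
      tt≢0 : NonZero (t * t)
      tt≢0 = >-nonZero (*-mono-≤ (m≤n+m 1 y) (m≤n+m 1 y))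
    expand : ∀ c d s y R t → (c + d) * s * (y * R) * (t * t) ≡ (c * s * (t * R)) * (y * t) + (d * (t * t * s) * R) * y
    expand = solve-∀
    collect : ∀ n y → n * (y * (y + 1)) + n * y + n ≡ n * ((y + 1) * (y + 1))
    collect = solve-∀

-- an upper bound of a / b, off by at most one; junk for b = 0
up : ℕ → ℕ → ℕ
up a zero    = a
up a (suc b) = div-helper 0 b a b + 1

up-bound : ∀ a b .{{_ : NonZero b}} → a ≤ b * up a b
up-bound a (suc b) = begin
  a                                   ≡⟨ m≡m%n+[m/n]*n a (suc b) ⟩
  a % suc b + a / suc b * suc b       ≤⟨ +-monoˡ-≤ _ (<⇒≤ (m%n<n a (suc b))) ⟩
  suc b + a / suc b * suc b           ≡⟨ shuffle (suc b) (a / suc b) ⟩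
  suc b * (a / suc b + 1)             ∎
  where
  open ≤-Reasoning
  shuffle : ∀ b q → b + q * b ≡ b * (q + 1)
  shuffle = solve-∀

scale-down : ∀ {c z n w} s .{{_ : NonZero s}} → c * s * z ≤ n * w → c * z ≤ n * up w s
scale-down {c} {z} {n} {w} s le = *-cancelʳ-≤ (c * z) (n * up w s) s (begin
  c * z * s          ≡⟨ shuffle c z s ⟩
  c * s * z          ≤⟨ le ⟩
  n * w              ≤⟨ *-monoʳ-≤ n (up-bound w s) ⟩
  n * (s * up w s)   ≡⟨ shuffle′ n s (up w s) ⟩
  n * up w s * s     ∎)
  where
  open ≤-Reasoning
  shuffle : ∀ c z s → c * z * s ≡ c * s * z
  shuffle = solve-∀
  shuffle′ : ∀ n s u → n * (s * u) ≡ n * u * s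
  shuffle′ = solve-∀

-- Only rejection needs proof, since a composite number let through merely enlarges a sum. Trial
-- division up to 43 lets none through from 2 to 2208.
passes : List ℕ → ℕ → Bool
passes []       p = true
passes (m ∷ ms) p = if isZero (p mod-suc m) then (if p ≡ᵇ suc m then passes ms p else false) else passes ms p

prime-passes : ∀ {p} ms → All (1 ≤_) ms → Prime p → passes ms p ≡ true
prime-passes [] [] pr = refl
prime-passes {p} (m ∷ ms) (1≤m ∷ 1≤ms) pr with p mod-suc m in r
... | suc _ = prime-passes ms 1≤ms pr
... | zero with p ≡ᵇ suc m in eq
...   | true  = prime-passes ms 1≤ms pr
...   | false with prime⇒irreducible pr (mod-suc≡0⇒∣ p m r)
...     | inj₁ refl = contradiction 1≤m λ ()
...     | inj₂ refl = case trans (sym eq) (T⇒≡true (≡⇒≡ᵇ p p refl)) of λ ()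
  where
  T⇒≡true : ∀ {b} → T b → b ≡ true
  T⇒≡true {true} _ = refl

-- the numbers to divide by, minus one
divisors : List ℕ
divisors = 1 ∷ 2 ∷ 4 ∷ 6 ∷ 10 ∷ 12 ∷ 16 ∷ 18 ∷ 22 ∷ 28 ∷ 30 ∷ 36 ∷ 40 ∷ 42 ∷ []

not-passes⇒¬prime : ∀ {p} → passes divisors p ≡ false → ¬ Prime p
not-passes⇒¬prime eq pr = case trans (sym eq) (prime-passes divisors (from-yes (All.all? (1 ≤?_) divisors)) pr) of λ ()

addNext : ℕ → ℕ → List ℕ → List ℕ
addNext p c []        = []
addNext p c (c′ ∷ cs) = (c′ + up c (p * p)) ∷ addNext p c′ cs

-- Entry k bounds the k-th elementary symmetric function of the values 1 / p^2; a new prime adds 1 /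
-- p^2 times the previous entry. Every product is rounded up.
addPrime : ℕ → List ℕ → List ℕ
addPrime p []       = []
addPrime p (c ∷ cs) = c ∷ addNext p c cs

Free : ℕ → Set
Free M = All (λ e → ¬ Squares e M) exceptional

free? : ∀ M → Dec (Free M)
free? M = All.all? (λ e → ¬? (squares? e M)) exceptional

not-free : ∀ {A M} → multipleOf products (product A) ≡ true → Squares A M → ¬ Free M
not-free {A} {M} eq sq free with find (multipleOf-true products (product A) eq)
... | _ , e∈ , e∣ with ∈-map⁻ product e∈
...   | e , e∈′ , refl = All.lookup free e∈′ (All.tabulate λ q∈ → All.lookup sq
        (prime∣product⇒∈ (All.lookup (All.lookup exceptional-primes e∈′) q∈) (All.map proj₁ sq) (∣-trans (∈⇒∣product q∈) e∣)))

-- The numerals and the tests stay variables so that the proofs do not unfold them.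
module SevenPrimes {F : ℕ → Set} (F? : ∀ M → Dec (F M)) (scale y : ℕ) .{{_ : NonZero scale}} .{{_ : NonZero y}}
  (sieve : ℕ → Bool) (sieve-false : ∀ {p} → sieve p ≡ false → ¬ Prime p)
  (barred : ℕ → Bool) (barred-true : ∀ {A M} → barred (product A) ≡ true → Squares A M → ¬ F M) where

  open Tails F?

  row : List ℕ → ℕ → ℕ → List ℕ
  row base zero    a = base
  row base (suc j) a = if sieve a then addPrime a (row base j (a + 1)) else row base j (a + 1)

  entry : List ℕ → ℕ → ℕ
  entry []       k       = scale
  entry (c ∷ cs) zero    = c
  entry (c ∷ cs) (suc k) = entry cs k

  -- The same recursion, but with the product π of the chosen primes at hand, so that barred choices
  -- contribute nothing. It branches, and is therefore used only for the first j numbers, above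
  -- which the row `cs` serves.
  caseBound : List ℕ → ℕ → ℕ → ℕ → ℕ → ℕ
  caseBound cs zero    a π k       = entry cs k
  caseBound cs (suc j) a π zero    = scale
  caseBound cs (suc j) a π (suc k) =
    if sieve a
    then caseBound cs j (a + 1) π (suc k) + (if barred (π * a) then 0 else up (caseBound cs j (a + 1) (π * a) k) (a * a))
    else caseBound cs j (a + 1) π (suc k)

  tailRow : List ℕ
  tailRow = applyUpTo (λ k → up scale (y ^ k)) 8

  module Validity (n : ℕ) where

    -- The density is compared with 1 / `squares A`, so that a row entry c is valid for every A at
    -- once.
    Bounds : List ℕ → ℕ → ℕ → ℕ → ℕ → Set
    Bounds A k a m c = count (event? A k (range a m)) n * squares A * scale ≤ n * c

    AllBounds : ℕ → ℕ → ℕ → ℕ → Set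
    AllBounds k a m c = ∀ A → Unique A → All (_< a) A → Bounds A k a m c

    <-weaken : ∀ {a A} → All (_< a) A → All (_< a + 1) A
    <-weaken {a} = All.map λ q<a → ≤-trans q<a (m≤m+n a 1)

    cons-< : ∀ {a A} → All (_< a) A → All (_< a + 1) (a ∷ A)
    cons-< {a} A< = ≤-reflexive (+-comm 1 a) ∷ <-weaken A<

    cons-unique : ∀ {a A} → Unique A → All (_< a) A → Unique (a ∷ A)
    cons-unique uq A< = All.map (λ q<a eq → <-irrefl (sym eq) q<a) A< ∷ uq

    bounds-trivial : ∀ A k a m → Unique A → Bounds A k a m scale
    bounds-trivial A k a m uq = *-monoˡ-≤ scale (≤-trans
      (*-monoˡ-≤ (squares A) (count-mono (event? A k (range a m)) (squares? A) n (λ M _ _ → proj₁)))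
      (count-squares≤ uq n))

    bounds-tail : ∀ k m → AllBounds k (suc y) m (up scale (y ^ k))
    bounds-tail k m A uq A< = begin
      c * s * scale                       ≤⟨ *-monoʳ-≤ (c * s) (up-bound scale (y ^ k)) ⟩
      c * s * (y ^ k * u)              ≡⟨ sym (*-assoc (c * s) (y ^ k) u) ⟩
      c * s * y ^ k * u                ≤⟨ *-monoˡ-≤ u (tail-bound n k m y A uq A<) ⟩
      n * u                               ∎
      where
      open ≤-Reasoning
      c = count (event? A k (range (suc y) m)) n
      s = squares A
      u = up scale (y ^ k)
      instance
        y^k≢0 : NonZero (y ^ k)
        y^k≢0 = m^n≢0 y k

    bounds-skip : ∀ {A k a m c} → ¬ Prime a → Bounds A k (a + 1) m c → Bounds A k a (suc m) c
    bounds-skip {A} {k} {a} {m} ¬pr bd = ≤-trans (*-monoˡ-≤ scale (*-monoˡ-≤ (squares A)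
      (count-mono (event? A k (a ∷ range (a + 1) m)) (event? A k (range (a + 1) m)) n
        (λ M _ _ (sq , k≤ , f) → sq , subst (k ≤_) (cong length (filter-reject (squareDivisor? M) (¬pr ∘ proj₁))) k≤ , f)))) bd

    bounds-split : ∀ {A k a m c u} → Bounds A (suc k) (a + 1) m c →
      count (event? (a ∷ A) k (range (a + 1) m)) n * squares A * scale ≤ n * u → Bounds A (suc k) a (suc m) (c + u)
    bounds-split {A} {k} {a} {m} {c} {u} bd bd′ = begin
      count (event? A (suc k) (a ∷ ps)) n * s * scale
        ≤⟨ *-monoˡ-≤ scale (*-monoˡ-≤ s (count-⊎ (event? A (suc k) (a ∷ ps)) (event? A (suc k) ps) (event? (a ∷ A) k ps) n
             (λ M _ _ → event-split))) ⟩
      (c₁ + c₂) * s * scale                ≡⟨ trans (cong (_* scale) (*-distribʳ-+ s c₁ c₂)) (*-distribʳ-+ scale (c₁ * s) (c₂ * s)) ⟩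
      c₁ * s * scale + c₂ * s * scale      ≤⟨ +-mono-≤ bd bd′ ⟩
      n * c + n * u                        ≡⟨ sym (*-distribˡ-+ n c u) ⟩
      n * (c + u)                          ∎
      where
      open ≤-Reasoning
      ps = range (a + 1) m
      s = squares A
      c₁ = count (event? A (suc k) ps) n
      c₂ = count (event? (a ∷ A) k ps) n

    bounds-up : ∀ {A k a m c} → 1 ≤ a → Bounds (a ∷ A) k (a + 1) m c →
      count (event? (a ∷ A) k (range (a + 1) m)) n * squares A * scale ≤ n * up c (a * a)
    bounds-up {A} {k} {a} {m} {c} 1≤a bd =
      ≤-trans (≤-reflexive (*-assoc c₂ (squares A) scale))
        (scale-down {c₂} {squares A * scale} {n} {c} (a * a) (≤-trans (≤-reflexive (shuffle c₂ a (product A) scale)) bd))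
      where
      c₂ = count (event? (a ∷ A) k (range (a + 1) m)) n
      instance
        aa≢0 : NonZero (a * a)
        aa≢0 = >-nonZero (*-mono-≤ 1≤a 1≤a)
      shuffle : ∀ c a b z → c * (a * a) * (b * b * z) ≡ c * (a * b * (a * b)) * z
      shuffle = solve-∀

    data RowValid (a m : ℕ) : ℕ → List ℕ → Set where
      []  : ∀ {k} → RowValid a m k []
      _∷_ : ∀ {k c cs} → AllBounds k a m c → RowValid a m (suc k) cs → RowValid a m k (c ∷ cs)

    addNext-valid : ∀ {a m k c cs} → 1 ≤ a → AllBounds k (a + 1) m c → RowValid (a + 1) m (suc k) cs →
      RowValid a (suc m) (suc k) (addNext a c cs)
    addNext-valid 1≤a bd [] = []
    addNext-valid {a} {m} {k} {c} {c′ ∷ cs} 1≤a bd (bd′ ∷ bds) =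
      (λ A uq A< → bounds-split {A} {k} {a} {m} {c′} (bd′ A uq (<-weaken A<))
        (bounds-up {A} {k} {a} {m} {c} 1≤a (bd (a ∷ A) (cons-unique uq A<) (cons-< A<))))
      ∷ addNext-valid 1≤a bd′ bds

    addPrime-valid : ∀ {a m cs} → 1 ≤ a → RowValid (a + 1) m 0 cs → RowValid a (suc m) 0 (addPrime a cs)
    addPrime-valid 1≤a [] = []
    addPrime-valid {a} {m} {c ∷ cs} 1≤a (bd ∷ bds) =
      (λ A uq A< → ≤-trans (*-monoˡ-≤ scale (*-monoˡ-≤ (squares A)
          (count-mono (event? A 0 (range a (suc m))) (event? A 0 (range (a + 1) m)) n (λ M _ _ (sq , _ , f) → sq , z≤n , f))))
        (bd A uq (<-weaken A<)))
      ∷ addNext-valid 1≤a bd bds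

    skip-valid : ∀ {a m k cs} → ¬ Prime a → RowValid (a + 1) m k cs → RowValid a (suc m) k cs
    skip-valid ¬pr [] = []
    skip-valid {a} {m} {k} {c ∷ cs} ¬pr (bd ∷ bds) =
      (λ A uq A< → bounds-skip {A} {k} {a} {m} {c} ¬pr (bd A uq (<-weaken A<))) ∷ skip-valid ¬pr bds

    row-valid : ∀ {b m base} j a → 1 ≤ a → a + j ≡ b → RowValid b m 0 base → RowValid a (j + m) 0 (row base j a)
    row-valid zero a 1≤a eq bds = subst (λ b → RowValid b _ 0 _) (trans (sym eq) (+-identityʳ a)) bds
    row-valid (suc j) a 1≤a eq bds with sieve a in ps
    ... | true  = addPrime-valid 1≤a (row-valid j (a + 1) (m≤n+m 1 a) (trans (+-assoc a 1 j) eq) bds)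
    ... | false = skip-valid (sieve-false ps) (row-valid j (a + 1) (m≤n+m 1 a) (trans (+-assoc a 1 j) eq) bds)

    entry-valid : ∀ {a m k cs} i → RowValid a m k cs → AllBounds (k + i) a m (entry cs i)
    entry-valid {a} {m} {k} i [] A uq A< = bounds-trivial A (k + i) a m uq
    entry-valid {a} {m} {k} {c ∷ cs} zero (bd ∷ bds) = subst (λ k → AllBounds k a m c) (sym (+-identityʳ k)) bd
    entry-valid {a} {m} {k} {c ∷ cs} (suc i) (bd ∷ bds) =
      subst (λ k → AllBounds k a m (entry cs i)) (sym (+-suc k i)) (entry-valid i bds)

    caseBound-valid : ∀ {b m cs} j a k → 1 ≤ a → a + j ≡ b → RowValid b m 0 cs →
      ∀ A → Unique A → All (_< a) A → Bounds A k a (j + m) (caseBound cs j a (product A) k)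
    caseBound-valid {b} {m} {cs} zero a k 1≤a eq bds A uq A< =
      subst (λ b → AllBounds k b m (entry cs k)) (trans (sym eq) (+-identityʳ a)) (entry-valid k bds) A uq A<
    caseBound-valid {m = m} (suc j) a zero 1≤a eq bds A uq A< = bounds-trivial A 0 a (suc j + m) uq
    caseBound-valid {m = m} {cs} (suc j) a (suc k) 1≤a eq bds A uq A<
      with sieve a in ps
         | caseBound-valid {cs = cs} j (a + 1) (suc k) (m≤n+m 1 a) (trans (+-assoc a 1 j) eq) bds A uq (<-weaken A<)
    ... | false | ih = bounds-skip {A} {suc k} {a} {j + m} (sieve-false ps) ih
    ... | true  | ih with barred (product A * a) in mult
    ...   | true = bounds-split {A} {k} {a} {j + m} {u = 0} ih (≤-trans (≤-reflexive (cong (λ c → c * squares A * scale)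
              (count-none (event? (a ∷ A) k (range (a + 1) (j + m))) n
                λ M _ _ (sq , _ , free) → barred-true {a ∷ A} (subst (λ π → barred π ≡ true) (*-comm (product A) a) mult) sq free))) z≤n)
    ...   | false = bounds-split {A} {k} {a} {j + m} ih (bounds-up {A} {k} {a} {j + m} 1≤a
              (subst (λ π → Bounds (a ∷ A) k (a + 1) (j + m) (caseBound cs j (a + 1) π k)) (*-comm a (product A))
                (caseBound-valid {cs = cs} j (a + 1) k (m≤n+m 1 a) (trans (+-assoc a 1 j) eq) bds (a ∷ A) (cons-unique uq A<) (cons-< A<))))

    tailRow-valid : ∀ m → RowValid (suc y) m 0 tailRow
    tailRow-valid m = applied 8 0
      where
      applied : ∀ i k → RowValid (suc y) m k (applyUpTo (λ j → up scale (y ^ (k + j))) i)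
      applied zero k = []
      applied (suc i) k = subst (λ j → AllBounds k (suc y) m (up scale (y ^ j))) (sym (+-identityʳ k)) (bounds-tail k m) ∷
        subst (RowValid (suc y) m (suc k)) (applyUpTo-cong i λ j → cong (λ e → up scale (y ^ e)) (sym (+-suc k j))) (applied i (suc k))
        where
        applyUpTo-cong : ∀ i {g h : ℕ → ℕ} → (∀ j → g j ≡ h j) → applyUpTo g i ≡ applyUpTo h i
        applyUpTo-cong zero eq = refl
        applyUpTo-cong (suc i) eq = cong₂ _∷_ (eq 0) (applyUpTo-cong i (eq ∘ suc))

-- Density bounds for the numbers of infinite type

Infinite : ℕ → Set
Infinite M = ¬ FiniteType (squarePrimes M)

infinite? : ∀ M → Dec (Infinite M)
infinite? M = ¬? (finiteType? (squarePrimes M))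

finite? : ∀ M → Dec (FiniteType (squarePrimes M))
finite? M = finiteType? (squarePrimes M)

count-complement : ∀ n → count finite? n + count infinite? n ≡ n
count-complement zero = refl
count-complement (suc n) with finiteType? (squarePrimes (suc n))
... | yes _ = cong suc (count-complement n)
... | no  _ = trans (+-suc (count finite? n) (count infinite? n)) (cong suc (count-complement n))

Piece : Set
Piece = List ℕ × Maybe ℕ

InPiece : Piece → ℕ → Set
InPiece (A , nothing) = Squares A
InPiece (A , just x)  = Except A x

inPiece? : ∀ π M → Dec (InPiece π M)
inPiece? (A , nothing) = squares? A
inPiece? (A , just x)  = except? A x

inSome? : ∀ πs M → Dec (Any (λ π → InPiece π M) πs)
inSome? πs M = Any.any? (λ π → inPiece? π M) πs

-- Numbers with two exceptional sets are counted once: a piece (A , just x) leaves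
-- out the multiples of x ^ 2 when an earlier exceptional set lies in A ∪ {x}.
pieces : List Piece
pieces = zipWith _,_ exceptional
  (nothing ∷ nothing ∷ just 17 ∷ just 13 ∷ just 11 ∷ just 7 ∷ just 5 ∷ just 7 ∷ replicate 20 nothing ++ just 3 ∷ [])

exhausts : List (List ℕ) → List Piece → Bool
exhausts earlier [] = true
exhausts earlier ((A , nothing) ∷ πs) = exhausts (A ∷ earlier) πs
exhausts earlier ((A , just x)  ∷ πs) = multipleOf (map product earlier) (x * product A) ∧ exhausts (A ∷ earlier) πs

exhausts-sound : ∀ {M} all earlier πs → exhausts earlier πs ≡ true → πs ⊆ all →
  All (All Prime) earlier → All (All Prime) (map proj₁ πs) →
  (∀ {e} → e ∈ earlier → Squares e M → Any (λ π → InPiece π M) all) →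
  ∀ {e} → e ∈ map proj₁ πs → Squares e M → Any (λ π → InPiece π M) all
exhausts-sound {M} all earlier ((A , nothing) ∷ πs) eq πs⊆ prs (prA ∷ prs′) done e∈ sq = case e∈ of λ where
    (here refl) → found sq
    (there e∈′) → exhausts-sound all (A ∷ earlier) πs eq (πs⊆ ∘ there) (prA ∷ prs) prs′
      (λ { (here refl) → found ; (there e∈) → done e∈ }) e∈′ sq
  where
  found : Squares A M → Any (λ π → InPiece π M) all
  found sq = lose (πs⊆ (here refl)) sq
exhausts-sound {M} all earlier ((A , just x) ∷ πs) eq πs⊆ prs (prA ∷ prs′) done e∈ sq = case e∈ of λ where
    (here refl) → found sq
    (there e∈′) → exhausts-sound all (A ∷ earlier) πs
      (proj₂ (∧-true (multipleOf (map product earlier) (x * product A)) eq)) (πs⊆ ∘ there) (prA ∷ prs) prs′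
      (λ { (here refl) → found ; (there e∈) → done e∈ }) e∈′ sq
  where
  found : Squares A M → Any (λ π → InPiece π M) all
  found sq with squareDivisor? M x
  ... | no ¬x² = lose (πs⊆ (here refl)) (sq , ¬x²)
  ... | yes x² with find (multipleOf-true (map product earlier) (x * product A)
                     (proj₁ (∧-true (multipleOf (map product earlier) (x * product A)) eq)))
  ...   | _ , e∈ , e∣ with ∈-map⁻ product e∈
  ...     | e , e∈′ , refl = done e∈′ (All.tabulate λ q∈ → All.lookup (x² ∷ sq)
              (prime∣product⇒∈ (All.lookup (All.lookup prs e∈′) q∈) (All.map proj₁ (x² ∷ sq)) (∣-trans (∈⇒∣product q∈) e∣)))

in-pieces : ∀ {M e} → e ∈ exceptional → Squares e M → Any (λ π → InPiece π M) pieces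
in-pieces = exhausts-sound pieces [] pieces refl id [] exceptional-primes (λ ())

weight : ℕ → Piece → ℕ
weight z (A , nothing) = up z (squares A)
weight z (A , just x)  = up ((x * x ∸ 1) * z) (squares (x ∷ A))

-- a common multiple making the pieces with an excluded prime exactly countable
modulus : ℕ
modulus = squares (2 ∷ 3 ∷ 5 ∷ 7 ∷ 11 ∷ 13 ∷ 17 ∷ 19 ∷ 23 ∷ 29 ∷ 31 ∷ 43 ∷ [])

Countable : Piece → Set
Countable (A , nothing) = Unique A × All Prime A
Countable (A , just x)  = Unique (x ∷ A) × All Prime (x ∷ A) × squares (x ∷ A) ∣ modulus

countable? : ∀ π → Dec (Countable π)
countable? (A , nothing) = unique? A ×-dec All.all? prime? A
countable? (A , just x)  = unique? (x ∷ A) ×-dec All.all? prime? (x ∷ A) ×-dec squares (x ∷ A) ∣? modulus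

pieces-countable : All Countable pieces
pieces-countable = from-yes (All.all? countable? pieces)

piece-bound : ∀ z n π → Countable π → modulus ∣ n → count (inPiece? π) n * z ≤ n * weight z π
piece-bound z n (A , nothing) (uq , prs) mod∣n = scale-down {count (squares? A) n} {z} {n} {z} (squares A) {{squares≢0 prs}}
  (*-monoˡ-≤ z (count-squares≤ uq n))
piece-bound z n (A , just x) (uq , prs , ∣mod) mod∣n =
  scale-down {count (except? A x) n} {z} {n} {(x * x ∸ 1) * z} (squares (x ∷ A)) {{squares≢0 prs}}
  (≤-reflexive (trans (cong (_* z) (count-except uq prs n (∣-trans ∣mod mod∣n))) (*-assoc n (x * x ∸ 1) z)))

pieces-bound : ∀ z n πs → All Countable πs → modulus ∣ n →
  count (inSome? πs) n * z ≤ n * sum (map (weight z) πs)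
pieces-bound z n [] [] mod∣n = ≤-trans (≤-reflexive (cong (_* z) (count-none (inSome? []) n λ _ _ _ ()))) z≤n
pieces-bound z n (π ∷ πs) (c ∷ cs) mod∣n = begin
  count (inSome? (π ∷ πs)) n * z
    ≤⟨ *-monoˡ-≤ z (count-⊎ (inSome? (π ∷ πs)) (inPiece? π) (inSome? πs) n (λ _ _ _ → Any.toSum)) ⟩
  (count (inPiece? π) n + count (inSome? πs) n) * z
    ≡⟨ *-distribʳ-+ z (count (inPiece? π) n) (count (inSome? πs) n) ⟩
  count (inPiece? π) n * z + count (inSome? πs) n * z
    ≤⟨ +-mono-≤ (piece-bound z n π c mod∣n) (pieces-bound z n πs cs mod∣n) ⟩
  n * weight z π + n * sum (map (weight z) πs)
    ≡⟨ sym (*-distribˡ-+ n (weight z π) _) ⟩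
  n * sum (map (weight z) (π ∷ πs)) ∎
  where open ≤-Reasoning

module Infinities where
  open Tails free?

  prime-square≤ : ∀ {p M} .{{_ : NonZero M}} → SquareDivisor M p → 2 ≤ p × p ≤ M
  prime-square≤ {p} {M} (pr , p²∣M) = nonTrivial⇒n>1 p {{prime⇒nonTrivial pr}} ,
    ∣⇒≤ (∣-trans (m∣m*n (p * 1)) p²∣M)

  card≤tally : ∀ {M} m .{{_ : NonZero M}} → M < 2 + m → card (squarePrimes M) ≤ tally M (range 2 m)
  card≤tally {M} m M< = unique-⊆⇒length≤ (unique (squarePrimes M)) λ {p} p∈ →
    let sd = Equivalence.to (∈-squarePrimes M p) p∈
        (2≤p , p≤M) = prime-square≤ sd
    in ∈-filter⁺ (squareDivisor? M) (∈-range 2 m 2≤p (≤-trans (s≤s p≤M) M<)) sd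

  infinite-split : ∀ {M} m → 1 ≤ M → M < 2 + m → Infinite M →
    Any (λ π → InPiece π M) pieces ⊎ Event [] 7 (range 2 m) M
  infinite-split {M} m 1≤M M< inf with free? M
  ... | no ¬free with find (Any.map (λ {e} → decidable-stable (squares? e M)) (All¬⇒Any ¬free))
    where
    All¬⇒Any : ¬ Free M → Any (λ e → ¬ ¬ Squares e M) exceptional
    All¬⇒Any ¬free = ¬All⇒Any¬ (λ e → ¬? (squares? e M)) exceptional ¬free
  ...   | e , e∈ , sq = inj₁ (in-pieces e∈ sq)
  infinite-split {M} m 1≤M M< inf | yes free with 7 ≤? card (squarePrimes M)
  ... | yes 7≤ = inj₂ ([] , ≤-trans 7≤ (card≤tally m {{>-nonZero 1≤M}} M<) , free)
  ... | no 7≰ = contradiction (bounded⇒finiteType (squarePrimes M) (classification (primes (squarePrimes M)) (s≤s⁻¹ (≰⇒> 7≰))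
          (All.map (λ ¬sq e⊆ → ¬sq (All.tabulate λ q∈ → Equivalence.to (∈-squarePrimes M {{>-nonZero 1≤M}} _) (e⊆ q∈))) free))) inf

  infinite-bound : ∀ z n m seven → n ≤ suc m → modulus ∣ n →
    count (event? [] 7 (range 2 m)) n * squares [] * z ≤ n * seven →
    count infinite? n * z ≤ n * (sum (map (weight z) pieces) + seven)
  infinite-bound z n m seven n≤ mod∣n sevens = begin
    count infinite? n * z
      ≤⟨ *-monoˡ-≤ z (count-⊎ infinite? (inSome? pieces) (event? [] 7 (range 2 m)) n
           (λ M 1≤M M≤n → infinite-split m 1≤M (s≤s (≤-trans M≤n n≤)))) ⟩
    (c₁ + c₂) * z                         ≡⟨ *-distribʳ-+ z c₁ c₂ ⟩
    c₁ * z + c₂ * z                       ≤⟨ +-mono-≤ (pieces-bound z n pieces pieces-countable mod∣n)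
                                              (≤-trans (≤-reflexive (cong (_* z) (sym (*-identityʳ c₂)))) sevens) ⟩
    n * sum (map (weight z) pieces) + n * seven
                                          ≡⟨ sym (*-distribˡ-+ n (sum (map (weight z) pieces)) seven) ⟩
    n * (sum (map (weight z) pieces) + seven) ∎
    where
    open ≤-Reasoning
    c₁ = count (inSome? pieces) n
    c₂ = count (event? [] 7 (range 2 m)) n

  rescale : ∀ {c n w} z u v .{{_ : NonZero z}} → c * z ≤ n * w → w * u ≤ v * z → c * u ≤ n * v
  rescale {c} {n} {w} z u v cz≤ wu≤ = *-cancelʳ-≤ (c * u) (n * v) z (begin
    c * u * z   ≡⟨ shuffle c u z ⟩
    c * z * u   ≤⟨ *-monoˡ-≤ u cz≤ ⟩
    n * w * u   ≡⟨ *-assoc n w u ⟩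
    n * (w * u) ≤⟨ *-monoʳ-≤ n wu≤ ⟩
    n * (v * z) ≡⟨ sym (*-assoc n v z) ⟩
    n * v * z   ∎)
    where
    open ≤-Reasoning
    shuffle : ∀ c u z → c * u * z ≡ c * z * u
    shuffle = solve-∀

  module _ (z y : ℕ) .{{_ : NonZero z}} .{{_ : NonZero y}} where

    open SevenPrimes free? z y (passes divisors) not-passes⇒¬prime (multipleOf products) not-free

    upper : ∀ j₁ j₂ u v → 2 + j₁ + j₂ ≡ suc y →
      (sum (map (weight z) pieces) + caseBound (row tailRow j₂ (2 + j₁)) j₁ 2 1 7) * u ≤ v * z →
      ∀ n → modulus ∣ n → count infinite? n * u ≤ n * v
    upper j₁ j₂ u v eq check n mod∣n = rescale {count infinite? n} {n} {sum (map (weight z) pieces) + caseBound (row tailRow j₂ (2 + j₁)) j₁ 2 1 7} z u v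
      (infinite-bound z n (j₁ + (j₂ + n)) _
        (≤-trans (m≤n+m n (suc (j₁ + j₂))) (≤-reflexive (cong suc (+-assoc j₁ j₂ n)))) mod∣n
        (Validity.caseBound-valid n j₁ 2 7 (s≤s z≤n) refl
          (Validity.row-valid n j₂ (2 + j₁) (s≤s z≤n) eq (Validity.tailRow-valid n n)) [] [] []))
      check

  lower-arith : ∀ {c₁ c₂ b n} s t k u v .{{_ : NonZero s}} .{{_ : NonZero t}} → c₁ * s ≡ n → c₂ * t ≡ n * k →
    c₁ + c₂ ≤ b → v * (s * t) ≤ t * u + k * (s * u) → n * v ≤ b * u
  lower-arith {c₁} {c₂} {b} {n} s t k u v eq₁ eq₂ c≤b v≤ = *-cancelʳ-≤ (n * v) (b * u) (s * t) (begin
    n * v * (s * t)                       ≡⟨ *-assoc n v (s * t) ⟩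
    n * (v * (s * t))                     ≤⟨ *-monoʳ-≤ n v≤ ⟩
    n * (t * u + k * (s * u))             ≡⟨ *-distribˡ-+ n (t * u) (k * (s * u)) ⟩
    n * (t * u) + n * (k * (s * u))       ≡⟨ cong (n * (t * u) +_) (sym (*-assoc n k (s * u))) ⟩
    n * (t * u) + n * k * (s * u)         ≡⟨ cong₂ (λ p q → p * (t * u) + q * (s * u)) (sym eq₁) (sym eq₂) ⟩
    c₁ * s * (t * u) + c₂ * t * (s * u)   ≡⟨ shuffle c₁ c₂ s t u ⟩
    (c₁ + c₂) * u * (s * t)               ≤⟨ *-monoˡ-≤ (s * t) (*-monoˡ-≤ u c≤b) ⟩
    b * u * (s * t)                       ∎)
    where
    open ≤-Reasoning
    instance
      st≢0 : NonZero (s * t)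
      st≢0 = m*n≢0 s t
    shuffle : ∀ c d s t u → c * s * (t * u) + d * t * (s * u) ≡ (c + d) * u * (s * t)
    shuffle = solve-∀

  squares⇒infinite : ∀ {A M} .{{_ : NonZero M}} → (∀ {ps} → All Prime ps → A ⊆ ps → ¬ Bounded ps) → Squares A M → Infinite M
  squares⇒infinite {M = M} unbounded sq fin = unbounded (primes (squarePrimes M))
    (λ p∈ → Equivalence.from (∈-squarePrimes M _) (All.lookup sq p∈)) (finiteType⇒bounded (squarePrimes M) fin)

  -- The x lies in A, so leaving out the multiples of x^2 makes the second family disjoint from the
  -- first and the two counts add up.
  lower : ∀ A B x k u v → Unique A → All Prime A → squares A ∣ modulus → Countable (B , just x) → x * x ∸ 1 ≡ k → x ∈ A →
    (∀ {ps} → All Prime ps → A ⊆ ps → ¬ Bounded ps) → (∀ {ps} → All Prime ps → B ⊆ ps → ¬ Bounded ps) →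
    v * (squares A * squares (x ∷ B)) ≤ squares (x ∷ B) * u + k * (squares A * u) →
    ∀ n → modulus ∣ n → n * v ≤ count infinite? n * u
  lower A B x k u v uqA prA sA∣ (uqB , prB , sB∣) refl x∈A unbA unbB check n mod∣n =
    lower-arith {count (squares? A) n} {count (except? B x) n} (squares A) (squares (x ∷ B)) (x * x ∸ 1) u v {{squares≢0 prA}} {{squares≢0 prB}}
      (count-squares uqA prA n (∣-trans sA∣ mod∣n)) (count-except uqB prB n (∣-trans sB∣ mod∣n))
      (count-disjoint infinite? (squares? A) (except? B x) n
        (λ M 1≤M _ sq → squares⇒infinite {A} {{>-nonZero 1≤M}} unbA sq)
        (λ M 1≤M _ (sq , _) → squares⇒infinite {B} {{>-nonZero 1≤M}} unbB sq)
        (λ M sq (_ , ¬x²) → ¬x² (All.lookup sq x∈A)))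
      check

-- Densities are rounded up to multiples of 10 ^ -20. Of the sets of seven primes,
-- those containing an exceptional set are discarded by looking at the primes below
-- 30; the primes above 2000 enter only through the telescoping bound.
infinite-upper : ∀ n → modulus ∣ n → count infinite? n * 100000000000 ≤ n * 8746
infinite-upper = Infinities.upper (10 ^ 20) 2000 28 1971 100000000000 8746 refl (≤ᵇ⇒≤ _ _ tt)

-- The prime 7 separates the two sets and 48 = 7^2 - 1. The densities are 1 / 3990^2 and (48 / 49) /
-- 6630^2.
infinite-lower : ∀ n → modulus ∣ n → n * 847 ≤ count infinite? n * 10000000000
infinite-lower = Infinities.lower A B 7 48 10000000000 847
  (from-yes (unique? A)) (from-yes (All.all? prime? A)) (from-yes (squares A ∣? modulus))
  (from-yes (countable? (B , just 7))) refl (there (there (there (here refl))))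
  unbounded-2-3-5-7-19 unbounded-2-3-5-13-17 (≤ᵇ⇒≤ _ _ tt)
  where
  A B : List ℕ
  A = 2 ∷ 3 ∷ 5 ∷ 7 ∷ 19 ∷ []
  B = 2 ∷ 3 ∷ 5 ∷ 13 ∷ 17 ∷ []

-- Truncation at y and periodicity in M

SmallFinite : ℕ → ℕ → Set
SmallFinite y M = FiniteType (small y (squarePrimes M))

smallFinite? : ∀ y M → Dec (SmallFinite y M)
smallFinite? y M = finiteType? (small y (squarePrimes M))

anything? : (M : ℕ) → Dec ⊤
anything? M = yes tt

module Beyond = Tails anything?

Beyond? : ∀ y n M → Dec (Beyond.Event [] 1 (range (suc y) n) M)
Beyond? y n = Beyond.event? [] 1 (range (suc y) n)

beyond-bound : ∀ y n → count (Beyond? y n) n * y ≤ n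
beyond-bound y n = ≤-trans (≤-reflexive (shuffle (count (Beyond? y n) n) y)) (Beyond.tail-bound n 1 n y [] [] [])
  where
  shuffle : ∀ c y → c * y ≡ c * 1 * (y * 1)
  shuffle = solve-∀

small-all : ∀ y n M → 1 ≤ M → M ≤ n → ¬ Beyond.Event [] 1 (range (suc y) n) M → squarePrimes M ≋ small y (squarePrimes M)
small-all y n M 1≤M M≤n none = (λ {p} p∈ → ∈-filter⁺ (_≤? y) p∈ (≮⇒≥ λ y<p → none ([] , at-least-one p∈ y<p , tt))) ,
  (λ p∈ → proj₁ (∈-filter⁻ (_≤? y) {xs = elements (squarePrimes M)} p∈))
  where
  at-least-one : ∀ {p} → p ∈ elements (squarePrimes M) → y < p → 1 ≤ Beyond.tally M (range (suc y) n)
  at-least-one {p} p∈ y<p =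
    let sd = Equivalence.to (∈-squarePrimes M {{>-nonZero 1≤M}} p) p∈
        (_ , p≤M) = Infinities.prime-square≤ {{>-nonZero 1≤M}} sd
    in ∈-length (∈-filter⁺ (squareDivisor? M) (∈-range (suc y) n y<p (s≤s (≤-trans p≤M (≤-trans M≤n (m≤n+m n y))))) sd)

finite≤small : ∀ y n → count finite? n * y ≤ count (smallFinite? y) n * y + n
finite≤small y n = ≤-trans (*-monoˡ-≤ y (count-⊎ finite? (smallFinite? y) (Beyond? y n) n λ M 1≤M M≤n fin →
    case Beyond? y n M of λ where
      (yes b) → inj₂ b
      (no ¬b) → inj₁ (finiteType-≋ {squarePrimes M} {small y (squarePrimes M)} (small-all y n M 1≤M M≤n ¬b) fin)))
  (≤-trans (≤-reflexive (*-distribʳ-+ y (count (smallFinite? y) n) _)) (+-monoʳ-≤ _ (beyond-bound y n)))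

small≤finite : ∀ y n → count (smallFinite? y) n * y ≤ count finite? n * y + n
small≤finite y n = ≤-trans (*-monoˡ-≤ y (count-⊎ (smallFinite? y) finite? (Beyond? y n) n λ M 1≤M M≤n fin →
    case Beyond? y n M of λ where
      (yes b) → inj₂ b
      (no ¬b) → let (to , from) = small-all y n M 1≤M M≤n ¬b in
        inj₁ (finiteType-≋ {small y (squarePrimes M)} {squarePrimes M} ((λ {_} → from) , (λ {_} → to)) fin)))
  (≤-trans (≤-reflexive (*-distribʳ-+ y (count finite? n) _)) (+-monoʳ-≤ _ (beyond-bound y n)))

module _ {P : ℕ → Set} (P? : ∀ M → Dec (P M)) (Q : ℕ)
  (shift⁺ : ∀ M → 1 ≤ M → P M → P (M + Q)) (shift⁻ : ∀ M → 1 ≤ M → P (M + Q) → P M) where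

  count-shift : ∀ n → count P? (n + Q) ≡ count P? n + count P? Q
  count-shift zero = refl
  count-shift (suc n) = trans (cong₂ _+_ bits (count-shift n)) (sym (+-assoc (bit (P? (suc n))) (count P? n) (count P? Q)))
    where
    bits : bit (P? (suc n + Q)) ≡ bit (P? (suc n))
    bits with P? (suc n + Q) | P? (suc n)
    ... | yes _ | yes _ = refl
    ... | no _  | no _  = refl
    ... | yes p | no ¬p = contradiction (shift⁻ (suc n) (s≤s z≤n) p) ¬p
    ... | no ¬p | yes p = contradiction (shift⁺ (suc n) (s≤s z≤n) p) ¬p

  count-periods : ∀ r q → count P? (r + q * Q) ≡ count P? r + q * count P? Q
  count-periods r zero = trans (cong (count P?) (+-identityʳ r)) (sym (+-identityʳ _))
  count-periods r (suc q) = begin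
    count P? (r + (Q + q * Q))               ≡⟨ cong (count P?) (shuffle r Q (q * Q)) ⟩
    count P? (r + q * Q + Q)                 ≡⟨ count-shift (r + q * Q) ⟩
    count P? (r + q * Q) + count P? Q        ≡⟨ cong (_+ count P? Q) (count-periods r q) ⟩
    count P? r + q * count P? Q + count P? Q ≡⟨ sym (shuffle (count P? r) (count P? Q) (q * count P? Q)) ⟩
    count P? r + (count P? Q + q * count P? Q) ∎
    where
    open ≡-Reasoning
    shuffle : ∀ r q s → r + (q + s) ≡ r + s + q
    shuffle = solve-∀

  count-exact : ∀ n → Q ∣ n → count P? n * Q ≡ n * count P? Q
  count-exact n (divides q refl) = trans (cong (_* Q) (count-periods 0 q)) (shuffle q (count P? Q) Q)
    where
    shuffle : ∀ q a Q → q * a * Q ≡ q * Q * a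
    shuffle = solve-∀

  module _ .{{_ : NonZero Q}} where

    -- The incomplete period changes the count by at most Q, and the inequality is multiplied by Q.
    count-near : ∀ n → count P? n * Q ≤ n * count P? Q + Q * Q × n * count P? Q ≤ count P? n * Q + Q * Q
    count-near n = subst (λ n → count P? n * Q ≤ n * A + Q * Q × n * A ≤ count P? n * Q + Q * Q) (sym (m≡m%n+[m/n]*n n Q))
      (subst (λ c → c * Q ≤ (r + q * Q) * A + Q * Q × (r + q * Q) * A ≤ c * Q + Q * Q) (sym (count-periods r q))
        ( (begin
            (count P? r + q * A) * Q       ≡⟨ expand (count P? r) q A Q ⟩
            q * Q * A + count P? r * Q     ≤⟨ +-mono-≤ (*-monoˡ-≤ A (m≤n+m (q * Q) r)) (*-monoˡ-≤ Q (≤-trans (count≤ P? r) r≤Q)) ⟩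
            (r + q * Q) * A + Q * Q        ∎)
        , (begin
            (r + q * Q) * A                ≡⟨ expand′ r q A Q ⟩
            q * A * Q + r * A              ≤⟨ +-mono-≤ (*-monoˡ-≤ Q (m≤n+m (q * A) (count P? r))) (*-mono-≤ r≤Q (count≤ P? Q)) ⟩
            (count P? r + q * A) * Q + Q * Q ∎)))
      where
      open ≤-Reasoning
      A = count P? Q
      r = n % Q
      q = n / Q
      r≤Q : r ≤ Q
      r≤Q = <⇒≤ (m%n<n n Q)
      expand : ∀ c q a Q → (c + q * a) * Q ≡ q * Q * a + c * Q
      expand = solve-∀
      expand′ : ∀ r q a Q → (r + q * Q) * a ≡ q * a * Q + r * a
      expand′ = solve-∀

abstract
  -- Factorials give a multiple of all p^2 with p at most y, and periods that divide one another.
  -- Being abstract, they are never evaluated.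
  period : ℕ → ℕ
  period y = y ! * y !

  period≢0 : ∀ y → NonZero (period y)
  period≢0 y = m*n≢0 (y !) (y !) {{y !≢0}} {{y !≢0}}

  square∣period : ∀ {p y} → Prime p → p ≤ y → p ^ 2 ∣ period y
  square∣period {p} {y} pr p≤y = subst (_∣ period y) (cong (p *_) (sym (*-identityʳ p))) (*-pres-∣ p∣y! p∣y!)
    where
    p∣y! : p ∣ y !
    p∣y! = ∣-trans (m∣m! p {{prime⇒nonZero pr}}) (m≤n⇒m!∣n! p≤y)
      where
      m∣m! : ∀ m .{{_ : NonZero m}} → m ∣ m !
      m∣m! (suc m) = m∣m*n (m !)

  period-mono : ∀ {y z} → y ≤ z → period y ∣ period z
  period-mono y≤z = *-pres-∣ (m≤n⇒m!∣n! y≤z) (m≤n⇒m!∣n! y≤z)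

smallFinite-shift : ∀ y M → 1 ≤ M → small y (squarePrimes M) ≋ small y (squarePrimes (M + period y))
smallFinite-shift y M 1≤M =
  (λ {p} p∈ → let (p∈′ , p≤y) = ∈-filter⁻ (_≤? y) {xs = elements (squarePrimes M)} p∈
                  (pr , p²∣) = Equivalence.to (∈-squarePrimes M {{M≢0}} p) p∈′
    in ∈-filter⁺ (_≤? y) (Equivalence.from (∈-squarePrimes (M + period y) {{M+≢0}} p)
         (pr , ∣m∣n⇒∣m+n p²∣ (square∣period pr p≤y))) p≤y) ,
  (λ {p} p∈ → let (p∈′ , p≤y) = ∈-filter⁻ (_≤? y) {xs = elements (squarePrimes (M + period y))} p∈
                  (pr , p²∣) = Equivalence.to (∈-squarePrimes (M + period y) {{M+≢0}} p) p∈′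
    in ∈-filter⁺ (_≤? y) (Equivalence.from (∈-squarePrimes M {{M≢0}} p)
         (pr , ∣m+n∣m⇒∣n (subst (p ^ 2 ∣_) (+-comm M (period y)) p²∣) (square∣period pr p≤y))) p≤y)
  where
  M≢0 : NonZero M
  M≢0 = >-nonZero 1≤M
  M+≢0 : NonZero (M + period y)
  M+≢0 = >-nonZero (≤-trans 1≤M (m≤m+n M (period y)))

≋-sym : ∀ {P Q} → P ≋ Q → Q ≋ P
≋-sym (to , from) = (λ {_} → from) , (λ {_} → to)

module SmallCount (y : ℕ) where

  Q A : ℕ
  Q = period y
  A = count (smallFinite? y) Q

  instance
    Q≢0 : NonZero Q
    Q≢0 = period≢0 y

  shift⁺ : ∀ M → 1 ≤ M → SmallFinite y M → SmallFinite y (M + Q)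
  shift⁺ M 1≤M = finiteType-≋ {small y (squarePrimes M)} {small y (squarePrimes (M + Q))} (smallFinite-shift y M 1≤M)

  shift⁻ : ∀ M → 1 ≤ M → SmallFinite y (M + Q) → SmallFinite y M
  shift⁻ M 1≤M = finiteType-≋ {small y (squarePrimes (M + Q))} {small y (squarePrimes M)}
    (≋-sym {small y (squarePrimes M)} {small y (squarePrimes (M + Q))} (smallFinite-shift y M 1≤M))

  private
    f c : ℕ → ℕ
    f = count finite?
    c = count (smallFinite? y)

    from-bounds : ∀ {u v n s} → u * y ≤ v * y + n → v * Q ≤ n * A + s → u * y * Q ≤ n * A * y + (s * y + n * Q)
    from-bounds {u} {v} {n} {s} uy≤ vQ≤ = begin
      u * y * Q                       ≤⟨ *-monoˡ-≤ Q uy≤ ⟩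
      (v * y + n) * Q                 ≡⟨ expand v y n Q ⟩
      v * Q * y + n * Q               ≤⟨ +-monoˡ-≤ (n * Q) (*-monoˡ-≤ y vQ≤) ⟩
      (n * A + s) * y + n * Q         ≡⟨ collect n A s y (n * Q) ⟩
      n * A * y + (s * y + n * Q)     ∎
      where
      open ≤-Reasoning
      expand : ∀ v y n Q → (v * y + n) * Q ≡ v * Q * y + n * Q
      expand = solve-∀
      collect : ∀ n a s y w → (n * a + s) * y + w ≡ n * a * y + (s * y + w)
      collect = solve-∀

    to-bounds : ∀ {u v n s} → v * y ≤ u * y + n → n * A ≤ v * Q + s → n * A * y ≤ u * y * Q + (s * y + n * Q)
    to-bounds {u} {v} {n} {s} vy≤ nA≤ = begin
      n * A * y                       ≤⟨ *-monoˡ-≤ y nA≤ ⟩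
      (v * Q + s) * y                 ≡⟨ expand v Q s y ⟩
      v * y * Q + s * y               ≤⟨ +-monoˡ-≤ (s * y) (*-monoˡ-≤ Q vy≤) ⟩
      (u * y + n) * Q + s * y         ≡⟨ collect (u * y) n Q (s * y) ⟩
      u * y * Q + (s * y + n * Q)     ∎
      where
      open ≤-Reasoning
      expand : ∀ v Q s y → (v * Q + s) * y ≡ v * y * Q + s * y
      expand = solve-∀
      collect : ∀ w n Q s → (w + n) * Q + s ≡ w * Q + (s + n * Q)
      collect = solve-∀

  exact : ∀ n → Q ∣ n → f n * y * Q ≤ n * A * y + n * Q × n * A * y ≤ f n * y * Q + n * Q
  exact n Q∣n =
    from-bounds {f n} {c n} {n} {0} (finite≤small y n) (≤-trans (≤-reflexive eq) (m≤m+n (n * A) 0)) ,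
    to-bounds {f n} {c n} {n} {0} (small≤finite y n) (≤-trans (≤-reflexive (sym eq)) (m≤m+n (c n * Q) 0))
    where
    eq : c n * Q ≡ n * A
    eq = count-exact (smallFinite? y) Q shift⁺ shift⁻ n Q∣n

  near : ∀ n → Q * y ≤ n → f n * y * Q ≤ n * A * y + 2 * (n * Q) × n * A * y ≤ f n * y * Q + 2 * (n * Q)
  near n Qy≤n =
    ≤-trans (from-bounds {f n} {c n} {n} {Q * Q} (finite≤small y n) (proj₁ nearby)) (+-monoʳ-≤ (n * A * y) error) ,
    ≤-trans (to-bounds {f n} {c n} {n} {Q * Q} (small≤finite y n) (proj₂ nearby)) (+-monoʳ-≤ (f n * y * Q) error)
    where
    nearby = count-near (smallFinite? y) Q shift⁺ shift⁻ n
    error : Q * Q * y + n * Q ≤ 2 * (n * Q)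
    error = begin
      Q * Q * y + n * Q     ≡⟨ cong (_+ n * Q) (shuffle Q y) ⟩
      Q * y * Q + n * Q     ≤⟨ +-monoˡ-≤ (n * Q) (*-monoˡ-≤ Q Qy≤n) ⟩
      n * Q + n * Q         ≡⟨ cong (n * Q +_) (sym (+-identityʳ (n * Q))) ⟩
      2 * (n * Q)           ∎
      where
      open ≤-Reasoning
      shuffle : ∀ q y → q * q * y ≡ q * y * q
      shuffle = solve-∀

-- The limit as a real number

-- opened here because +_ would clash with sections of _+_ above
open import Data.Integer using (+_; -[1+_]; +[1+_])

/-mono : ∀ a b c d .{{_ : NonZero b}} .{{_ : NonZero d}} → a * d ≤ c * b → (+ a) ℚ./ b ℚ.≤ (+ c) ℚ./ d
/-mono a (suc b) c (suc d) le = ℚₚ.toℚᵘ-cancel-≤ (begin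
  ℚ.toℚᵘ ((+ a) ℚ./ suc b) ≃⟨ ℚₚ.toℚᵘ-fromℚᵘ (mkℚᵘ (+ a) b) ⟩
  mkℚᵘ (+ a) b             ≤⟨ ℚᵘ.*≤* (subst₂ ℤ._≤_ (ℤₚ.pos-* a (suc d)) (ℤₚ.pos-* c (suc b)) (ℤ.+≤+ le)) ⟩
  mkℚᵘ (+ c) d             ≃⟨ ℚᵘₚ.≃-sym (ℚₚ.toℚᵘ-fromℚᵘ (mkℚᵘ (+ c) d)) ⟩
  ℚ.toℚᵘ ((+ c) ℚ./ suc d) ∎)
  where open ℚᵘₚ.≤-Reasoning

/-+ : ∀ a b c d .{{_ : NonZero b}} .{{_ : NonZero d}} →
  (+ a) ℚ./ b ℚ.+ (+ c) ℚ./ d ≡ ℚ._/_ (+ (a * d + c * b)) (b * d) {{m*n≢0 b d}}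
/-+ a (suc b) c (suc d) = ℚₚ.toℚᵘ-injective (begin-equality
  ℚ.toℚᵘ ((+ a) ℚ./ suc b ℚ.+ (+ c) ℚ./ suc d)
    ≃⟨ ℚₚ.toℚᵘ-homo-+ ((+ a) ℚ./ suc b) ((+ c) ℚ./ suc d) ⟩
  ℚ.toℚᵘ ((+ a) ℚ./ suc b) ℚᵘ.+ ℚ.toℚᵘ ((+ c) ℚ./ suc d)
    ≃⟨ ℚᵘₚ.+-cong (ℚₚ.toℚᵘ-fromℚᵘ (mkℚᵘ (+ a) b)) (ℚₚ.toℚᵘ-fromℚᵘ (mkℚᵘ (+ c) d)) ⟩
  mkℚᵘ ((+ a) ℤ.* (+ suc d) ℤ.+ (+ c) ℤ.* (+ suc b)) (d + b * suc d)
    ≡⟨ cong (λ i → mkℚᵘ i (d + b * suc d)) (cong₂ ℤ._+_ (sym (ℤₚ.pos-* a (suc d))) (sym (ℤₚ.pos-* c (suc b)))) ⟩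
  mkℚᵘ (+ (a * suc d + c * suc b)) (d + b * suc d)
    ≃⟨ ℚᵘₚ.≃-sym (ℚₚ.toℚᵘ-fromℚᵘ (mkℚᵘ (+ (a * suc d + c * suc b)) (d + b * suc d))) ⟩
  ℚ.toℚᵘ ((+ (a * suc d + c * suc b)) ℚ./ (suc b * suc d)) ∎)
  where open ℚᵘₚ.≤-Reasoning

/-≤-+ : ∀ a b c d e f .{{_ : NonZero b}} .{{_ : NonZero d}} .{{_ : NonZero f}} →
  a * (d * f) ≤ (c * f + e * d) * b → (+ a) ℚ./ b ℚ.≤ (+ c) ℚ./ d ℚ.+ (+ e) ℚ./ f
/-≤-+ a b c d e f le = subst ((+ a) ℚ./ b ℚ.≤_) (sym (/-+ c d e f))
  (/-mono a b (c * f + e * d) (d * f) {{it}} {{m*n≢0 d f}} le)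

+-/-≤ : ∀ a b c d e f .{{_ : NonZero b}} .{{_ : NonZero d}} .{{_ : NonZero f}} →
  (a * d + c * b) * f ≤ e * (b * d) → (+ a) ℚ./ b ℚ.+ (+ c) ℚ./ d ℚ.≤ (+ e) ℚ./ f
+-/-≤ a b c d e f le = subst (ℚ._≤ (+ e) ℚ./ f) (sym (/-+ a b c d))
  (/-mono (a * d + c * b) (b * d) e f {{m*n≢0 b d}} {{it}} le)

+-cancelʳ : ∀ p q → p ℚ.+ q ℚ.- q ≡ p
+-cancelʳ p q = trans (ℚₚ.+-assoc p q (ℚ.- q)) (trans (cong (p ℚ.+_) (ℚₚ.+-inverseʳ q)) (ℚₚ.+-identityʳ p))

≤-+⇒-≤ : ∀ {p q r} → p ℚ.≤ q ℚ.+ r → p ℚ.- r ℚ.≤ q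
≤-+⇒-≤ {p} {q} {r} le = subst (p ℚ.- r ℚ.≤_) (+-cancelʳ q r) (ℚₚ.+-monoˡ-≤ (ℚ.- r) le)

record Close (e p q : ℚ) : Set where
  constructor _,_
  field
    fst≤ : p ℚ.≤ q ℚ.+ e
    snd≤ : q ℚ.≤ p ℚ.+ e

close-/ : ∀ a b c d e f .{{_ : NonZero b}} .{{_ : NonZero d}} .{{_ : NonZero f}} →
  a * (d * f) ≤ (c * f + e * d) * b → c * (b * f) ≤ (a * f + e * b) * d →
  Close ((+ e) ℚ./ f) ((+ a) ℚ./ b) ((+ c) ℚ./ d)
close-/ a b c d e f le ge = /-≤-+ a b c d e f le , /-≤-+ c d a b e f ge

close-sym : ∀ {e p q} → Close e p q → Close e q p
close-sym (le , ge) = ge , le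

close-mono : ∀ {e f p q} → e ℚ.≤ f → Close e p q → Close f p q
close-mono {p = p} {q} e≤f (le , ge) = ℚₚ.≤-trans le (ℚₚ.+-monoʳ-≤ q e≤f) , ℚₚ.≤-trans ge (ℚₚ.+-monoʳ-≤ p e≤f)

close-trans : ∀ {e f p q r} → Close e p q → Close f q r → Close (e ℚ.+ f) p r
close-trans {e} {f} {p} {q} {r} (p≤ , ≤p) (q≤ , ≤q) =
  ℚₚ.≤-trans p≤ (ℚₚ.≤-trans (ℚₚ.+-monoˡ-≤ e q≤) (ℚₚ.≤-reflexive (trans (ℚₚ.+-assoc r f e) (cong (r ℚ.+_) (ℚₚ.+-comm f e))))) ,
  ℚₚ.≤-trans ≤q (ℚₚ.≤-trans (ℚₚ.+-monoˡ-≤ f ≤p) (ℚₚ.≤-reflexive (ℚₚ.+-assoc p e f)))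

close-∣∣ : ∀ {e p q} → Close e p q → ℚ.∣ p ℚ.- q ∣ ℚ.≤ e
close-∣∣ {e} {p} {q} (le , ge) with ℚₚ.∣p∣≡p∨∣p∣≡-p (p ℚ.- q)
... | inj₁ eq = subst (ℚ._≤ e) (sym eq) (≤-+⇒-≤ (subst (p ℚ.≤_) (ℚₚ.+-comm q e) le))
... | inj₂ eq = subst (ℚ._≤ e) (sym (trans eq swapped)) (≤-+⇒-≤ (subst (q ℚ.≤_) (ℚₚ.+-comm p e) ge))
  where
  neg-neg : ∀ p → ℚ.- (ℚ.- p) ≡ p
  neg-neg (mkℚ (+ zero) d c) = refl
  neg-neg (mkℚ +[1+ n ] d c) = refl
  neg-neg (mkℚ -[1+ n ] d c) = refl
  swapped : ℚ.- (p ℚ.- q) ≡ q ℚ.- p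
  swapped = trans (ℚₚ.neg-distrib-+ p (ℚ.- q)) (trans (cong (ℚ.- p ℚ.+_) (neg-neg q)) (ℚₚ.+-comm (ℚ.- p) q))

positive-above : ∀ ε → ℚ.0ℚ ℚ.< ε → ∃ λ q → (+ 1) ℚ./ suc q ℚ.≤ ε
positive-above (mkℚ (+ zero) d c) (ℚ.*<* (ℤ.+<+ ()))
positive-above (mkℚ -[1+ k ] d c) (ℚ.*<* ())
positive-above ε@(mkℚ +[1+ k ] d c) _ = d , subst ((+ 1) ℚ./ suc d ℚ.≤_) (ℚₚ.↥p/↧p≡p ε)
  (/-mono 1 (suc d) (suc k) (suc d) (*-monoˡ-≤ (suc d) (s≤s (z≤n {k}))))

finiteCount : ℕ → ℕ
finiteCount = count finite?

finiteCount-cardinality : ∀ n → HasCardinality (𝒜 n) (finiteCount n)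
finiteCount-cardinality n = satisfying finite? n , satisfying-unique finite? n ,
  (λ M → mk⇔ (∈-satisfying⁻ finite? n) (λ (1≤M , M≤n , fin) → ∈-satisfying⁺ finite? n 1≤M M≤n fin)) ,
  length-satisfying finite? n

abstract
  density : ℕ → ℚ
  density y = ℚ._/_ (+ SmallCount.A y) (period y) {{period≢0 y}}

  close-density : ∀ y k n .{{_ : NonZero y}} .{{_ : NonZero n}} →
    finiteCount n * y * period y ≤ n * SmallCount.A y * y + k * (n * period y) ×
    n * SmallCount.A y * y ≤ finiteCount n * y * period y + k * (n * period y) →
    Close ((+ k) ℚ./ y) ((+ finiteCount n) ℚ./ n) (density y)
  close-density y k n (le , ge) = close-/ (finiteCount n) n (SmallCount.A y) (period y) k y {{it}} {{period≢0 y}} {{it}}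
    (subst₂ _≤_ (shuffle₁ (finiteCount n) y (period y)) (shuffle₂ n (SmallCount.A y) y k (period y)) le)
    (subst₂ _≤_ (shuffle₃ n (SmallCount.A y) y) (shuffle₄ (finiteCount n) y (period y) k n) ge)
    where
    shuffle₁ : ∀ f y q → f * y * q ≡ f * (q * y)
    shuffle₁ = solve-∀
    shuffle₂ : ∀ n a y k q → n * a * y + k * (n * q) ≡ (a * y + k * q) * n
    shuffle₂ = solve-∀
    shuffle₃ : ∀ n a y → n * a * y ≡ a * (n * y)
    shuffle₃ = solve-∀
    shuffle₄ : ∀ f y q k n → f * y * q + k * (n * q) ≡ (f * y + k * n) * q
    shuffle₄ = solve-∀

close-exact : ∀ y n .{{_ : NonZero y}} .{{_ : NonZero n}} → period y ∣ n →
  Close ((+ 1) ℚ./ y) ((+ finiteCount n) ℚ./ n) (density y)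
close-exact y n Q∣n = close-density y 1 n (subst
  (λ e → finiteCount n * y * period y ≤ n * SmallCount.A y * y + e × n * SmallCount.A y * y ≤ finiteCount n * y * period y + e)
  (sym (*-identityˡ (n * period y))) (SmallCount.exact y n Q∣n))

close-near : ∀ y n .{{_ : NonZero y}} .{{_ : NonZero n}} → period y * y ≤ n →
  Close ((+ 2) ℚ./ y) ((+ finiteCount n) ℚ./ n) (density y)
close-near y n Qy≤n = close-density y 2 n (SmallCount.near y n Qy≤n)

abstract
  -- The limit is approximated at these n only. The factor `period` makes the truncated count exact;
  -- the factor `modulus` makes both density bounds hold for every single approximation, not just in
  -- the limit.
  grid : ℕ → ℕ
  grid m = period (2 * suc m) * modulus

  grid≢0 : ∀ m → NonZero (grid m)
  grid≢0 m = m*n≢0 (period (2 * suc m)) modulus {{period≢0 (2 * suc m)}}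

  modulus∣grid : ∀ m → modulus ∣ grid m
  modulus∣grid m = n∣m*n (period (2 * suc m))

  period∣grid : ∀ {y} m → y ≤ 2 * suc m → period y ∣ grid m
  period∣grid m y≤ = ∣m⇒∣m*n modulus (period-mono y≤)

abstract
  approximation : ℕ → ℚ
  approximation m = ℚ._/_ (+ finiteCount (grid m)) (grid m) {{grid≢0 m}}

  close-approximation : ∀ y m .{{_ : NonZero y}} → y ≤ 2 * suc m → Close ((+ 1) ℚ./ y) (approximation m) (density y)
  close-approximation y m y≤ = close-exact y (grid m) {{it}} {{grid≢0 m}} (period∣grid m y≤)

  approximation-≥ : ∀ w u .{{_ : NonZero u}} → (∀ n → modulus ∣ n → n * w ≤ finiteCount n * u) →
    ∀ m → (+ w) ℚ./ u ℚ.≤ approximation m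
  approximation-≥ w u le m = /-mono w u (finiteCount (grid m)) (grid m) {{it}} {{grid≢0 m}}
    (≤-trans (≤-reflexive (*-comm w (grid m))) (le (grid m) (modulus∣grid m)))

  approximation-≤ : ∀ w u .{{_ : NonZero u}} → (∀ n → modulus ∣ n → finiteCount n * u ≤ n * w) →
    ∀ m → approximation m ℚ.≤ (+ w) ℚ./ u
  approximation-≤ w u le m = /-mono (finiteCount (grid m)) (grid m) w u {{grid≢0 m}} {{it}}
    (≤-trans (le (grid m) (modulus∣grid m)) (≤-reflexive (*-comm (grid m) w)))

1/≤1/+1/ : ∀ s t .{{_ : NonZero s}} .{{_ : NonZero t}} → (+ 1) ℚ./ s ℚ.≤ (+ 1) ℚ./ s ℚ.+ (+ 1) ℚ./ t
1/≤1/+1/ s t = /-≤-+ 1 s 1 s 1 t (≤-trans (m≤m+n (1 * (s * t)) (s * s)) (≤-reflexive (shuffle s t)))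
  where
  shuffle : ∀ s t → 1 * (s * t) + s * s ≡ (1 * t + 1 * s) * s
  shuffle = solve-∀

halves : ∀ s .{{_ : NonZero s}} .{{_ : NonZero (2 * s)}} → (+ 1) ℚ./ (2 * s) ℚ.+ (+ 1) ℚ./ (2 * s) ℚ.≤ (+ 1) ℚ./ s
halves s = +-/-≤ 1 (2 * s) 1 (2 * s) 1 s (≤-reflexive (shuffle s))
  where
  shuffle : ∀ s → (1 * (2 * s) + 1 * (2 * s)) * s ≡ 1 * (2 * s * (2 * s))
  shuffle = solve-∀

thirds : ∀ q y .{{_ : NonZero q}} .{{_ : NonZero y}} → 3 * q ≤ y → (+ 2) ℚ./ y ℚ.+ (+ 1) ℚ./ y ℚ.≤ (+ 1) ℚ./ q
thirds q y 3q≤y = +-/-≤ 2 y 1 y 1 q (≤-trans (≤-reflexive (shuffle q y))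
  (≤-trans (*-monoˡ-≤ y 3q≤y) (≤-reflexive (sym (*-identityˡ (y * y))))))
  where
  shuffle : ∀ q y → (2 * y + 1 * y) * q ≡ 3 * q * y
  shuffle = solve-∀

close-approximations : ∀ {m k} → m ≤ k → Close ((+ 1) ℚ./ suc m) (approximation m) (approximation k)
close-approximations {m} {k} m≤k = close-mono (halves (suc m))
  (close-trans (close-approximation (2 * suc m) m ≤-refl)
    (close-sym (close-approximation (2 * suc m) k (*-monoʳ-≤ 2 (s≤s m≤k)))))

limit : ℝ
limit = record { seq = approximation ; regular = λ m k → close-∣∣ (close m k) }
  where
  close : ∀ m k → Close ((+ 1) ℚ./ suc m ℚ.+ (+ 1) ℚ./ suc k) (approximation m) (approximation k)
  close m k with ≤-total m k
  ... | inj₁ m≤k = close-mono (1/≤1/+1/ (suc m) (suc k)) (close-approximations m≤k)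
  ... | inj₂ k≤m = close-mono (subst ((+ 1) ℚ./ suc k ℚ.≤_) (ℚₚ.+-comm ((+ 1) ℚ./ suc k) ((+ 1) ℚ./ suc m))
          (1/≤1/+1/ (suc k) (suc m))) (close-sym (close-approximations k≤m))

module _ (ε : ℚ) (y μ : ℕ) .{{_ : NonZero y}} (y≤ : y ≤ 2 * suc μ) (small : (+ 2) ℚ./ y ℚ.+ (+ 1) ℚ./ y ℚ.≤ ε)
  (n : ℕ) .{{_ : NonZero n}} (n≥ : period y * y ≤ n) where

  private
    s = (+ finiteCount n) ℚ./ n

  -- For small k the grid may be too coarse for a comparison with `density y`. The detour through
  -- `k ⊔ μ` repairs this and costs at most 1 / (k + 1), within the slack of the order on reals.
  close-limit : ∀ k → Close (ε ℚ.+ (+ 2) ℚ./ suc k) s (approximation k)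
  close-limit k = close-trans
    (close-mono small (close-trans (close-near y n n≥)
      (close-sym (close-approximation y (k ⊔ μ) (≤-trans y≤ (*-monoʳ-≤ 2 (s≤s (m≤n⊔m k μ))))))))
    (close-mono (/-mono 1 (suc k) 2 (suc k) (*-monoˡ-≤ (suc k) (s≤s (z≤n {1})))) (close-sym (close-approximations (m≤m⊔n k μ))))

  near-limit : fromℚ (s ℚ.- ε) ≤ℝ limit × limit ≤ℝ fromℚ (s ℚ.+ ε)
  near-limit =
    (λ k → ≤-+⇒-≤ {s} {approximation k ℚ.+ (+ 2) ℚ./ suc k} {ε}
      (subst (s ℚ.≤_) (rearrange (approximation k) ε ((+ 2) ℚ./ suc k)) (Close.fst≤ (close-limit k)))) ,
    (λ k → subst (approximation k ℚ.≤_) (sym (ℚₚ.+-assoc s ε ((+ 2) ℚ./ suc k))) (Close.snd≤ (close-limit k)))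
    where
    rearrange : ∀ a b c → a ℚ.+ (b ℚ.+ c) ≡ a ℚ.+ c ℚ.+ b
    rearrange a b c = trans (cong (a ℚ.+_) (ℚₚ.+-comm b c)) (sym (ℚₚ.+-assoc a c b))

eventually : ∀ ε y μ .{{_ : NonZero y}} → y ≤ 2 * suc μ → (+ 2) ℚ./ y ℚ.+ (+ 1) ℚ./ y ℚ.≤ ε →
  ∃ λ n₀ → ∀ n .{{_ : NonZero n}} → n₀ ≤ n →
    fromℚ ((+ finiteCount n) ℚ./ n ℚ.- ε) ≤ℝ limit × limit ≤ℝ fromℚ ((+ finiteCount n) ℚ./ n ℚ.+ ε)
eventually ε y μ y≤ small = period y * y , λ n n≥ → near-limit ε y μ y≤ small n n≥

converges : (λ n → (+ finiteCount n) ℚ./ n) ⟶ limit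
converges ε 0<ε = let (q , 1/q≤ε) = positive-above ε 0<ε in
  -- The total error is 2 / y from n and 1 / y from the grid, so y = 3 (q + 1) keeps it within 1 /
  -- (q + 1).
  eventually ε (3 * suc q) (3 * suc q)
    (≤-trans (n≤1+n (3 * suc q)) (m≤m+n (suc (3 * suc q)) (suc (3 * suc q) + 0)))
    (ℚₚ.≤-trans (thirds (suc q) (3 * suc q) ≤-refl) 1/q≤ε)

finite-bounds : ∀ {f b n} u v w → f + b ≡ n → v + w ≡ u → (b * u ≤ n * v → n * w ≤ f * u) × (n * v ≤ b * u → f * u ≤ n * w)
finite-bounds {f} {b} {n} u v w refl refl =
  (λ le → +-cancelʳ-≤ (n * v) (n * w) (f * u) (≤-trans (≤-reflexive (shuffle f b v w)) (+-monoʳ-≤ (f * u) le))) ,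
  (λ le → +-cancelʳ-≤ (n * v) (f * u) (n * w) (≤-trans (+-monoʳ-≤ (f * u) le) (≤-reflexive (sym (shuffle f b v w)))))
  where
  shuffle : ∀ f b v w → (f + b) * w + (f + b) * v ≡ f * (v + w) + b * (v + w)
  shuffle = solve-∀

≤-slack : ∀ {p q} k → p ℚ.≤ q → p ℚ.≤ q ℚ.+ (+ 2) ℚ./ suc k
≤-slack {p} {q} k p≤q = ℚₚ.≤-trans p≤q (ℚₚ.≤-trans (ℚₚ.≤-reflexive (sym (ℚₚ.+-identityʳ q)))
  (ℚₚ.+-monoʳ-≤ q (/-mono 0 1 2 (suc k) z≤n)))

limit-lower : fromℚ ((+ 99999991254) ℚ./ 100000000000) ≤ℝ limit
limit-lower k = ≤-slack k (approximation-≥ 99999991254 100000000000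
  (λ n mod∣n → proj₁ (finite-bounds {count finite? n} {count infinite? n} 100000000000 8746 99999991254 (count-complement n) refl) (infinite-upper n mod∣n)) k)

limit-upper : limit ≤ℝ fromℚ ((+ 9999999153) ℚ./ 10000000000)
limit-upper k = ≤-slack k (approximation-≤ 9999999153 10000000000
  (λ n mod∣n → proj₂ (finite-bounds {count finite? n} {count infinite? n} 10000000000 847 9999999153 (count-complement n) refl) (infinite-lower n mod∣n)) k)

theorem1p5 : ((P : PrimeSet) → card P ≤ 4 → FiniteType P)
    × ((r : ℕ) → 5 ≤ r → Finite _≋_ (λ P → Primitive P × card P ≡ r))
    × (∃ λ (a : ℕ → ℕ) → (∀ n → HasCardinality (𝒜 n) (a n))
    × (∃ λ (L : ℝ) → ((λ n → + (a n) ℚ./ n) ⟶ L)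
    × fromℚ (+ 99999991254 ℚ./ 100000000000) ≤ℝ L
    × L ≤ℝ fromℚ (+ 9999999153 ℚ./ 10000000000)))
theorem1p5 = card≤4⇒finiteType , (λ r _ → primitive-finite r) ,
  finiteCount , finiteCount-cardinality , limit , converges , limit-lower , limit-upper
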